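{- Let $n\geq 1$ be an integer and let $p \leq n-1$ be a natural number. Then $$ \mathbf{R}(M_{\langle n,n,n\rangle}) \;\geq\; \left(3 - \frac{1}{p+1}\right) n^2 - \left(1 + 2p\binom{2p}{p-1}\right) n . $$ In particular, $\mathbf{R}(M_{\langle n,n,n\rangle}) \geq 3n^2 - o(n^2)$ as $n\to\infty$, i.e., there is a function $f:\mathbb{N}\to\mathbb{R}$ with $f(n)/n^2\to 0$ as $n\to\infty$ such that $\mathbf{R}(M_{\langle n,n,n\rangle}) \geq 3n^2 - f(n)$ for all $n\ge 1$.
   Context: All vector spaces and matrices are over the complex numbers $\mathbb{C}$. $M_{\langle n,n,n\rangle}: \mathrm{Mat}_{n\times n}(\mathbb{C})\times \mathrm{Mat}_{n\times n}(\mathbb{C})\to \mathrm{Mat}_{n\times n}(\mathbb{C})$ denotes the bilinear map $(X,Y)\mapsto XY$ (matrix multiplication). The rank $\mathbf{R}(T)$ of a bilinear map $T: U\times V\to W$ of finite-dimensional complex vector spaces is the smallest integer $r\ge 0$ such that there exist linear forms $u_1,\dots,u_r$ on $U$, linear forms $v_1,\dots,v_r$ on $V$, and vectors $w_1,\dots,w_r\in W$ with $T(x,y)=\sum_{i=1}^r u_i(x)v_i(y)w_i$ for all $x\in U$, $y\in V$. Binomial coefficients $\binom{a}{b}$ with $b<0$ are $0$. -}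

module Defs where

open import Algebra.Bundles using (CommutativeRing)
open import Algebra.Module.Bundles using (Module)
open import Algebra.Module.Morphism.Structures using (IsModuleHomomorphism)
open import Algebra.Structures using (IsCommutativeRing)
import Algebra.Construct.Pointwise as Pointwise
import Algebra.Module.Construct.TensorUnit as TensorUnit
import Algebra.Properties.Group as GroupProperties
import Algebra.Properties.Monoid.Sum as MonoidSum
import Algebra.Properties.Semiring.Sum as SemiringSum
open import Data.Fin.Base using (Fin)
open import Data.Integer.Base using (ℤ; +_; -[1+_])
open import Data.Nat.Base as ℕ using (ℕ; NonZero)
open import Data.Nat.Combinatorics using (_C_)
open import Data.Nat.Induction using (<-wellFounded)
import Data.Nat.Properties as ℕₚ
open import Data.Product.Base using (∃; _×_; _,_; proj₁; proj₂)
open import Data.Rational.Base as ℚ using (ℚ; 0ℚ; 1ℚ; ½; Positive)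
import Data.Rational.Properties as ℚₚ
open import Data.Rational.Solver using (module +-*-Solver)
open import Data.Sum.Base using (inj₁; inj₂)
open import Induction.WellFounded using (Acc; acc)
open import Level using (Level; 0ℓ; _⊔_) renaming (suc to lsuc)
open import Relation.Binary.PropositionalEquality using (_≡_; refl; sym; trans; cong; subst)
open import Relation.Nullary.Negation using (¬_)

module Estimates where

  open import Data.Rational.Base
  open +-*-Solver

  half>0 : ∀ {ε} → 0ℚ < ε → 0ℚ < ½ * ε
  half>0 {ε} ε>0 = ℚₚ.positive⁻¹ (½ * ε) {{ℚₚ.pos*pos⇒pos ½ ε {{positive ε>0}}}}

  half+half : ∀ ε → ½ * ε + ½ * ε ≡ ε
  half+half ε = trans (sym (ℚₚ.*-distribʳ-+ ε ½ ½)) (ℚₚ.*-identityˡ ε)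

  divide : ∀ {D ε} → 0ℚ < D → 0ℚ < ε → ∃ λ δ → 0ℚ < δ × D * δ ≡ ε
  divide {D} {ε} D>0 ε>0 = 1/D * ε , ℚₚ.positive⁻¹ (1/D * ε) {{ℚₚ.pos*pos⇒pos 1/D {{1/D>0}} ε {{positive ε>0}}}} , eq
    where
    instance
      D-pos : Positive D
      D-pos = positive D>0
      D-nonZero : ℚ.NonZero D
      D-nonZero = ℚₚ.pos⇒nonZero D
    1/D : ℚ
    1/D = 1/ D
    1/D>0 : Positive 1/D
    1/D>0 = ℚₚ.1/pos⇒pos D
    eq : D * (1/D * ε) ≡ ε
    eq = trans (sym (ℚₚ.*-assoc D 1/D ε)) (trans (cong (_* ε) (ℚₚ.*-inverseʳ D)) (ℚₚ.*-identityˡ ε))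

  ∣sum∣≤ : ∀ {a b α β} → ∣ a ∣ ≤ α → ∣ b ∣ ≤ β → ∣ a + b ∣ ≤ α + β
  ∣sum∣≤ {a} {b} p q = ℚₚ.≤-trans (ℚₚ.∣p+q∣≤∣p∣+∣q∣ a b) (ℚₚ.+-mono-≤ p q)

  ∣prod∣≤ : ∀ {a b α β} → ∣ a ∣ ≤ α → ∣ b ∣ ≤ β → ∣ a * b ∣ ≤ α * β
  ∣prod∣≤ {a} {b} {α} {β} p q = subst (_≤ α * β) (sym (ℚₚ.∣p*q∣≡∣p∣*∣q∣ a b))
    (ℚₚ.≤-trans
      (ℚₚ.*-monoʳ-≤-nonNeg ∣ b ∣ {{ℚₚ.∣-∣-nonNeg b}} p)
      (ℚₚ.*-monoˡ-≤-nonNeg α {{nonNegative (ℚₚ.≤-trans (ℚₚ.0≤∣p∣ a) p)}} q))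

  ∣swap∣ : ∀ a b → ∣ a - b ∣ ≡ ∣ b - a ∣
  ∣swap∣ a b = trans (cong ∣_∣ (solve 2 (λ a b → a :- b := :- (b :- a)) refl a b)) (ℚₚ.∣-p∣≡∣p∣ (b - a))

  diff-+ : ∀ a b a′ b′ → (a + b) - (a′ + b′) ≡ (a - a′) + (b - b′)
  diff-+ = solve 4 (λ a b a′ b′ → (a :+ b) :- (a′ :+ b′) := (a :- a′) :+ (b :- b′)) refl

  diff-neg : ∀ a b → (- a) - (- b) ≡ b - a
  diff-neg = solve 2 (λ a b → (:- a) :- (:- b) := b :- a) refl

  diff-* : ∀ a b a′ b′ → a * b - a′ * b′ ≡ a * (b - b′) + b′ * (a - a′)
  diff-* = solve 4 (λ a b a′ b′ → a :* b :- a′ :* b′ := a :* (b :- b′) :+ b′ :* (a :- a′)) refl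

  ∣diff-*∣≤ : ∀ {A B δ} a b a′ b′ → ∣ a ∣ ≤ A → ∣ b′ ∣ ≤ B → ∣ a - a′ ∣ ≤ δ → ∣ b - b′ ∣ ≤ δ →
              ∣ a * b - a′ * b′ ∣ ≤ (A + B) * δ
  ∣diff-*∣≤ {A} {B} {δ} a b a′ b′ a≤ b≤ da db = begin
    ∣ a * b - a′ * b′ ∣                ≡⟨ cong ∣_∣ (diff-* a b a′ b′) ⟩
    ∣ a * (b - b′) + b′ * (a - a′) ∣   ≤⟨ ∣sum∣≤ {a * (b - b′)} {b′ * (a - a′)} (∣prod∣≤ {a} {b - b′} a≤ db) (∣prod∣≤ {b′} {a - a′} b≤ da) ⟩
    A * δ + B * δ                      ≡⟨ ℚₚ.*-distribʳ-+ δ A B ⟨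
    (A + B) * δ                        ∎
    where open ℚₚ.≤-Reasoning

  ∣∣a∣-∣b∣∣≤∣a-b∣ : ∀ a b → ∣ ∣ a ∣ - ∣ b ∣ ∣ ≤ ∣ a - b ∣
  ∣∣a∣-∣b∣∣≤∣a-b∣ a b with ℚₚ.∣p∣≡p∨∣p∣≡-p (∣ a ∣ - ∣ b ∣)
  ... | inj₁ eq = subst (_≤ ∣ a - b ∣) (sym eq) (one-sided a b)
    where
    one-sided : ∀ a b → ∣ a ∣ - ∣ b ∣ ≤ ∣ a - b ∣
    one-sided a b = begin
      ∣ a ∣ - ∣ b ∣                 ≡⟨ cong (λ t → ∣ t ∣ - ∣ b ∣) (solve 2 (λ a b → a := (a :- b) :+ b) refl a b) ⟩
      ∣ (a - b) + b ∣ - ∣ b ∣       ≤⟨ ℚₚ.+-monoˡ-≤ (- ∣ b ∣) (ℚₚ.∣p+q∣≤∣p∣+∣q∣ (a - b) b) ⟩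
      ∣ a - b ∣ + ∣ b ∣ - ∣ b ∣     ≡⟨ solve 2 (λ c d → c :+ d :- d := c) refl ∣ a - b ∣ ∣ b ∣ ⟩
      ∣ a - b ∣                     ∎
      where open ℚₚ.≤-Reasoning
  ... | inj₂ eq = subst (_≤ ∣ a - b ∣) (sym eq) (begin
      - (∣ a ∣ - ∣ b ∣)             ≡⟨ solve 2 (λ c d → :- (c :- d) := d :- c) refl ∣ a ∣ ∣ b ∣ ⟩
      ∣ b ∣ - ∣ a ∣                 ≡⟨ cong (λ t → ∣ t ∣ - ∣ a ∣) (solve 2 (λ a b → b := (b :- a) :+ a) refl a b) ⟩
      ∣ (b - a) + a ∣ - ∣ a ∣       ≤⟨ ℚₚ.+-monoˡ-≤ (- ∣ a ∣) (ℚₚ.∣p+q∣≤∣p∣+∣q∣ (b - a) a) ⟩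
      ∣ b - a ∣ + ∣ a ∣ - ∣ a ∣     ≡⟨ solve 2 (λ c d → c :+ d :- d := c) refl ∣ b - a ∣ ∣ a ∣ ⟩
      ∣ b - a ∣                     ≡⟨ ∣swap∣ b a ⟩
      ∣ a - b ∣                     ∎)
      where open ℚₚ.≤-Reasoning

open Estimates

-- The real numbers: Cauchy sequences of rationals.  Two sequences
-- represent the same real number when their difference tends to 0, so
-- equality on ℝ is the relation _≈ᴿ_, not _≡_.  Eta is switched off so
-- that the type checker does not compare the cauchy fields, which is slow.

record ℝ : Set where
  no-eta-equality
  constructor mkℝ
  field
    seq    : ℕ → ℚ
    cauchy : ∀ ε → 0ℚ ℚ.< ε → ∃ λ N → ∀ m n → N ℕ.≤ m → N ℕ.≤ n → ℚ.∣ seq m ℚ.- seq n ∣ ℚ.≤ ε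

open ℝ public

infix 4 _≈ᴿ_ _≤ᴿ_ _<ᴿ_

-- A record rather than a function, so that x and y can be inferred from
-- a proof of x ≈ᴿ y.
record _≈ᴿ_ (x y : ℝ) : Set where
  constructor mk≈
  field
    close : ∀ ε → 0ℚ ℚ.< ε → ∃ λ N → ∀ n → N ℕ.≤ n → ℚ.∣ seq x n ℚ.- seq y n ∣ ℚ.≤ ε

open _≈ᴿ_ public

_≤ᴿ_ : ℝ → ℝ → Set
x ≤ᴿ y = ∀ ε → 0ℚ ℚ.< ε → ∃ λ N → ∀ n → N ℕ.≤ n → seq x n ℚ.≤ seq y n ℚ.+ ε

_<ᴿ_ : ℝ → ℝ → Set
x <ᴿ y = ∃ λ ε → 0ℚ ℚ.< ε × ∃ λ N → ∀ n → N ℕ.≤ n → seq x n ℚ.+ ε ℚ.≤ seq y n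

pointwise : ∀ {x y} → (∀ n → seq x n ≡ seq y n) → x ≈ᴿ y
pointwise {x} {y} eq = mk≈ λ ε ε>0 → 0 , λ n _ → subst (λ t → ℚ.∣ t ∣ ℚ.≤ ε)
  (trans (sym (ℚₚ.+-inverseʳ (seq y n))) (cong (ℚ._- seq y n) (sym (eq n)))) (ℚₚ.<⇒≤ ε>0)

≈ᴿ-refl : ∀ {x} → x ≈ᴿ x
≈ᴿ-refl {x} = pointwise {x} {x} (λ _ → refl)

≈ᴿ-sym : ∀ {x y} → x ≈ᴿ y → y ≈ᴿ x
≈ᴿ-sym {x} {y} x≈y = mk≈ λ ε ε>0 →
  let (N , h) = close x≈y ε ε>0
  in N , λ n N≤n → subst (ℚ._≤ ε) (∣swap∣ (seq x n) (seq y n)) (h n N≤n)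

private
  lub : ∀ {M N n} → M ℕ.⊔ N ℕ.≤ n → (M ℕ.≤ n) × (N ℕ.≤ n)
  lub {M} {N} p = ℕₚ.≤-trans (ℕₚ.m≤m⊔n M N) p , ℕₚ.≤-trans (ℕₚ.m≤n⊔m M N) p

≈ᴿ-trans : ∀ {x y z} → x ≈ᴿ y → y ≈ᴿ z → x ≈ᴿ z
≈ᴿ-trans {x} {y} {z} x≈y y≈z = mk≈ λ ε ε>0 →
  let (M , h) = close x≈y (½ ℚ.* ε) (half>0 ε>0)
      (N , k) = close y≈z (½ ℚ.* ε) (half>0 ε>0)
  in M ℕ.⊔ N , λ n le → subst (ℚ._≤ ε) (cong ℚ.∣_∣ (telescope (seq x n) (seq y n) (seq z n)))
    (subst (_ ℚ.≤_) (half+half ε)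
      (∣sum∣≤ {seq x n ℚ.- seq y n} {seq y n ℚ.- seq z n} (h n (proj₁ (lub le))) (k n (proj₂ (lub {M} le)))))
  where
  open +-*-Solver
  telescope : ∀ a b c → (a ℚ.- b) ℚ.+ (b ℚ.- c) ≡ a ℚ.- c
  telescope = solve 3 (λ a b c → (a :- b) :+ (b :- c) := a :- c) refl

fromℚ : ℚ → ℝ
seq    (fromℚ q) _ = q
cauchy (fromℚ q) ε ε>0 = 0 , λ _ _ _ _ → subst (λ t → ℚ.∣ t ∣ ℚ.≤ ε) (sym (ℚₚ.+-inverseʳ q)) (ℚₚ.<⇒≤ ε>0)

0ᴿ 1ᴿ : ℝ
0ᴿ = fromℚ 0ℚ
1ᴿ = fromℚ 1ℚ

infixl 6 _+ᴿ_ _-ᴿ_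
infixl 7 _*ᴿ_
infix  8 -ᴿ_

_+ᴿ_ : ℝ → ℝ → ℝ
seq    (x +ᴿ y) n = seq x n ℚ.+ seq y n
cauchy (x +ᴿ y) ε ε>0 =
  let (M , h) = cauchy x (½ ℚ.* ε) (half>0 ε>0)
      (N , k) = cauchy y (½ ℚ.* ε) (half>0 ε>0)
  in M ℕ.⊔ N , λ m n p q →
  subst (ℚ._≤ ε) (cong ℚ.∣_∣ (sym (diff-+ (seq x m) (seq y m) (seq x n) (seq y n))))
    (subst (_ ℚ.≤_) (half+half ε)
      (∣sum∣≤ {seq x m ℚ.- seq x n} {seq y m ℚ.- seq y n}
        (h m n (proj₁ (lub p)) (proj₁ (lub q))) (k m n (proj₂ (lub {M} p)) (proj₂ (lub {M} q)))))

-ᴿ_ : ℝ → ℝ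
seq    (-ᴿ x) n = ℚ.- seq x n
cauchy (-ᴿ x) ε ε>0 =
  let (N , h) = cauchy x ε ε>0
  in N , λ m n p q →
  subst (ℚ._≤ ε) (cong ℚ.∣_∣ (sym (diff-neg (seq x m) (seq x n)))) (h n m q p)

_-ᴿ_ : ℝ → ℝ → ℝ
x -ᴿ y = x +ᴿ -ᴿ y

eventually-bounded : ∀ x → ∃ λ B → 0ℚ ℚ.< B × ∃ λ N → ∀ n → N ℕ.≤ n → ℚ.∣ seq x n ∣ ℚ.≤ B
eventually-bounded x =
  let (N , h) = cauchy x 1ℚ (ℚₚ.positive⁻¹ 1ℚ)
      b = ℚ.∣ seq x N ∣
  in 1ℚ ℚ.+ b , ℚₚ.+-mono-<-≤ (ℚₚ.positive⁻¹ 1ℚ) (ℚₚ.0≤∣p∣ (seq x N)) , N , λ n N≤n →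
    subst (ℚ._≤ 1ℚ ℚ.+ b) (cong ℚ.∣_∣ (cancel (seq x n) (seq x N)))
      (∣sum∣≤ {seq x n ℚ.- seq x N} {seq x N} (h n N N≤n ℕₚ.≤-refl) ℚₚ.≤-refl)
  where
  open +-*-Solver
  cancel : ∀ a c → (a ℚ.- c) ℚ.+ c ≡ a
  cancel = solve 2 (λ a c → (a :- c) :+ c := a) refl

_*ᴿ_ : ℝ → ℝ → ℝ
seq    (x *ᴿ y) n = seq x n ℚ.* seq y n
cauchy (x *ᴿ y) ε ε>0 =
  let (A , A>0 , M₁ , bx) = eventually-bounded x
      (B , B>0 , M₂ , by) = eventually-bounded y
      (δ , δ>0 , eq) = divide (ℚₚ.+-mono-< A>0 B>0) ε>0
      (N₁ , h) = cauchy x δ δ>0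
      (N₂ , k) = cauchy y δ δ>0
  in (M₁ ℕ.⊔ M₂) ℕ.⊔ (N₁ ℕ.⊔ N₂) , λ m n p q → subst (_ ℚ.≤_) eq
  (∣diff-*∣≤ (seq x m) (seq y m) (seq x n) (seq y n)
    (bx m (proj₁ (lub (proj₁ (lub p))))) (by n (proj₂ (lub {M₁} (proj₁ (lub q)))))
    (h m n (proj₁ (lub (proj₂ (lub {M₁ ℕ.⊔ M₂} p)))) (proj₁ (lub (proj₂ (lub {M₁ ℕ.⊔ M₂} q)))))
    (k m n (proj₂ (lub {N₁} (proj₂ (lub {M₁ ℕ.⊔ M₂} p)))) (proj₂ (lub {N₁} (proj₂ (lub {M₁ ℕ.⊔ M₂} q))))))

∣_∣ᴿ : ℝ → ℝ
seq    ∣ x ∣ᴿ n = ℚ.∣ seq x n ∣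
cauchy ∣ x ∣ᴿ ε ε>0 =
  let (N , h) = cauchy x ε ε>0
  in N , λ m n p q → ℚₚ.≤-trans (∣∣a∣-∣b∣∣≤∣a-b∣ (seq x m) (seq x n)) (h m n p q)

+ᴿ-cong : ∀ {x x′ y y′} → x ≈ᴿ x′ → y ≈ᴿ y′ → x +ᴿ y ≈ᴿ x′ +ᴿ y′
+ᴿ-cong {x} {x′} {y} {y′} p q = mk≈ λ ε ε>0 →
  let (M , h) = close p (½ ℚ.* ε) (half>0 ε>0)
      (N , k) = close q (½ ℚ.* ε) (half>0 ε>0)
  in M ℕ.⊔ N , λ n le →
  subst (ℚ._≤ ε) (cong ℚ.∣_∣ (sym (diff-+ (seq x n) (seq y n) (seq x′ n) (seq y′ n))))
    (subst (_ ℚ.≤_) (half+half ε)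
      (∣sum∣≤ {seq x n ℚ.- seq x′ n} {seq y n ℚ.- seq y′ n} (h n (proj₁ (lub le))) (k n (proj₂ (lub {M} le)))))

-ᴿ-cong : ∀ {x y} → x ≈ᴿ y → -ᴿ x ≈ᴿ -ᴿ y
-ᴿ-cong {x} {y} p = mk≈ λ ε ε>0 →
  let (N , h) = close p ε ε>0
  in N , λ n N≤n →
  subst (ℚ._≤ ε) (trans (∣swap∣ (seq x n) (seq y n)) (cong ℚ.∣_∣ (sym (diff-neg (seq x n) (seq y n))))) (h n N≤n)

*ᴿ-cong : ∀ {x x′ y y′} → x ≈ᴿ x′ → y ≈ᴿ y′ → x *ᴿ y ≈ᴿ x′ *ᴿ y′
*ᴿ-cong {x} {x′} {y} {y′} p q = mk≈ λ ε ε>0 →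
  let (A , A>0 , M₁ , bx) = eventually-bounded x
      (B , B>0 , M₂ , by) = eventually-bounded y′
      (δ , δ>0 , eq) = divide (ℚₚ.+-mono-< A>0 B>0) ε>0
      (N₁ , h) = close p δ δ>0
      (N₂ , k) = close q δ δ>0
  in (M₁ ℕ.⊔ M₂) ℕ.⊔ (N₁ ℕ.⊔ N₂) , λ n le → subst (_ ℚ.≤_) eq
  (∣diff-*∣≤ (seq x n) (seq y n) (seq x′ n) (seq y′ n)
    (bx n (proj₁ (lub (proj₁ (lub le))))) (by n (proj₂ (lub {M₁} (proj₁ (lub le)))))
    (h n (proj₁ (lub (proj₂ (lub {M₁ ℕ.⊔ M₂} le)))))
    (k n (proj₂ (lub {N₁} (proj₂ (lub {M₁ ℕ.⊔ M₂} le))))))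

infix 4 _≈ᶜ_

record ℂ : Set where
  constructor _+i_
  field
    re im : ℝ

open ℂ public

_≈ᶜ_ : ℂ → ℂ → Set
z ≈ᶜ w = re z ≈ᴿ re w × im z ≈ᴿ im w

infixl 6 _+ᶜ_
infixl 7 _*ᶜ_
infix  8 -ᶜ_

0ᶜ 1ᶜ : ℂ
0ᶜ = 0ᴿ +i 0ᴿ
1ᶜ = 1ᴿ +i 0ᴿ

_+ᶜ_ _*ᶜ_ : ℂ → ℂ → ℂ
(a +i b) +ᶜ (c +i d) = (a +ᴿ c) +i (b +ᴿ d)
(a +i b) *ᶜ (c +i d) = (a *ᴿ c -ᴿ b *ᴿ d) +i (a *ᴿ d +ᴿ b *ᴿ c)

-ᶜ_ : ℂ → ℂ
-ᶜ (a +i b) = (-ᴿ a) +i (-ᴿ b)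

ℂ-isCommutativeRing : IsCommutativeRing _≈ᶜ_ _+ᶜ_ _*ᶜ_ -ᶜ_ 0ᶜ 1ᶜ
ℂ-isCommutativeRing = record
  { isRing = record
    { +-isAbelianGroup = record
      { isGroup = record
        { isMonoid = record
          { isSemigroup = record
            { isMagma = record
              { isEquivalence = record
                { refl  = λ {z} → ≈ᴿ-refl {re z} , ≈ᴿ-refl {im z}
                ; sym   = λ {z} {w} p → ≈ᴿ-sym {re z} {re w} (proj₁ p) , ≈ᴿ-sym {im z} {im w} (proj₂ p)
                ; trans = λ {z} {w} {v} p q → ≈ᴿ-trans {re z} {re w} {re v} (proj₁ p) (proj₁ q)
                                            , ≈ᴿ-trans {im z} {im w} {im v} (proj₂ p) (proj₂ q)
                }
              ; ∙-cong = λ {z} {z′} {w} {w′} p q →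
                  +ᴿ-cong {re z} {re z′} {re w} {re w′} (proj₁ p) (proj₁ q)
                , +ᴿ-cong {im z} {im z′} {im w} {im w′} (proj₂ p) (proj₂ q)
              }
            ; assoc = λ z w v →
                pointwise (λ n → ℚₚ.+-assoc (seq (re z) n) (seq (re w) n) (seq (re v) n))
              , pointwise (λ n → ℚₚ.+-assoc (seq (im z) n) (seq (im w) n) (seq (im v) n))
            }
          ; identity = (λ z → pointwise (λ n → ℚₚ.+-identityˡ (seq (re z) n)) , pointwise (λ n → ℚₚ.+-identityˡ (seq (im z) n)))
                     , (λ z → pointwise (λ n → ℚₚ.+-identityʳ (seq (re z) n)) , pointwise (λ n → ℚₚ.+-identityʳ (seq (im z) n)))
          }
        ; inverse = (λ z → pointwise (λ n → ℚₚ.+-inverseˡ (seq (re z) n)) , pointwise (λ n → ℚₚ.+-inverseˡ (seq (im z) n)))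
                  , (λ z → pointwise (λ n → ℚₚ.+-inverseʳ (seq (re z) n)) , pointwise (λ n → ℚₚ.+-inverseʳ (seq (im z) n)))
        ; ⁻¹-cong = λ {z} {w} p → -ᴿ-cong {re z} {re w} (proj₁ p) , -ᴿ-cong {im z} {im w} (proj₂ p)
        }
      ; comm = λ z w → pointwise (λ n → ℚₚ.+-comm (seq (re z) n) (seq (re w) n))
                     , pointwise (λ n → ℚₚ.+-comm (seq (im z) n) (seq (im w) n))
      }
    ; *-cong = λ {z} {z′} {w} {w′} → *ᶜ-cong {z} {z′} {w} {w′}
    ; *-assoc = λ (a +i b) (c +i d) (e +i f) →
        pointwise (λ n → assoc-re (seq a n) (seq b n) (seq c n) (seq d n) (seq e n) (seq f n))
      , pointwise (λ n → assoc-im (seq a n) (seq b n) (seq c n) (seq d n) (seq e n) (seq f n))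
    ; *-identity =
        (λ (a +i b) → pointwise (λ n → idˡ-re (seq a n) (seq b n)) , pointwise (λ n → idˡ-im (seq a n) (seq b n)))
      , (λ (a +i b) → pointwise (λ n → idʳ-re (seq a n) (seq b n)) , pointwise (λ n → idʳ-im (seq a n) (seq b n)))
    ; distrib =
        (λ (a +i b) (c +i d) (e +i f) →
            pointwise (λ n → distribˡ-re (seq a n) (seq b n) (seq c n) (seq d n) (seq e n) (seq f n))
          , pointwise (λ n → distribˡ-im (seq a n) (seq b n) (seq c n) (seq d n) (seq e n) (seq f n)))
      , (λ (a +i b) (c +i d) (e +i f) →
            pointwise (λ n → distribʳ-re (seq a n) (seq b n) (seq c n) (seq d n) (seq e n) (seq f n))
          , pointwise (λ n → distribʳ-im (seq a n) (seq b n) (seq c n) (seq d n) (seq e n) (seq f n)))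
    }
  ; *-comm = λ (a +i b) (c +i d) →
        pointwise (λ n → comm-re (seq a n) (seq b n) (seq c n) (seq d n))
      , pointwise (λ n → comm-im (seq a n) (seq b n) (seq c n) (seq d n))
  }
  where
  open +-*-Solver
  open import Data.Rational.Base using (_+_; _*_; _-_)

  *ᶜ-cong : ∀ {z z′ w w′} → z ≈ᶜ z′ → w ≈ᶜ w′ → z *ᶜ w ≈ᶜ z′ *ᶜ w′
  *ᶜ-cong {a +i b} {a′ +i b′} {c +i d} {c′ +i d′} (a≈ , b≈) (c≈ , d≈) =
      +ᴿ-cong {a *ᴿ c} {a′ *ᴿ c′} { -ᴿ (b *ᴿ d)} { -ᴿ (b′ *ᴿ d′)}
        (*ᴿ-cong {a} {a′} {c} {c′} a≈ c≈)
        (-ᴿ-cong {b *ᴿ d} {b′ *ᴿ d′} (*ᴿ-cong {b} {b′} {d} {d′} b≈ d≈))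
    , +ᴿ-cong {a *ᴿ d} {a′ *ᴿ d′} {b *ᴿ c} {b′ *ᴿ c′}
        (*ᴿ-cong {a} {a′} {d} {d′} a≈ d≈) (*ᴿ-cong {b} {b′} {c} {c′} b≈ c≈)

  assoc-re : ∀ a b c d e f → (a * c - b * d) * e - (a * d + b * c) * f ≡ a * (c * e - d * f) - b * (c * f + d * e)
  assoc-re = solve 6 (λ a b c d e f →
    (a :* c :- b :* d) :* e :- (a :* d :+ b :* c) :* f := a :* (c :* e :- d :* f) :- b :* (c :* f :+ d :* e)) refl

  assoc-im : ∀ a b c d e f → (a * c - b * d) * f + (a * d + b * c) * e ≡ a * (c * f + d * e) + b * (c * e - d * f)
  assoc-im = solve 6 (λ a b c d e f →
    (a :* c :- b :* d) :* f :+ (a :* d :+ b :* c) :* e := a :* (c :* f :+ d :* e) :+ b :* (c :* e :- d :* f)) refl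

  idˡ-re : ∀ a b → 1ℚ * a - 0ℚ * b ≡ a
  idˡ-re = solve 2 (λ a b → con 1ℚ :* a :- con 0ℚ :* b := a) refl

  idˡ-im : ∀ a b → 1ℚ * b + 0ℚ * a ≡ b
  idˡ-im = solve 2 (λ a b → con 1ℚ :* b :+ con 0ℚ :* a := b) refl

  idʳ-re : ∀ a b → a * 1ℚ - b * 0ℚ ≡ a
  idʳ-re = solve 2 (λ a b → a :* con 1ℚ :- b :* con 0ℚ := a) refl

  idʳ-im : ∀ a b → a * 0ℚ + b * 1ℚ ≡ b
  idʳ-im = solve 2 (λ a b → a :* con 0ℚ :+ b :* con 1ℚ := b) refl

  distribˡ-re : ∀ a b c d e f → a * (c + e) - b * (d + f) ≡ (a * c - b * d) + (a * e - b * f)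
  distribˡ-re = solve 6 (λ a b c d e f →
    a :* (c :+ e) :- b :* (d :+ f) := (a :* c :- b :* d) :+ (a :* e :- b :* f)) refl

  distribˡ-im : ∀ a b c d e f → a * (d + f) + b * (c + e) ≡ (a * d + b * c) + (a * f + b * e)
  distribˡ-im = solve 6 (λ a b c d e f →
    a :* (d :+ f) :+ b :* (c :+ e) := (a :* d :+ b :* c) :+ (a :* f :+ b :* e)) refl

  distribʳ-re : ∀ a b c d e f → (c + e) * a - (d + f) * b ≡ (c * a - d * b) + (e * a - f * b)
  distribʳ-re = solve 6 (λ a b c d e f →
    (c :+ e) :* a :- (d :+ f) :* b := (c :* a :- d :* b) :+ (e :* a :- f :* b)) refl

  distribʳ-im : ∀ a b c d e f → (c + e) * b + (d + f) * a ≡ (c * b + d * a) + (e * b + f * a)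
  distribʳ-im = solve 6 (λ a b c d e f →
    (c :+ e) :* b :+ (d :+ f) :* a := (c :* b :+ d :* a) :+ (e :* b :+ f :* a)) refl

  comm-re : ∀ a b c d → a * c - b * d ≡ c * a - d * b
  comm-re = solve 4 (λ a b c d → a :* c :- b :* d := c :* a :- d :* b) refl

  comm-im : ∀ a b c d → a * d + b * c ≡ c * b + d * a
  comm-im = solve 4 (λ a b c d → a :* d :+ b :* c := c :* b :+ d :* a) refl

ℂ-commutativeRing : CommutativeRing 0ℓ 0ℓ
ℂ-commutativeRing = record { isCommutativeRing = ℂ-isCommutativeRing }

-- The scalars K are abstract here and are instantiated with ℂ at the end.
-- Linear maps are module homomorphisms, which include respect for ≈.

module Linear {c ℓ : Level} (K : CommutativeRing c ℓ) where

  private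
    module K = CommutativeRing K

  VectorSpace : Set (lsuc (c ⊔ ℓ))
  VectorSpace = Module K c ℓ

  open Module using (Carrierᴹ; rawModule)

  IsLinear : (U W : VectorSpace) → (Carrierᴹ U → Carrierᴹ W) → Set (c ⊔ ℓ)
  IsLinear U W = IsModuleHomomorphism (rawModule U) (rawModule W)

  record LinearForm (U : VectorSpace) : Set (c ⊔ ℓ) where
    field
      form     : Carrierᴹ U → K.Carrier
      isLinear : IsLinear U TensorUnit.⟨module⟩ form

  open LinearForm public

  record BilinearMap (U V W : VectorSpace) : Set (c ⊔ ℓ) where
    field
      map       : Carrierᴹ U → Carrierᴹ V → Carrierᴹ W
      isLinearˡ : ∀ y → IsLinear U W (λ x → map x y)
      isLinearʳ : ∀ x → IsLinear V W (λ y → map x y)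

  open BilinearMap public

  record RankDecomposition {U V W : VectorSpace} (T : BilinearMap U V W) (r : ℕ) : Set (c ⊔ ℓ) where
    private
      module W = Module W
    open MonoidSum W.+ᴹ-monoid using (sum)
    field
      u : Fin r → LinearForm U
      v : Fin r → LinearForm V
      w : Fin r → Carrierᴹ W
      decomposes : ∀ x y → map T x y W.≈ᴹ sum (λ i → (form (u i) x K.* form (v i) y) W.*ₗ w i)

  -- r is the rank of T.  A least r exists only classically (see
  -- rank-exists below), so the rank is a predicate on r and not a
  -- function of T.
  IsRank : {U V W : VectorSpace} → BilinearMap U V W → ℕ → Set (c ⊔ ℓ)
  IsRank T r = RankDecomposition T r × (∀ s → RankDecomposition T s → r ℕ.≤ s)

  rank-exists : {U V W : VectorSpace} (T : BilinearMap U V W) →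
                ∀ s → RankDecomposition T s → ¬ ¬ ∃ (IsRank T)
  rank-exists T s d no-rank = go s (<-wellFounded s) d
    where
    go : ∀ s → Acc ℕ._<_ s → ¬ RankDecomposition T s
    go s (acc rs) d = no-rank (s , d , λ t e → ℕₚ.≮⇒≥ (λ t<s → go t (rs t<s) e))

  -- Preservation of 0 and of negation follows from the other laws.
  mkLinear : ∀ (U W : VectorSpace) (f : Carrierᴹ U → Carrierᴹ W) →
             (∀ {x y} → Module._≈ᴹ_ U x y → Module._≈ᴹ_ W (f x) (f y)) →
             (∀ x y → Module._≈ᴹ_ W (f (Module._+ᴹ_ U x y)) (Module._+ᴹ_ W (f x) (f y))) →
             (∀ a x → Module._≈ᴹ_ W (f (Module._*ₗ_ U a x)) (Module._*ₗ_ W a (f x))) →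
             IsLinear U W f
  mkLinear U W f f-cong f-+ f-* = record
    { isBimoduleHomomorphism = record
      { +ᴹ-isGroupHomomorphism = record
        { isMonoidHomomorphism = record
          { isMagmaHomomorphism = record
            { isRelHomomorphism = record { cong = f-cong }
            ; homo = f-+
            }
          ; ε-homo = f-0
          }
        ; ⁻¹-homo = λ x → GroupProperties.inverseˡ-unique W.+ᴹ-group (f (U.-ᴹ x)) (f x)
            (W.≈ᴹ-trans (W.≈ᴹ-sym (f-+ (U.-ᴹ x) x)) (W.≈ᴹ-trans (f-cong (U.-ᴹ‿inverseˡ x)) f-0))
        }
      ; *ₗ-homo = f-*
      ; *ᵣ-homo = λ a x → W.≈ᴹ-trans (f-cong (U.≈ᴹ-sym (U.*ₗ-*ᵣ-coincident a x)))
                            (W.≈ᴹ-trans (f-* a x) (W.*ₗ-*ᵣ-coincident a (f x)))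
      }
    }
    where
    module U = Module U
    module W = Module W
    f-0 : f U.0ᴹ W.≈ᴹ W.0ᴹ
    f-0 = W.≈ᴹ-trans (f-cong (U.≈ᴹ-sym (U.*ₗ-zeroˡ U.0ᴹ)))
            (W.≈ᴹ-trans (f-* K.0# U.0ᴹ) (W.*ₗ-zeroˡ (f U.0ᴹ)))

  Mat : ℕ → ℕ → VectorSpace
  Mat m n = record
    { Carrierᴹ = Fin m → Fin n → K.Carrier
    ; _≈ᴹ_ = λ X Y → ∀ i j → X i j K.≈ Y i j
    ; _+ᴹ_ = λ X Y i j → X i j K.+ Y i j
    ; _*ₗ_ = λ a X i j → a K.* X i j
    ; _*ᵣ_ = λ X a i j → X i j K.* a
    ; 0ᴹ   = λ _ _ → K.0#
    ; -ᴹ_  = λ X i j → K.- X i j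
    ; isModule = record
      { isBimodule = record
        { isBisemimodule = record
          { +ᴹ-isCommutativeMonoid =
              Pointwise.isCommutativeMonoid (Fin m) (Pointwise.isCommutativeMonoid (Fin n) K.+-isCommutativeMonoid)
          ; isPreleftSemimodule = record
            { *ₗ-cong      = λ a≈b X≈Y i j → K.*-cong a≈b (X≈Y i j)
            ; *ₗ-zeroˡ     = λ X i j → K.zeroˡ (X i j)
            ; *ₗ-distribʳ  = λ X a b i j → K.distribʳ (X i j) a b
            ; *ₗ-identityˡ = λ X i j → K.*-identityˡ (X i j)
            ; *ₗ-assoc     = λ a b X i j → K.*-assoc a b (X i j)
            ; *ₗ-zeroʳ     = λ a i j → K.zeroʳ a
            ; *ₗ-distribˡ  = λ a X Y i j → K.distribˡ a (X i j) (Y i j)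
            }
          ; isPrerightSemimodule = record
            { *ᵣ-cong      = λ X≈Y a≈b i j → K.*-cong (X≈Y i j) a≈b
            ; *ᵣ-zeroʳ     = λ X i j → K.zeroʳ (X i j)
            ; *ᵣ-distribˡ  = λ X a b i j → K.distribˡ (X i j) a b
            ; *ᵣ-identityʳ = λ X i j → K.*-identityʳ (X i j)
            ; *ᵣ-assoc     = λ X a b i j → K.*-assoc (X i j) a b
            ; *ᵣ-zeroˡ     = λ a i j → K.zeroˡ a
            ; *ᵣ-distribʳ  = λ a X Y i j → K.distribʳ a (X i j) (Y i j)
            }
          ; *ₗ-*ᵣ-assoc = λ a X b i j → K.*-assoc a (X i j) b
          }
        ; -ᴹ‿cong    = λ X≈Y i j → K.-‿cong (X≈Y i j)
        ; -ᴹ‿inverse = (λ X i j → K.-‿inverseˡ (X i j)) , (λ X i j → K.-‿inverseʳ (X i j))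
        }
      ; *ₗ-*ᵣ-coincident = λ a X i j → K.*-comm a (X i j)
      }
    }

  matrixMultiplication : ∀ l m n → BilinearMap (Mat l m) (Mat m n) (Mat l n)
  matrixMultiplication l m n = record
    { map = mul
    ; isLinearˡ = λ Y → mkLinear (Mat l m) (Mat l n) (λ X → mul X Y)
        (λ X≈X′ i k → sum-cong-≋ (λ j → K.*-congʳ (X≈X′ i j)))
        (λ X X′ i k → K.trans (sum-cong-≋ (λ j → K.distribʳ (Y j k) (X i j) (X′ i j)))
                        (∑-distrib-+ (λ j → X i j K.* Y j k) (λ j → X′ i j K.* Y j k)))
        (λ a X i k → K.trans (sum-cong-≋ (λ j → K.*-assoc a (X i j) (Y j k)))
                       (K.sym (*-distribˡ-sum a (λ j → X i j K.* Y j k))))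
    ; isLinearʳ = λ X → mkLinear (Mat m n) (Mat l n) (λ Y → mul X Y)
        (λ Y≈Y′ i k → sum-cong-≋ (λ j → K.*-congˡ (Y≈Y′ j k)))
        (λ Y Y′ i k → K.trans (sum-cong-≋ (λ j → K.distribˡ (X i j) (Y j k) (Y′ j k)))
                        (∑-distrib-+ (λ j → X i j K.* Y j k) (λ j → X i j K.* Y′ j k)))
        (λ a Y i k → K.trans (sum-cong-≋ (λ j → x∙yz≈y∙xz (X i j) a (Y j k)))
                       (K.sym (*-distribˡ-sum a (λ j → X i j K.* Y j k))))
    }
    where
    open SemiringSum K.semiring using (sum; sum-cong-≋; ∑-distrib-+; *-distribˡ-sum)
    mul : (Fin l → Fin m → K.Carrier) → (Fin m → Fin n → K.Carrier) → Fin l → Fin n → K.Carrier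
    mul X Y i k = sum (λ j → X i j K.* Y j k)
    x∙yz≈y∙xz : ∀ x y z → x K.* (y K.* z) K.≈ y K.* (x K.* z)
    x∙yz≈y∙xz x y z = K.trans (K.sym (K.*-assoc x y z)) (K.trans (K.*-congʳ (K.*-comm x y)) (K.*-assoc y x z))

open Linear ℂ-commutativeRing public

M⟨_,_,_⟩ : ∀ l m n → BilinearMap (Mat l m) (Mat m n) (Mat l n)
M⟨ l , m , n ⟩ = matrixMultiplication l m n

ℕ→ℚ : ℕ → ℚ
ℕ→ℚ n = + n ℚ./ 1

binomial : ℕ → ℤ → ℕ
binomial a (+ b)    = a C b
binomial a -[1+ _ ] = 0

-- f(n)/n² → 0 as n → ∞; the value at n = 0 plays no role.
IsLittleO-n² : (ℕ → ℝ) → Set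
IsLittleO-n² f = ∀ ε → 0ᴿ <ᴿ ε → ∃ λ N → ∀ n .{{_ : NonZero n}} → N ℕ.≤ n →
  ∣ f n *ᴿ fromℚ (ℚ._/_ (+ 1) (n ℕ.* n) {{ℕₚ.m*n≢0 n n}}) ∣ᴿ <ᴿ ε

{-# OPTIONS --safe #-}
module Submission where

-- Write X Y = Σ_{l < r} u_l(X) v_l(Y) w_l. The forms u_l span the dual of Mat; choose n² of them
-- forming a basis, with dual basis b_k. A polynomial of degree d on Mat that does not vanish has a
-- non-zero already on the span of some d of the b_k, and there at least n² - d of the terms vanish.
-- Applied to det, this yields an invertible X₀ at the cost of n basis vectors. Let D be the Koszul
-- map Σ e_j ∧ X₀⁻¹X_j on Λ(K^2p) ⊗ K^n. The map D² : Λ^(p-1) ⊗ K^n → Λ^(p+1) ⊗ K^n is quadratic in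
-- X₁, …, X_2p, so if it is injective for one choice of them, it is injective for a choice in the
-- span of 2 n C(2p, p-1) basis vectors. By a Schur complement, the Koszul map of X₀, …, X_2p is then
-- injective on Λ^p(K^(2p+1)) ⊗ Mat. A rank one term contributes the exterior multiplication by a
-- vector, of rank C(2p, p), to this map, so at least n² C(2p+1, p) / C(2p, p) terms survive.
--
-- For one good choice, take n = m 2^(p-1) and K^n = K^m ⊗ K^2 ⊗ ⋯ ⊗ K^2, with a pair of matrices
-- on each factor whose commutator is diagonal and invertible. Then D² is the multiplication by a
-- symplectic form in each coordinate and hard Lefschetz applies. Other n are treated by ignoring
-- the remainder modulo 2^(p-1), and n < 2^p by the case p = 0.

open import Algebra.Bundles using (CommutativeRing)
open import Level using (Level)

-- The constant 3 - 1/(p+1) is 1 + (2p+1)/(p+1): the basis accounts for n² terms, which vanish apart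
-- from those spent on X₀, ..., X_2p, and n² C(2p+1, p) / C(2p, p) = n² (2p+1)/(p+1) further terms
-- have to survive. The spent terms are the linear error: a determinant of size n with linear
-- entries, and one of size n C(2p, p-1) with quadratic entries, whence its factor 2. With Zᵢ =
-- X₀⁻¹Xᵢ, D² is multiplication by the 2-form with coefficients [Zᵢ, Zⱼ], so commuting matrices are
-- useless. If the Zᵢ commute except within p disjoint pairs, this 2-form is symplectic when the p
-- commutators are invertible. Λ^(p-1) → Λ^(p+1) is the last degree where multiplication by it is
-- injective, and there both sides have the same dimension. The matrices are restricted to subsets
-- of the basis, so every minor is a function on the Boolean cube and no polynomial ring is
-- required. Equality in ℂ is undecidable: pivots, inverses and nonvanishing minors are found only
-- under a double negation. Nothing is lost, since the final inequality between natural numbers is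
-- decidable.

module DoubleNegation where

  open import Data.Fin.Base using (Fin; zero; suc)
  open import Data.Nat.Base using (zero; suc)
  open import Function.Base using (_∘_)
  open import Relation.Nullary using (¬_)

  infixl 1 _>>=_

  _>>=_ : ∀ {a b} {A : Set a} {B : Set b} → ¬ ¬ A → (A → ¬ ¬ B) → ¬ ¬ B
  (m >>= f) k = m (λ x → f x k)

  return : ∀ {a} {A : Set a} → A → ¬ ¬ A
  return x k = k x

  -- Finiteness of `Fin n` is essential: double negation commutes with finite products only. This is
  -- what allows rank data to be chosen for all `r` terms at once.
  sequence : ∀ {a n} {P : Fin n → Set a} → (∀ i → ¬ ¬ P i) → ¬ ¬ (∀ i → P i)
  sequence {n = zero} f = return λ ()
  sequence {n = suc n} f = do
    p ← f zero
    ps ← sequence (f ∘ suc)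
    return λ { zero → p ; (suc i) → ps i }

-- Fields up to double negation, and a ring solver with integer coefficients.

module StableFields where

  open import Algebra.Bundles using (RawRing)
  import Algebra.Properties.AbelianGroup as AbelianGroupProperties
  import Algebra.Properties.CommutativeSemigroup as CommutativeSemigroupProperties
  import Algebra.Properties.Ring as RingProperties
  import Algebra.Properties.Semiring.Mult as Mult
  import Algebra.Solver.Ring as RingSolver
  open import Algebra.Solver.Ring.AlmostCommutativeRing using (fromCommutativeRing; _-Raw-AlmostCommutative⟶_)
  open import Data.Maybe.Base using (Maybe; just; nothing)
  open import Data.Nat.Base as ℕ using (ℕ; zero; suc)
  import Data.Nat.Properties as ℕₚ
  open import Data.Product.Base using (∃; _×_; _,_; proj₁; proj₂)
  open import Level using (0ℓ; _⊔_)
  open import Relation.Binary.PropositionalEquality using (_≡_)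
  open import Relation.Nullary using (¬_; yes; no)

  -- The classical axioms of a field, under a double negation: constructively, a complex number which
  -- is not zero need not have an inverse.
  record IsStableField {c ℓ : Level} (K : CommutativeRing c ℓ) : Set (c ⊔ ℓ) where
    open CommutativeRing K
    open Mult semiring using () renaming (_×_ to _·_)
    field
      ≈0-stable           : ∀ {x} → ¬ ¬ x ≈ 0# → x ≈ 0#
      invertible          : ∀ {x} → ¬ x ≈ 0# → ¬ ¬ ∃ λ y → y * x ≈ 1#
      characteristic-zero : ∀ n → ¬ suc n · 1# ≈ 0#

  -- A ring solver with formal differences of natural numbers as coefficients,
  -- so that cancellation is decided although equality in K is not.
  module Solver {c ℓ : Level} (K : CommutativeRing c ℓ) where

    open CommutativeRing K
    open Mult semiring using (×-homo-+; ×-homo-1; ×1-homo-*; ×-congˡ) renaming (_×_ to _·_)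
    open RingProperties ring using (-‿distribˡ-*; -‿distribʳ-*; -‿involutive; -0#≈0#)
    open AbelianGroupProperties +-abelianGroup using (⁻¹-∙-comm)
    open import Relation.Binary.Reasoning.Setoid setoid
    open CommutativeSemigroupProperties +-commutativeSemigroup using (interchange)

    private
      normalise : ℕ → ℕ → ℕ × ℕ
      normalise zero    q       = 0 , q
      normalise (suc p) zero    = suc p , 0
      normalise (suc p) (suc q) = normalise p q

      differences : RawRing 0ℓ 0ℓ
      differences = record
        { Carrier = ℕ × ℕ
        ; _≈_ = _≡_
        ; _+_ = λ (p , q) (r , s) → normalise (p ℕ.+ r) (q ℕ.+ s)
        ; _*_ = λ (p , q) (r , s) → normalise (p ℕ.* r ℕ.+ q ℕ.* s) (p ℕ.* s ℕ.+ q ℕ.* r)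
        ; -_ = λ (p , q) → (q , p)
        ; 0# = (0 , 0)
        ; 1# = (1 , 0)
        }

      -- The first two clauses make `con (0 , 0)` and `con (1 , 0)` evaluate to `0#` and `1#`
      -- themselves, so that solved equations match the goals definitionally.
      ⟦_⟧ : ℕ × ℕ → Carrier
      ⟦ 0 , 0 ⟧ = 0#
      ⟦ 1 , 0 ⟧ = 1#
      ⟦ p , q ⟧ = p · 1# - q · 1#

      expand : ∀ x → ⟦ x ⟧ ≈ proj₁ x · 1# - proj₂ x · 1#
      expand (0 , 0)           = sym (-‿inverseʳ 0#)
      expand (1 , 0)           = sym (trans (+-congʳ (×-homo-1 1#)) (trans (+-congˡ -0#≈0#) (+-identityʳ 1#)))
      expand (0 , suc _)       = refl
      expand (1 , suc _)       = refl
      expand (suc (suc _) , _) = refl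

      sub-+ : ∀ x y z w → (x + z) - (y + w) ≈ (x - y) + (z - w)
      sub-+ x y z w = trans (+-congˡ (sym (⁻¹-∙-comm y w))) (interchange x z (- y) (- w))

      sub-* : ∀ x y z w → (x * z + y * w) - (x * w + y * z) ≈ (x - y) * (z - w)
      sub-* x y z w = begin
        (x * z + y * w) - (x * w + y * z)          ≈⟨ sub-+ _ _ _ _ ⟩
        (x * z - x * w) + (y * w - y * z)          ≈⟨ +-cong (+-congˡ (-‿distribʳ-* x w)) (+-comm _ _) ⟩
        (x * z + x * - w) + (- (y * z) + y * w)    ≈⟨ +-cong (sym (distribˡ x z (- w)))
                                                        (+-cong (-‿distribˡ-* y z)
                                                          (trans (sym (-‿involutive _))
                                                            (trans (-‿cong (-‿distribʳ-* y w)) (-‿distribˡ-* y (- w))))) ⟩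
        x * (z - w) + (- y * z + - y * - w)        ≈⟨ +-congˡ (sym (distribˡ (- y) z (- w))) ⟩
        x * (z - w) + - y * (z - w)                ≈⟨ distribʳ _ _ _ ⟨
        (x - y) * (z - w)                          ∎

      cancel : ∀ x y z → (x + z) - (y + z) ≈ x - y
      cancel x y z = trans (sub-+ x y z z) (trans (+-congˡ (-‿inverseʳ z)) (+-identityʳ _))

      expand-normalise : ∀ p q → ⟦ normalise p q ⟧ ≈ p · 1# - q · 1#
      expand-normalise zero    q       = expand (0 , q)
      expand-normalise (suc p) zero    = expand (suc p , 0)
      expand-normalise (suc p) (suc q) = trans (expand-normalise p q)
        (sym (trans (+-cong (+-comm 1# _) (-‿cong (+-comm 1# _))) (cancel (p · 1#) (q · 1#) 1#)))

      ×-homo-** : ∀ p q r s → (p ℕ.* r ℕ.+ q ℕ.* s) · 1# ≈ (p · 1#) * (r · 1#) + (q · 1#) * (s · 1#)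
      ×-homo-** p q r s = trans (×-homo-+ 1# (p ℕ.* r) (q ℕ.* s)) (+-cong (×1-homo-* p r) (×1-homo-* q s))

      morphism : differences -Raw-AlmostCommutative⟶ fromCommutativeRing K
      morphism = record
        { ⟦_⟧ = ⟦_⟧
        ; +-homo = λ x@(p , q) y@(r , s) → trans (expand-normalise (p ℕ.+ r) (q ℕ.+ s))
            (trans (+-cong (×-homo-+ 1# p r) (-‿cong (×-homo-+ 1# q s)))
              (trans (sub-+ _ _ _ _) (sym (+-cong (expand x) (expand y)))))
        ; *-homo = λ x@(p , q) y@(r , s) → trans (expand-normalise (p ℕ.* r ℕ.+ q ℕ.* s) (p ℕ.* s ℕ.+ q ℕ.* r))
            (trans (+-cong (×-homo-** p q r s) (-‿cong (×-homo-** p q s r)))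
              (trans (sub-* _ _ _ _) (sym (*-cong (expand x) (expand y)))))
        ; -‿homo = λ x@(p , q) → trans (expand (q , p)) (trans (+-comm _ _)
            (trans (+-congˡ (sym (-‿involutive _)))
              (trans (⁻¹-∙-comm (p · 1#) (- (q · 1#))) (-‿cong (sym (expand x))))))
        ; 0-homo = refl
        ; 1-homo = refl
        }

      _≟_ : ∀ x y → Maybe (⟦ x ⟧ ≈ ⟦ y ⟧)
      (p , q) ≟ (r , s) with p ℕ.+ s ℕₚ.≟ r ℕ.+ q
      ... | no _   = nothing
      ... | yes eq = just (begin
        ⟦ p , q ⟧                                 ≈⟨ expand (p , q) ⟩
        p · 1# - q · 1#                           ≈⟨ cancel (p · 1#) (q · 1#) (s · 1#) ⟨
        (p · 1# + s · 1#) - (q · 1# + s · 1#)     ≈⟨ +-congʳ (trans (sym (×-homo-+ 1# p s)) (trans (×-congˡ eq) (×-homo-+ 1# r q))) ⟩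
        (r · 1# + q · 1#) - (q · 1# + s · 1#)     ≈⟨ +-congˡ (-‿cong (+-comm _ _)) ⟩
        (r · 1# + q · 1#) - (s · 1# + q · 1#)     ≈⟨ cancel (r · 1#) (s · 1#) (q · 1#) ⟩
        r · 1# - s · 1#                           ≈⟨ expand (r , s) ⟨
        ⟦ r , s ⟧                                 ∎)

    open RingSolver differences (fromCommutativeRing K) morphism _≟_ public

open StableFields

-- Subsets of a given size, counted by binomial coefficients.

module Combinations where

  open import Data.Bool.Base using (true; false)
  open import Data.Empty using (⊥)
  open import Data.Fin.Base using (Fin; zero; suc)
  open import Data.Fin.Properties using (+↔⊎)
  open import Data.Fin.Subset using (Subset; ∣_∣)
  open import Data.Integer.Base using (_⊖_)
  open import Data.Maybe.Base as Maybe using (Maybe; just; nothing)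
  open import Data.Nat.Base using (ℕ; zero; suc; z<s)
  open import Data.Nat.Combinatorics using (_C_; k>n⇒nCk≡0; nCk+nC[k+1]≡[n+1]C[k+1])
  open import Data.Product.Base using (∃; _,_)
  open import Data.Sum.Base using (_⊎_; inj₁; inj₂)
  open import Data.Sum.Function.Propositional using (_⊎-↔_)
  open import Data.Vec.Base using ([]; _∷_)
  open import Defs using (binomial)
  open import Function.Bundles using (_↔_; mk↔ₛ′)
  open import Function.Properties.Inverse using (↔-refl; ↔-sym; ↔-trans)
  open import Relation.Binary.PropositionalEquality using (_≡_; refl; sym; cong)

  -- Carrying the size in the type gives an index set for the coordinates of Λ^k(K^m), whose
  -- cardinality follows from Pascal's rule. The Koszul maps act on all subsets; `combination` is
  -- the partial way back.
  data Combination : ℕ → ℕ → Set where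
    []   : Combination 0 0
    skip : ∀ {m k} → Combination m k → Combination (suc m) k
    pick : ∀ {m k} → Combination m k → Combination (suc m) (suc k)

  toSubset : ∀ {m k} → Combination m k → Subset m
  toSubset []       = []
  toSubset (skip T) = false ∷ toSubset T
  toSubset (pick T) = true ∷ toSubset T

  fromSubset : ∀ {m} (S : Subset m) {k} → ∣ S ∣ ≡ k → ∃ λ (T : Combination m k) → toSubset T ≡ S
  fromSubset []          refl = [] , refl
  fromSubset (false ∷ S) eq   = let (T , T≡S) = fromSubset S eq in skip T , cong (false ∷_) T≡S
  fromSubset (true ∷ S)  refl = let (T , T≡S) = fromSubset S refl in pick T , cong (true ∷_) T≡S

  combination : ∀ {m} k → Subset m → Maybe (Combination m k)
  combination zero    []          = just []
  combination (suc k) []          = nothing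
  combination k       (false ∷ S) = Maybe.map skip (combination k S)
  combination zero    (true ∷ S)  = nothing
  combination (suc k) (true ∷ S)  = Maybe.map pick (combination k S)

  combination-toSubset : ∀ {m k} (T : Combination m k) → combination k (toSubset T) ≡ just T
  combination-toSubset [] = refl
  combination-toSubset {k = zero}  (skip T) rewrite combination-toSubset T = refl
  combination-toSubset {k = suc k} (skip T) rewrite combination-toSubset T = refl
  combination-toSubset (pick T) rewrite combination-toSubset T = refl

  combination-size : ∀ {m} k (S : Subset m) {T} → combination k S ≡ just T → ∣ S ∣ ≡ k
  combination-size zero    []          eq = refl
  combination-size zero    (false ∷ S) eq with combination zero S in eq′
  ... | just _ = combination-size zero S eq′
  combination-size (suc k) (false ∷ S) eq with combination (suc k) S in eq′
  ... | just _ = combination-size (suc k) S eq′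
  combination-size (suc k) (true ∷ S)  eq with combination k S in eq′
  ... | just _ = cong suc (combination-size k S eq′)

  private
    Fin-cong : ∀ {m n} → m ≡ n → Fin m ↔ Fin n
    Fin-cong refl = ↔-refl

  combination↔ : ∀ m k → Combination m k ↔ Fin (m C k)
  combination↔ zero    zero    = mk↔ₛ′ (λ _ → zero) (λ _ → []) (λ { zero → refl }) (λ { [] → refl })
  combination↔ zero    (suc k) = ↔-trans (mk↔ₛ′ (λ ()) (λ ()) (λ ()) (λ ())) (Fin-cong (sym (k>n⇒nCk≡0 {0} {suc k} z<s)))
  combination↔ (suc m) zero    = ↔-trans
    (mk↔ₛ′ (λ { (skip T) → T }) skip (λ _ → refl) (λ { (skip T) → refl }))
    (↔-trans (combination↔ m zero) (Fin-cong refl))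
  combination↔ (suc m) (suc k) = ↔-trans split
    (↔-trans (combination↔ m k ⊎-↔ combination↔ m (suc k))
      (↔-trans (↔-sym +↔⊎) (Fin-cong (nCk+nC[k+1]≡[n+1]C[k+1] m k))))
    where
    split : Combination (suc m) (suc k) ↔ (Combination m k ⊎ Combination m (suc k))
    split = mk↔ₛ′ (λ { (pick T) → inj₁ T ; (skip T) → inj₂ T }) (λ { (inj₁ T) → pick T ; (inj₂ T) → skip T })
      (λ { (inj₁ T) → refl ; (inj₂ T) → refl }) (λ { (pick T) → refl ; (skip T) → refl })

  -- Combinations of p - 1 elements; there are none when p = 0.
  Combination⁻ : ℕ → ℕ → Set
  Combination⁻ m zero    = ⊥
  Combination⁻ m (suc k) = Combination m k

  combination⁻↔ : ∀ m p → Combination⁻ m p ↔ Fin (binomial m (p ⊖ 1))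
  combination⁻↔ m zero    = mk↔ₛ′ (λ ()) (λ ()) (λ ()) (λ ())
  combination⁻↔ m (suc k) = combination↔ m k

  combination⁻ : ∀ {m} p → Subset m → Maybe (Combination⁻ m p)
  combination⁻ zero    S = nothing
  combination⁻ (suc k) S = combination k S

  combination⁻-size : ∀ {m} p (S : Subset m) {T} → combination⁻ p S ≡ just T → suc ∣ S ∣ ≡ p
  combination⁻-size (suc k) S eq = cong suc (combination-size k S eq)

  toSubset⁻ : ∀ {m} p → Combination⁻ m p → Subset m
  toSubset⁻ (suc k) = toSubset

  combination⁻-toSubset : ∀ {m} p (T : Combination⁻ m p) → combination⁻ p (toSubset⁻ p T) ≡ just T
  combination⁻-toSubset (suc k) = combination-toSubset

-- Complements and unions of subsets.

module Subsets where

  open import Data.Bool.Base using (true; false)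
  open import Data.Fin.Base using (Fin; zero; suc)
  open import Data.Fin.Properties using (suc-injective)
  open import Data.Fin.Subset using (Subset; ∣_∣; ∁; _∪_)
  open import Data.Nat.Base using (suc; _+_; _≤_; z≤n; s≤s)
  open import Data.Nat.Properties using (+-suc; ≤-trans; ≤-reflexive; m≤n⇒m≤1+n)
  open import Data.Product.Base using (_×_; _,_)
  open import Data.Vec.Base using ([]; _∷_; lookup)
  open import Relation.Binary.PropositionalEquality using (_≡_; refl; sym; cong)

  absent : ∀ {n} (S : Subset n) → Fin ∣ ∁ S ∣ → Fin n
  absent (false ∷ S) zero    = zero
  absent (false ∷ S) (suc i) = suc (absent S i)
  absent (true ∷ S)  i       = suc (absent S i)

  lookup-absent : ∀ {n} (S : Subset n) i → lookup S (absent S i) ≡ false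
  lookup-absent (false ∷ S) zero    = refl
  lookup-absent (false ∷ S) (suc i) = lookup-absent S i
  lookup-absent (true ∷ S)  i       = lookup-absent S i

  absent-injective : ∀ {n} (S : Subset n) {i j} → absent S i ≡ absent S j → i ≡ j
  absent-injective (false ∷ S) {zero}  {zero}  eq = refl
  absent-injective (false ∷ S) {suc i} {suc j} eq = cong suc (absent-injective S (suc-injective eq))
  absent-injective (true ∷ S)                  eq = absent-injective S (suc-injective eq)

  ∣p∪q∣≤∣p∣+∣q∣ : ∀ {n} (p q : Subset n) → ∣ p ∪ q ∣ ≤ ∣ p ∣ + ∣ q ∣
  ∣p∪q∣≤∣p∣+∣q∣ []          []          = z≤n
  ∣p∪q∣≤∣p∣+∣q∣ (false ∷ p) (false ∷ q) = ∣p∪q∣≤∣p∣+∣q∣ p q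
  ∣p∪q∣≤∣p∣+∣q∣ (false ∷ p) (true ∷ q)  = ≤-trans (s≤s (∣p∪q∣≤∣p∣+∣q∣ p q)) (≤-reflexive (sym (+-suc ∣ p ∣ ∣ q ∣)))
  ∣p∪q∣≤∣p∣+∣q∣ (true ∷ p)  (false ∷ q) = s≤s (∣p∪q∣≤∣p∣+∣q∣ p q)
  ∣p∪q∣≤∣p∣+∣q∣ (true ∷ p)  (true ∷ q)  = s≤s (≤-trans (∣p∪q∣≤∣p∣+∣q∣ p q)
    (≤-trans (m≤n⇒m≤1+n (≤-reflexive refl)) (≤-reflexive (sym (+-suc ∣ p ∣ ∣ q ∣)))))

  lookup-∪-false : ∀ {n} (p q : Subset n) i → lookup (p ∪ q) i ≡ false → lookup p i ≡ false × lookup q i ≡ false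
  lookup-∪-false (false ∷ p) (false ∷ q) zero    eq = refl , refl
  lookup-∪-false (x ∷ p)     (y ∷ q)     (suc i) eq = lookup-∪-false p q i eq

-- Binomial estimates, and the passage from the count of terms to the bound.

module Arithmetic where

  open import Data.Integer.Base using (_⊖_)
  open import Data.List.Base using (List; []; _∷_; length; replicate)
  open import Data.List.Properties using (length-replicate)
  open import Data.Nat.Base
  open import Data.Nat.Combinatorics using (_C_; nCk+nC[k+1]≡[n+1]C[k+1]; k>n⇒nCk≡0)
  open import Data.Nat.DivMod using (m≡m%n+[m/n]*n; m%n<n; /-monoˡ-≤; m*n/n≡m)
  open import Data.Nat.Properties
  open import Data.Nat.Solver using (module +-*-Solver)
  open import Data.Product.Base using (∃; _,_)
  open import Defs using (binomial)
  open import Data.Sum.Base using (inj₁; inj₂)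
  open import Function.Base using (_∘_)
  open import Relation.Binary.PropositionalEquality
  open import Relation.Nullary using (¬_; yes; no; contradiction)
  open +-*-Solver using (solve; _:=_; _:+_; _:*_; con)

  -- In contrast to `2 * q`, the successor case exposes two `suc`s, so that a pair of coordinates
  -- splits off from `Fin (double (suc q))` by computation.
  double : ℕ → ℕ
  double zero    = zero
  double (suc q) = suc (suc (double q))

  -- An entry `d` stands for a tensor factor of dimension d + 2. Dimension 1 is excluded because the
  -- cyclic shift on the factor must have no fixed point.
  size : List ℕ → ℕ
  size []       = 1
  size (d ∷ ds) = size ds * suc (suc d)

  double≡2* : ∀ q → double q ≡ 2 * q
  double≡2* zero    = refl
  double≡2* (suc q) = trans (cong (suc ∘ suc) (double≡2* q)) (solve 1 (λ q → con 2 :+ con 2 :* q := con 2 :* (con 1 :+ q)) refl q)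

  absorption : ∀ n k → suc k * (suc n C suc k) ≡ suc n * (n C k)
  absorption zero    zero    = refl
  absorption zero    (suc k) = trans (cong (suc (suc k) *_) (k>n⇒nCk≡0 {1} {suc (suc k)} (s<s z<s)))
    (trans (*-zeroʳ (suc (suc k))) (sym (cong (_+ 0) (k>n⇒nCk≡0 {0} {suc k} z<s))))
  absorption (suc n) zero    = begin
    1 * (suc (suc n) C 1)                      ≡⟨ *-identityˡ _ ⟩
    suc (suc n) C 1                            ≡⟨ nCk+nC[k+1]≡[n+1]C[k+1] (suc n) 0 ⟨
    1 + suc n C 1                              ≡⟨ cong (1 +_) (trans (sym (*-identityˡ _)) (absorption n zero)) ⟩
    1 + suc n * 1                              ≡⟨⟩
    suc (suc n) * 1                            ∎
    where open ≡-Reasoning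
  absorption (suc n) (suc k) = begin
    suc (suc k) * (suc (suc n) C suc (suc k))
      ≡⟨ cong (suc (suc k) *_) (nCk+nC[k+1]≡[n+1]C[k+1] (suc n) (suc k)) ⟨
    suc (suc k) * (suc n C suc k + suc n C suc (suc k))
      ≡⟨ solve 3 (λ k x y → (con 1 :+ k) :* (x :+ y) := x :+ (k :* x :+ (con 1 :+ k) :* y)) refl (suc k) (suc n C suc k) (suc n C suc (suc k)) ⟩
    suc n C suc k + (suc k * (suc n C suc k) + suc (suc k) * (suc n C suc (suc k)))
      ≡⟨ cong (suc n C suc k +_) (cong₂ _+_ (absorption n k) (absorption n (suc k))) ⟩
    suc n C suc k + (suc n * (n C k) + suc n * (n C suc k))
      ≡⟨ cong (suc n C suc k +_) (*-distribˡ-+ (suc n) (n C k) (n C suc k)) ⟨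
    suc n C suc k + suc n * (n C k + n C suc k)
      ≡⟨ cong (λ x → suc n C suc k + suc n * x) (nCk+nC[k+1]≡[n+1]C[k+1] n k) ⟩
    suc (suc n) * (suc n C suc k)  ∎
    where open ≡-Reasoning

  -- Evaluate p C(2p+1, p) by absorption and by Pascal's rule and compare. The ratio C(2p, p-1) /
  -- C(2p, p) = p/(p+1) is where the fraction in the theorem comes from.
  central-ratio : ∀ p → suc p * binomial (double p) (p ⊖ 1) ≡ p * (double p C p)
  central-ratio zero    = refl
  central-ratio (suc k) = +-cancelˡ-≡ (p * b) _ _ (begin
    p * b + suc p * b                    ≡⟨ solve 2 (λ p b → p :* b :+ (con 1 :+ p) :* b := (con 1 :+ con 2 :* p) :* b) refl p b ⟩
    suc (2 * p) * b                      ≡⟨ cong (λ m → suc m * b) (double≡2* p) ⟨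
    suc (double p) * (double p C k)      ≡⟨ absorption (double p) k ⟨
    p * (suc (double p) C p)             ≡⟨ cong (p *_) (nCk+nC[k+1]≡[n+1]C[k+1] (double p) k) ⟨
    p * (b + double p C p)               ≡⟨ *-distribˡ-+ p b _ ⟩
    p * b + p * (double p C p)           ∎)
    where
    open ≡-Reasoning
    p b : ℕ
    p = suc k
    b = double p C k

  C-positive : ∀ {n k} → k ≤ n → 0 < n C k
  C-positive {n}     {zero}  _         = z<s
  C-positive {suc n} {suc k} (s≤s k≤n) = <-≤-trans (C-positive k≤n)
    (≤-trans (m≤m+n (n C k) (n C suc k)) (≤-reflexive (nCk+nC[k+1]≡[n+1]C[k+1] n k)))

  p≤double : ∀ p → p ≤ double p
  p≤double zero    = z≤n
  p≤double (suc p) = s≤s (m≤n⇒m≤1+n (p≤double p))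

  -- Expanding the right side twice by Pascal's rule produces C(n, k) two times.
  2*C≤C : ∀ n k → 2 * (n C k) ≤ suc (suc n) C suc k
  2*C≤C n zero = begin
    2                          ≤⟨ s≤s (C-positive {suc n} {1} (s≤s z≤n)) ⟩
    1 + suc n C 1              ≡⟨ nCk+nC[k+1]≡[n+1]C[k+1] (suc n) 0 ⟩
    suc (suc n) C 1            ∎
    where open ≤-Reasoning
  2*C≤C n (suc k) = begin
    2 * x                                  ≡⟨ cong (x +_) (+-identityʳ x) ⟩
    x + x                                  ≤⟨ +-mono-≤ (m≤n+m x (n C k)) (m≤m+n x (n C suc (suc k))) ⟩
    (n C k + x) + (x + n C suc (suc k))    ≡⟨ cong₂ _+_ (nCk+nC[k+1]≡[n+1]C[k+1] n k) (nCk+nC[k+1]≡[n+1]C[k+1] n (suc k)) ⟩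
    suc n C suc k + suc n C suc (suc k)    ≡⟨ nCk+nC[k+1]≡[n+1]C[k+1] (suc n) (suc k) ⟩
    suc (suc n) C suc (suc k)              ∎
    where
    open ≤-Reasoning
    x : ℕ
    x = n C suc k

  2^k≤C : ∀ k → 2 ^ k ≤ double (suc k) C k
  2^k≤C zero    = ≤-refl
  2^k≤C (suc k) = ≤-trans (*-monoʳ-≤ 2 (2^k≤C k)) (2*C≤C (double (suc k)) k)

  module _ (p s′ n r : ℕ) where
    private
      b c : ℕ
      b = binomial (double p) (p ⊖ 1)
      c = double p C p

    -- The hypothesis is the outcome of the counting argument. Divide it by c and use b / c =
    -- p/(p+1). The truncated subtraction does no harm: n² ≤ y + (n² ∸ y) holds even when y exceeds
    -- n².
    cancel-central : (b * s′ + c * n) * n + (n * n ∸ (n * 1 + b * s′ * 2)) * c ≤ r * c →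
                     p * s′ * n + 2 * suc p * (n * n) ≤ suc p * (r + (n + 2 * (b * s′)))
    cancel-central h = *-cancelʳ-≤ _ _ c {{>-nonZero (C-positive (p≤double p))}} (begin
      (p * s′ * n + 2 * suc p * (n * n)) * c
        ≡⟨ solve 5 (λ p s n c P → (p :* s :* n :+ con 2 :* P :* (n :* n)) :* c := p :* c :* s :* n :+ con 2 :* P :* c :* (n :* n)) refl p s′ n c (suc p) ⟩
      p * c * s′ * n + 2 * suc p * c * (n * n)
        ≡⟨ cong (λ x → x * s′ * n + 2 * suc p * c * (n * n)) (central-ratio p) ⟨
      suc p * b * s′ * n + 2 * suc p * c * (n * n)
        ≡⟨ solve 5 (λ b s n c P → P :* b :* s :* n :+ con 2 :* P :* c :* (n :* n) := P :* ((b :* s :+ c :* n) :* n :+ (n :* n) :* c)) refl b s′ n c (suc p) ⟩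
      suc p * ((b * s′ + c * n) * n + (n * n) * c)
        ≤⟨ *-monoʳ-≤ (suc p) (+-monoʳ-≤ ((b * s′ + c * n) * n) (*-monoˡ-≤ c (m≤n+m∸n (n * n) y))) ⟩
      suc p * ((b * s′ + c * n) * n + (y + (n * n ∸ y)) * c)
        ≡⟨ solve 5 (λ P x y z c → P :* (x :+ (y :+ z) :* c) := P :* ((x :+ z :* c) :+ y :* c)) refl (suc p) ((b * s′ + c * n) * n) y (n * n ∸ y) c ⟩
      suc p * (((b * s′ + c * n) * n + (n * n ∸ y) * c) + y * c)
        ≤⟨ *-monoʳ-≤ (suc p) (+-monoˡ-≤ (y * c) h) ⟩
      suc p * (r * c + y * c)
        ≡⟨ solve 6 (λ P r c n b s → P :* (r :* c :+ (n :* con 1 :+ b :* s :* con 2) :* c) := P :* (r :+ (n :+ con 2 :* (b :* s))) :* c) refl (suc p) r c n b s′ ⟩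
      suc p * (r + (n + 2 * (b * s′))) * c  ∎)
      where
      open ≤-Reasoning
      y : ℕ
      y = n * 1 + b * s′ * 2

  coefficient : ℕ → ℕ
  coefficient p = 1 + 2 * p * binomial (2 * p) (p ⊖ 1)

  -- The inequality of the theorem multiplied by p + 1, since 3 - 1/(p+1) = (3p+2)/(p+1).
  Bound : ℕ → ℕ → ℕ → Set
  Bound p n r = (3 * p + 2) * (n * n) ≤ suc p * (r + coefficient p * n)

  module _ {n r : ℕ} (bound : ∀ ds {s} → size ds + s ≡ n →
    length ds * size ds * n + 2 * suc (length ds) * (n * n) ≤
      suc (length ds) * (r + (n + 2 * (binomial (double (length ds)) (length ds ⊖ 1) * size ds)))) where

    -- With `ds = []` the binomial is 0, and only the n basis vectors spent on X₀ are subtracted.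
    bound-0 : 1 ≤ n → 2 * (n * n) ≤ r + n
    bound-0 n≥1 = ≤-trans (bound [] (m+[n∸m]≡n n≥1)) (≤-reflexive (trans (*-identityˡ _) (cong (r +_) (+-identityʳ n))))

    private
      size-replicate : ∀ k → size (replicate k 0) ≡ 2 ^ k
      size-replicate zero    = refl
      size-replicate (suc k) = trans (cong (_* 2) (size-replicate k)) (*-comm (2 ^ k) 2)

      remainder-small : ∀ k {s} → s < 2 ^ k → s ≤ 2 * (k * (double (suc k) C k))
      remainder-small zero    (s≤s z≤n) = z≤n
      remainder-small (suc k) {s} s<2^k = begin
        s                 ≤⟨ <⇒≤ s<2^k ⟩
        2 ^ suc k         ≤⟨ 2^k≤C (suc k) ⟩
        B                 ≤⟨ m≤m+n B (k * B) ⟩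
        suc k * B         ≤⟨ m≤m+n _ _ ⟩
        2 * (suc k * B)   ∎
        where
        open ≤-Reasoning
        B : ℕ
        B = double (suc (suc k)) C suc k

      coefficient-double : ∀ k → coefficient (suc k) ≡ 1 + 2 * suc k * (double (suc k) C k)
      coefficient-double k = cong (λ m → 1 + 2 * suc k * (m C k)) (sym (double≡2* (suc k)))

      -- Here n has no room for p factors of dimension 2. But n < 2^p ≤ 2pB, so the term 2pB n of
      -- the error is at least n², and adding n² to the bound 2n² ≤ r + n already gives 3n².
      small : ∀ k → n < 2 ^ suc k → 2 * (n * n) ≤ r + n → Bound (suc k) n r
      small k n<2^p h = begin
        (3 * suc k + 2) * (n * n)                         ≤⟨ *-monoˡ-≤ (n * n) (≤-trans (m≤m+n (3 * suc k + 2) 1)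
                                                               (≤-reflexive (solve 1 (λ k → con 3 :* k :+ con 2 :+ con 1 := con 3 :* (con 1 :+ k)) refl (suc k)))) ⟩
        3 * suc (suc k) * (n * n)                         ≡⟨ solve 2 (λ P x → con 3 :* P :* x := P :* (con 2 :* x :+ x)) refl (suc (suc k)) (n * n) ⟩
        suc (suc k) * (2 * (n * n) + n * n)               ≤⟨ *-monoʳ-≤ (suc (suc k)) (+-mono-≤ h (*-monoˡ-≤ n (<⇒≤ n<K))) ⟩
        suc (suc k) * ((r + n) + 2 * suc k * B * n)       ≡⟨ cong (suc (suc k) *_) (solve 3 (λ r n x → r :+ n :+ x :* n := r :+ (con 1 :+ x) :* n) refl r n (2 * suc k * B)) ⟩
        suc (suc k) * (r + (1 + 2 * suc k * B) * n)       ≡⟨ cong (λ x → suc (suc k) * (r + x * n)) (coefficient-double k) ⟨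
        suc (suc k) * (r + coefficient (suc k) * n)       ∎
        where
        open ≤-Reasoning
        B : ℕ
        B = double (suc k) C k
        n<K : n < 2 * suc k * B
        n<K = <-≤-trans n<2^p (*-mono-≤ {2} {2 * suc k} (*-monoʳ-≤ 2 (s≤s (z≤n {k}))) (2^k≤C k))

      -- The product s′ of the digit sizes misses n by s < 2^k, which costs p s n; the slack between
      -- 2 b and 2 p b pays for it, as s ≤ 2 (p - 1) b.
      large : ∀ k → 2 ^ suc k ≤ n → Bound (suc k) n r
      large k 2^p≤n = begin
        (3 * P + 2) * (n * n)                                     ≡⟨ solve 2 (λ P x → (con 3 :* P :+ con 2) :* x := P :* x :+ con 2 :* (con 1 :+ P) :* x) refl P (n * n) ⟩
        P * (n * n) + 2 * suc P * (n * n)                         ≡⟨ cong (λ x → P * (x * n) + 2 * suc P * (n * n)) s′+s≡n ⟨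
        P * ((s′ + s) * n) + 2 * suc P * (n * n)                  ≡⟨ solve 5 (λ P s′ s n x → P :* ((s′ :+ s) :* n) :+ x := (P :* s′ :* n :+ x) :+ P :* (s :* n)) refl P s′ s n (2 * suc P * (n * n)) ⟩
        (P * s′ * n + 2 * suc P * (n * n)) + P * (s * n)          ≤⟨ +-mono-≤ base (*-monoˡ-≤ (s * n) (n≤1+n P)) ⟩
        suc P * (r + (n + 2 * (B * s′))) + suc P * (s * n)        ≡⟨ *-distribˡ-+ (suc P) (r + (n + 2 * (B * s′))) (s * n) ⟨
        suc P * (r + (n + 2 * (B * s′)) + s * n)                  ≤⟨ *-monoʳ-≤ (suc P) (+-mono-≤ (+-monoʳ-≤ r (+-monoʳ-≤ n (*-monoʳ-≤ 2 (*-monoʳ-≤ B s′≤n))))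
                                                                       (*-monoˡ-≤ n (remainder-small k s<))) ⟩
        suc P * (r + (n + 2 * (B * n)) + 2 * (k * B) * n)         ≡⟨ cong (suc P *_) (solve 4 (λ r n B k → r :+ (n :+ con 2 :* (B :* n)) :+ con 2 :* (k :* B) :* n := r :+ (con 1 :+ con 2 :* (con 1 :+ k) :* B) :* n) refl r n B k) ⟩
        suc P * (r + (1 + 2 * P * B) * n)                         ≡⟨ cong (λ x → suc P * (r + x * n)) (coefficient-double k) ⟨
        suc P * (r + coefficient P * n)                           ∎
        where
        open ≤-Reasoning
        instance
          2^k-nonZero : NonZero (2 ^ k)
          2^k-nonZero = m^n≢0 2 k
        P B q s s′ : ℕ
        P = suc k
        B = double (suc k) C k
        q = n / 2 ^ k
        s = n % 2 ^ k
        ds : List ℕ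
        -- One factor of dimension q and k factors of dimension 2; an entry d means dimension d + 2,
        -- hence `q ∸ 2`.
        ds = (q ∸ 2) ∷ replicate k 0
        s′ = size ds
        s< : s < 2 ^ k
        s< = m%n<n n (2 ^ k)
        q≥2 : 2 ≤ q
        q≥2 = ≤-trans (≤-reflexive (sym (m*n/n≡m 2 (2 ^ k)))) (/-monoˡ-≤ (2 ^ k) 2^p≤n)
        s′+s≡n : s′ + s ≡ n
        s′+s≡n = begin-equality
          size (replicate k 0) * (2 + (q ∸ 2)) + s    ≡⟨ cong₂ (λ x y → x * y + s) (size-replicate k) (m+[n∸m]≡n q≥2) ⟩
          2 ^ k * q + s                               ≡⟨ +-comm _ s ⟩
          s + 2 ^ k * q                               ≡⟨ cong (s +_) (*-comm (2 ^ k) q) ⟩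
          s + q * 2 ^ k                               ≡⟨ m≡m%n+[m/n]*n n (2 ^ k) ⟨
          n                                           ∎
        s′≤n : s′ ≤ n
        s′≤n = ≤-trans (m≤m+n s′ s) (≤-reflexive s′+s≡n)
        base : P * s′ * n + 2 * suc P * (n * n) ≤ suc P * (r + (n + 2 * (B * s′)))
        base = subst (λ l → l * s′ * n + 2 * suc l * (n * n) ≤ suc l * (r + (n + 2 * (binomial (double l) (l ⊖ 1) * s′))))
          (cong suc (length-replicate k)) (bound ds s′+s≡n)

    bound-p : 1 ≤ n → ∀ p → Bound p n r
    bound-p n≥1 zero    = ≤-trans (bound-0 n≥1) (≤-reflexive (trans (cong (r +_) (sym (+-identityʳ n))) (sym (*-identityˡ _))))
    bound-p n≥1 (suc k) with 2 ^ suc k ≤? n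
    ... | yes 2^p≤n = large k 2^p≤n
    ... | no  2^p≰n = small k (≰⇒> 2^p≰n) (bound-0 n≥1)

  -- From this n on, the linear error `coefficient p * n` is at most n²/(p+1), which is also the
  -- loss in the leading term.
  threshold : ℕ → ℕ
  threshold p = suc p * coefficient p

  -- The largest p reached by time n, when p + 1 becomes available at time threshold (p + 1).
  parameter : ℕ → ℕ
  parameter zero = zero
  parameter (suc n) with threshold (suc (parameter n)) ≤? suc n
  ... | yes _ = suc (parameter n)
  ... | no  _ = parameter n

  threshold-parameter : ∀ n → threshold (parameter (suc n)) ≤ suc n
  threshold-parameter n with threshold (suc (parameter n)) ≤? suc n
  threshold-parameter n       | yes h = h
  -- `threshold 0` is 1, so the claim starts to hold at time 1; this is why it is stated for
  -- `suc n`.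
  threshold-parameter zero    | no  _ = ≤-refl
  threshold-parameter (suc n) | no  _ = m≤n⇒m≤1+n (threshold-parameter n)

  parameter-suc : ∀ n → parameter n ≤ parameter (suc n)
  parameter-suc n with threshold (suc (parameter n)) ≤? suc n
  ... | yes _ = n≤1+n _
  ... | no  _ = ≤-refl

  parameter-mono : ∀ {m n} → m ≤′ n → parameter m ≤ parameter n
  parameter-mono ≤′-refl                = ≤-refl
  parameter-mono (≤′-step {n = n} m≤n) = ≤-trans (parameter-mono m≤n) (parameter-suc n)

  parameter-step : ∀ {n p} → p ≤ parameter n → threshold (suc p) ≤ suc n → suc p ≤ parameter (suc n)
  parameter-step {n} {p} p≤ h with threshold (suc (parameter n)) ≤? suc n
  ... | yes _ = s≤s p≤
  ... | no ¬h with m≤n⇒m<n∨m≡n p≤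
  parameter-step {n} {p} p≤ h | no ¬h | inj₁ p< = p<
  parameter-step {n} {p} p≤ h | no ¬h | inj₂ refl = contradiction h ¬h

  parameter-unbounded : ∀ p → ∃ λ N → p ≤ parameter N
  parameter-unbounded zero    = 0 , z≤n
  parameter-unbounded (suc p) =
    let (N , p≤) = parameter-unbounded p
        N′ = N ⊔ threshold (suc p)
    in suc N′ , parameter-step (≤-trans p≤ (parameter-mono (≤⇒≤′ (m≤m⊔n N _)))) (m≤n⇒m≤1+n (m≤n⊔m N (threshold (suc p))))

module OverStableField {c ℓ : Level} (K : CommutativeRing c ℓ) (K-isStableField : IsStableField K) where

  import Algebra.Properties.Group as GroupProperties
  import Algebra.Properties.Ring as RingProperties
  import Algebra.Properties.Semiring.Mult as Mult
  import Algebra.Properties.Semiring.Sum as Sum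
  open import Data.Bool.Base using (Bool; true; false; if_then_else_)
  open import Data.Fin.Base using (Fin; zero; suc; fromℕ; inject₁; toℕ)
  open import Data.Fin.Properties using (_≟_; toℕ-inject₁; *↔×; +↔⊎; injective⇒≤)
  open import Data.Fin.Relation.Unary.Top using (view; ‵fromℕ; ‵inject₁; view-fromℕ; view-inject₁)
  open import Data.Fin.Subset using (Subset; ∣_∣; ⊤; ∁; _∪_)
  open import Data.Fin.Subset.Properties using (∣∁p∣≡n∸∣p∣)
  open import Data.Integer.Base using (_⊖_)
  open import Data.List.Base using (List; []; _∷_; length)
  open import Data.Maybe.Base as Maybe using (Maybe; just; nothing; maybe′)
  open import Data.Nat.Base as ℕ using (ℕ; zero; suc; _≤_; _<_; z≤n; s≤s)
  open import Data.Nat.Combinatorics using (_C_)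
  import Data.Nat.Properties as ℕₚ
  open import Data.Product.Base using (∃; _×_; _,_; proj₁; proj₂)
  open import Data.Product.Function.NonDependent.Propositional using (_×-↔_)
  open import Data.Sum.Base using (_⊎_; inj₁; inj₂)
  open import Data.Sum.Function.Propositional using (_⊎-↔_)
  import Data.Unit.Base as Unit
  open import Data.Vec.Base using (Vec; []; _∷_; lookup)
  open import Data.Vec.Properties using (lookup-replicate)
  open import Defs using (binomial)
  open import Function.Base using (_∘_; id)
  open import Function.Bundles using (_↔_; mk↔ₛ′; Injection; Inverse)
  open import Function.Properties.Inverse using (↔-refl; ↔-sym; ↔-trans; ↔⇒↣)
  open import Level using (Lift; lift; _⊔_)
  open import Relation.Binary.PropositionalEquality as ≡ using (_≡_)
  open import Relation.Nullary using (¬_; yes; no; contradiction; ¬¬-excluded-middle)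
  open import Relation.Nullary.Decidable using (decidable-stable)

  open CommutativeRing K hiding (zero)
  open GroupProperties +-group using (∙-cancelˡ)
  open IsStableField K-isStableField
  open Mult semiring using () renaming (_×_ to _·_)
  open RingProperties ring using (-1*x≈-x; -0#≈0#; -‿involutive)
  open Solver K using (solve; _:+_; _:*_; _:-_; :-_; _:=_; con)
  open Sum semiring using (sum; sum-cong-≋; ∑-distrib-+; *-distribˡ-sum; *-distribʳ-sum; sum-replicate-zero)
  open import Relation.Binary.Reasoning.Setoid setoid
  open Arithmetic using (double; size)
  open Combinations
  open DoubleNegation
  open Subsets

  -- Linear maps between coordinate spaces.

  1≉0 : ¬ 1# ≈ 0#
  1≉0 1≈0 = characteristic-zero 0 (trans (+-identityʳ 1#) 1≈0)

  x-x≈0 : ∀ {x y} → x ≈ y → x - y ≈ 0#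
  x-x≈0 x≈y = trans (+-congʳ x≈y) (-‿inverseʳ _)

  sum-zero : ∀ {n} (t : Fin n → Carrier) → (∀ i → t i ≈ 0#) → sum t ≈ 0#
  sum-zero {n} t t≈0 = trans (sum-cong-≋ t≈0) (sum-replicate-zero n)

  δ : ∀ {n} → Fin n → Fin n → Carrier
  δ zero    zero    = 1#
  δ zero    (suc _) = 0#
  δ (suc _) zero    = 0#
  δ (suc i) (suc j) = δ i j

  δ-diagonal : ∀ {n} (i : Fin n) → δ i i ≡ 1#
  δ-diagonal zero    = ≡.refl
  δ-diagonal (suc i) = δ-diagonal i

  δ-off-diagonal : ∀ {n} {i j : Fin n} → ¬ i ≡ j → δ i j ≡ 0#
  δ-off-diagonal {i = zero}  {zero}  i≢j = contradiction ≡.refl i≢j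
  δ-off-diagonal {i = zero}  {suc _} i≢j = ≡.refl
  δ-off-diagonal {i = suc _} {zero}  i≢j = ≡.refl
  δ-off-diagonal {i = suc _} {suc _} i≢j = δ-off-diagonal (i≢j ∘ ≡.cong suc)

  sum-δ : ∀ {n} (i : Fin n) (t : Fin n → Carrier) → sum (λ k → t k * δ i k) ≈ t i
  sum-δ zero t = trans (+-cong (*-identityʳ _) (sum-zero (λ k → t (suc k) * 0#) (λ k → zeroʳ (t (suc k))))) (+-identityʳ _)
  sum-δ (suc i) t = trans (+-cong (zeroʳ _) (sum-δ i (t ∘ suc))) (+-identityˡ _)

  infix 1 _⊸_

  -- Arbitrary index types let tensor products and exterior algebras be products of index types, as
  -- in `Vec Bool m × J`. Finiteness enters only through bijections with some `Fin n`.
  record _⊸_ (I J : Set) : Set (c ⊔ ℓ) where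
    field
      app      : (I → Carrier) → J → Carrier
      app-cong : ∀ {x y} → (∀ i → x i ≈ y i) → ∀ j → app x j ≈ app y j
      app-+    : ∀ x y j → app (λ i → x i + y i) j ≈ app x j + app y j
      app-*    : ∀ a x j → app (λ i → a * x i) j ≈ a * app x j

    app-0 : ∀ {x} → (∀ i → x i ≈ 0#) → ∀ j → app x j ≈ 0#
    app-0 {x} x≈0 j = begin
      app x j                   ≈⟨ app-cong (λ i → trans (x≈0 i) (sym (zeroˡ (x i)))) j ⟩
      app (λ i → 0# * x i) j    ≈⟨ app-* 0# x j ⟩
      0# * app x j              ≈⟨ zeroˡ _ ⟩
      0#                        ∎

    app-neg : ∀ x j → app (λ i → - x i) j ≈ - app x j
    app-neg x j = begin
      app (λ i → - x i) j          ≈⟨ app-cong (λ i → -1*x≈-x (x i)) j ⟨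
      app (λ i → - 1# * x i) j     ≈⟨ app-* (- 1#) x j ⟩
      - 1# * app x j               ≈⟨ -1*x≈-x _ ⟩
      - app x j                    ∎

    app-sub : ∀ x y j → app (λ i → x i - y i) j ≈ app x j - app y j
    app-sub x y j = trans (app-+ x (λ i → - y i) j) (+-congˡ (app-neg y j))

    app-sum : ∀ {n} (a : Fin n → Carrier) (x : Fin n → I → Carrier) j →
              app (λ i → sum (λ k → a k * x k i)) j ≈ sum (λ k → a k * app (x k) j)
    app-sum {zero}  a x j = app-0 (λ _ → refl) j
    app-sum {suc n} a x j = trans (app-+ _ _ j) (+-cong (app-* (a zero) (x zero) j) (app-sum (a ∘ suc) (x ∘ suc) j))

  open _⊸_ public

  infixr 9 _⊙_

  _⊙_ : ∀ {I J L} → J ⊸ L → I ⊸ J → I ⊸ L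
  g ⊙ f = record
    { app      = λ x → app g (app f x)
    ; app-cong = λ x≈y → app-cong g (app-cong f x≈y)
    ; app-+    = λ x y j → trans (app-cong g (app-+ f x y) j) (app-+ g _ _ j)
    ; app-*    = λ a x j → trans (app-cong g (app-* f a x) j) (app-* g _ _ j)
    }

  reindex : ∀ {I J : Set} → (J → I) → I ⊸ J
  reindex f = record
    { app      = λ x j → x (f j)
    ; app-cong = λ x≈y j → x≈y (f j)
    ; app-+    = λ _ _ _ → refl
    ; app-*    = λ _ _ _ → refl
    }

  matrix : ∀ {J : Set} {n} → (J → Fin n → Carrier) → Fin n ⊸ J
  matrix {n = n} M = record
    { app      = λ x j → sum (λ k → x k * M j k)
    ; app-cong = λ x≈y j → sum-cong-≋ (λ k → *-congʳ (x≈y k))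
    ; app-+    = λ x y j → trans (sum-cong-≋ (λ k → distribʳ (M j k) (x k) (y k))) (∑-distrib-+ {n} _ _)
    ; app-*    = λ a x j → trans (sum-cong-≋ (λ k → *-assoc a (x k) (M j k))) (sym (*-distribˡ-sum a (λ k → x k * M j k)))
    }

  app-expand : ∀ {n J} (f : Fin n ⊸ J) x j → app f x j ≈ sum (λ k → x k * app f (δ k) j)
  app-expand f x j = trans
    (app-cong f (λ i → sym (trans (sum-cong-≋ (λ k → *-congˡ (δ-sym k i))) (sum-δ i x))) j)
    (app-sum f x δ j)
    where
    δ-sym : ∀ {n} (i j : Fin n) → δ i j ≈ δ j i
    δ-sym zero    zero    = refl
    δ-sym zero    (suc _) = refl
    δ-sym (suc _) zero    = refl
    δ-sym (suc i) (suc j) = δ-sym i j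

  TrivialKernel : ∀ {I R} → I ⊸ R → Set (c ⊔ ℓ)
  TrivialKernel f = ∀ x → (∀ ρ → app f x ρ ≈ 0#) → ∀ i → x i ≈ 0#

  -- The rows of `u` selected by `ι` form an invertible n × n system, and the vectors `b` are the
  -- columns of its inverse.
  record DualBasis {I R : Set} (n : ℕ) (u : I ⊸ R) : Set (c ⊔ ℓ) where
    field
      ι    : Fin n → R
      b    : Fin n → I → Carrier
      dual : ∀ j k → app u (b k) (ι j) ≈ δ j k
      span : ∀ x i → x i ≈ sum (λ k → app u x (ι k) * b k i)

    ι-injective : ∀ {j k} → ι j ≡ ι k → j ≡ k
    ι-injective {j} {k} eq with j ≟ k
    ... | yes j≡k = j≡k
    ... | no  j≢k = contradiction
      (trans (reflexive (≡.sym (δ-diagonal j)))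
        (trans (sym (dual j j)) (trans (reflexive (≡.cong (app u (b j)) eq))
          (trans (dual k j) (reflexive (δ-off-diagonal (j≢k ∘ ≡.sym)))))))
      1≉0

  -- Gaussian elimination. A row ρ on which e₀ has a nonzero value is the first pivot; `intoKernel`
  -- parametrises the hyperplane where row ρ vanishes, by correcting (0, y) along e₀, and the
  -- induction continues there.
  dualBasisFin : ∀ {R} n (u : Fin n ⊸ R) → TrivialKernel u → ¬ ¬ DualBasis n u
  dualBasisFin zero u ker = return record { ι = λ () ; b = λ () ; dual = λ () ; span = λ _ () }
  dualBasisFin {R} (suc n) u ker = do
    (ρ , uρ≉0) ← pivot
    (w , wu≈1) ← invertible uρ≉0
    basis ← dualBasisFin n (u ⊙ intoKernel ρ w) (λ x u≈0 i → trans (sym (minus-zero _ (x i))) (ker _ u≈0 (suc i)))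
    return (extend ρ w wu≈1 basis)
    where
    e : Fin (suc n) → Carrier
    e = δ zero

    minus-zero : ∀ a y → y - a * 0# ≈ y
    minus-zero = solve 2 (λ a y → y :- a :* con (0 , 0) := y) refl

    pivot : ¬ ¬ ∃ λ ρ → ¬ app u e ρ ≈ 0#
    pivot none = 1≉0 (ker e (λ ρ → ≈0-stable (λ ne → none (ρ , ne))) zero)

    cons0 : (Fin n → Carrier) → Fin (suc n) → Carrier
    cons0 y zero    = 0#
    cons0 y (suc i) = y i

    cons0-linear : Fin n ⊸ Fin (suc n)
    cons0-linear = record
      { app      = cons0
      ; app-cong = λ { x≈y zero → refl ; x≈y (suc i) → x≈y i }
      ; app-+    = λ { x y zero → sym (+-identityˡ 0#) ; x y (suc i) → refl }
      ; app-*    = λ { a x zero → sym (zeroʳ a) ; a x (suc i) → refl }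
      }

    intoKernel : R → Carrier → Fin n ⊸ Fin (suc n)
    intoKernel ρ w = record
      { app      = λ y i → cons0 y i - w * t y * e i
      ; app-cong = λ x≈y i → +-cong (app-cong cons0-linear x≈y i)
          (-‿cong (*-congʳ (*-congˡ (app-cong u₀ x≈y ρ))))
      ; app-+    = λ x y i → trans (+-cong (app-+ cons0-linear x y i) (-‿cong (*-congʳ (*-congˡ (app-+ u₀ x y ρ)))))
          (solve 6 (λ p q w r s e → (p :+ q) :- w :* (r :+ s) :* e := (p :- w :* r :* e) :+ (q :- w :* s :* e)) refl
            (cons0 x i) (cons0 y i) w (t x) (t y) (e i))
      ; app-*    = λ a x i → trans (+-cong (app-* cons0-linear a x i) (-‿cong (*-congʳ (*-congˡ (app-* u₀ a x ρ)))))
          (solve 5 (λ a p w r e → a :* p :- w :* (a :* r) :* e := a :* (p :- w :* r :* e)) refl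
            a (cons0 x i) w (t x) (e i))
      }
      where
      u₀ = u ⊙ cons0-linear
      t : (Fin n → Carrier) → Carrier
      t y = app u₀ y ρ

    app-combine : ∀ x a y ρ → app u (λ i → x i - a * y i) ρ ≈ app u x ρ - a * app u y ρ
    app-combine x a y ρ = trans (app-sub u _ _ ρ) (+-congˡ (-‿cong (app-* u a y ρ)))

    extend : ∀ ρ w → w * app u e ρ ≈ 1# → DualBasis n (u ⊙ intoKernel ρ w) → DualBasis (suc n) u
    extend ρ w wu≈1 basis = record { ι = ι ; b = b ; dual = dual ; span = span }
      where
      module B = DualBasis basis

      lb : Fin n → Fin (suc n) → Carrier
      lb k = app (intoKernel ρ w) (B.b k)

      s : Fin n → Carrier
      s k = w * app u e (B.ι k)

      ι : Fin (suc n) → R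
      ι zero    = ρ
      ι (suc j) = B.ι j

      b : Fin (suc n) → Fin (suc n) → Carrier
      -- `w * e` has value 1 at the pivot row; subtracting its values `s` at the other selected rows
      -- makes it vanish there.
      b zero    i = w * e i - sum (λ k → s k * lb k i)
      b (suc k) i = lb k i

      killed : ∀ y → app u (app (intoKernel ρ w) y) ρ ≈ 0#
      killed y = begin
        app u (λ i → cons0 y i - w * t * e i) ρ     ≈⟨ app-combine (cons0 y) (w * t) e ρ ⟩
        t - w * t * app u e ρ                       ≈⟨ solve 3 (λ t w v → t :- w :* t :* v := t :- t :* (w :* v)) refl t w (app u e ρ) ⟩
        t - t * (w * app u e ρ)                     ≈⟨ +-congˡ (-‿cong (trans (*-congˡ wu≈1) (*-identityʳ t))) ⟩
        t - t                                       ≈⟨ -‿inverseʳ t ⟩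
        0#                                          ∎
        where t = app u (cons0 y) ρ

      app-b₀ : ∀ ρ′ → app u (b zero) ρ′ ≈ w * app u e ρ′ - sum (λ k → s k * app u (lb k) ρ′)
      app-b₀ ρ′ = trans (app-sub u _ _ ρ′) (+-cong (app-* u w e ρ′) (-‿cong (app-sum u s lb ρ′)))

      dual : ∀ j k → app u (b k) (ι j) ≈ δ j k
      dual zero    zero    = trans (app-b₀ ρ)
        (trans (+-cong wu≈1 (trans (-‿cong (sum-zero {n} _ (λ k → trans (*-congˡ (killed (B.b k))) (zeroʳ _)))) -0#≈0#))
          (+-identityʳ 1#))
      dual (suc j) zero    = trans (app-b₀ (B.ι j))
        (x-x≈0 (sym (trans (sum-cong-≋ (λ k → *-congˡ (B.dual j k))) (sum-δ j s))))
      dual zero    (suc k) = killed (B.b k)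
      dual (suc j) (suc k) = B.dual j k

      span : ∀ x i → x i ≈ sum (λ k → app u x (ι k) * b k i)
      span x i = begin
        x i                                                         ≈⟨ solve 2 (λ x z → x := (x :- z) :+ z) refl (x i) (T * w * e i) ⟩
        (x i - T * w * e i) + T * w * e i                           ≈⟨ +-congʳ (z≈intoKernel i) ⟩
        app (intoKernel ρ w) (x ∘ suc) i + T * w * e i                    ≈⟨ +-congʳ (trans (app-cong (intoKernel ρ w) (B.span (x ∘ suc)) i)
                                                                         (app-sum (intoKernel ρ w) _ B.b i)) ⟩
        sum (λ k → app u (app (intoKernel ρ w) (x ∘ suc)) (B.ι k) * lb k i) + T * w * e i
                                                                    ≈⟨ +-congʳ (sum-cong-≋ (λ k → *-congʳ (coordinate k))) ⟩
        sum (λ k → (app u x (B.ι k) - T * s k) * lb k i) + T * w * e i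
          ≈⟨ +-congʳ (sum-cong-≋ (λ k → solve 4 (λ p t s l → (p :- t :* s) :* l := p :* l :+ (:- t) :* (s :* l)) refl
               (app u x (B.ι k)) T (s k) (lb k i))) ⟩
        sum (λ k → app u x (B.ι k) * lb k i + - T * (s k * lb k i)) + T * w * e i
          ≈⟨ +-congʳ (trans (∑-distrib-+ {n} _ (λ k → - T * (s k * lb k i))) (+-congˡ (sym (*-distribˡ-sum (- T) (λ k → s k * lb k i))))) ⟩
        Σ₁ + - T * Σ₂ + T * w * e i
          ≈⟨ solve 5 (λ p t q w e → p :+ (:- t) :* q :+ t :* w :* e := t :* (w :* e :- q) :+ p) refl Σ₁ T Σ₂ w (e i) ⟩
        T * (w * e i - Σ₂) + Σ₁                                     ∎
        where
        T Σ₁ Σ₂ : Carrier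
        T = app u x ρ
        Σ₁ = sum (λ k → app u x (B.ι k) * lb k i)
        Σ₂ = sum (λ k → s k * lb k i)

        x≈ : ∀ i → x i ≈ cons0 (x ∘ suc) i - (- x zero) * e i
        x≈ zero    = solve 1 (λ x → x := con (0 , 0) :- (:- x) :* con (1 , 0)) refl (x zero)
        x≈ (suc i) = solve 2 (λ x y → x := x :- (:- y) :* con (0 , 0)) refl (x (suc i)) (x zero)

        t : Carrier
        t = app u (cons0 (x ∘ suc)) ρ

        head≈ : x zero ≈ w * (T - t)
        head≈ = begin
          x zero                                  ≈⟨ *-identityʳ _ ⟨
          x zero * 1#                             ≈⟨ *-congˡ wu≈1 ⟨
          x zero * (w * v)                        ≈⟨ solve 4 (λ x w v t → x :* (w :* v) := w :* (t :- (:- x) :* v :- t)) refl (x zero) w v t ⟩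
          w * (t - (- x zero) * v - t)            ≈⟨ *-congˡ (+-congʳ (trans (app-cong u x≈ ρ) (app-combine _ _ e ρ))) ⟨
          w * (T - t)                             ∎
          where v = app u e ρ

        z≈intoKernel : ∀ i → x i - T * w * e i ≈ app (intoKernel ρ w) (x ∘ suc) i
        z≈intoKernel i = begin
          x i - T * w * e i                                          ≈⟨ +-congʳ (x≈ i) ⟩
          cons0 (x ∘ suc) i - (- x zero) * e i - T * w * e i         ≈⟨ +-congʳ (+-congˡ (-‿cong (*-congʳ (-‿cong head≈)))) ⟩
          cons0 (x ∘ suc) i - (- (w * (T - t))) * e i - T * w * e i
            ≈⟨ solve 5 (λ c w T t e → c :- (:- (w :* (T :- t))) :* e :- T :* w :* e := c :- w :* t :* e) refl
                 (cons0 (x ∘ suc) i) w T t (e i) ⟩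
          cons0 (x ∘ suc) i - w * t * e i                            ∎

        coordinate : ∀ k → app u (app (intoKernel ρ w) (x ∘ suc)) (B.ι k) ≈ app u x (B.ι k) - T * s k
        coordinate k = trans (app-cong u (λ i → sym (z≈intoKernel i)) (B.ι k))
          (trans (app-combine x (T * w) e (B.ι k)) (+-congˡ (-‿cong (*-assoc T w _))))

  dualBasis : ∀ {I R n} → I ↔ Fin n → (u : I ⊸ R) → TrivialKernel u → ¬ ¬ DualBasis n u
  dualBasis {I} {R} {n} I↔n u ker = do
    basis ← dualBasisFin n (u ⊙ reindex to) (λ x u≈0 k → trans (reflexive (≡.cong x (≡.sym (strictlyInverseˡ k)))) (ker (x ∘ to) u≈0 (from k)))
    let module B = DualBasis basis
    return record
      { ι    = B.ι
      ; b    = λ k → B.b k ∘ to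
      ; dual = B.dual
      ; span = λ x i → trans (reflexive (≡.cong x (≡.sym (strictlyInverseʳ i))))
          (trans (B.span (x ∘ from) (to i))
            (sum-cong-≋ (λ k → *-congʳ (app-cong u (λ i′ → reflexive (≡.cong x (strictlyInverseʳ i′))) (B.ι k)))))
      }
    where open Inverse I↔n

  leftInverse : ∀ {I R n} {u : I ⊸ R} → DualBasis n u → R ⊸ I
  leftInverse {I} {R} {n} basis = matrix (λ i k → b k i) ⊙ reindex ι
    where open DualBasis basis

  -- Koszul maps and exterior products.

  sum-sub : ∀ {n} (f g : Fin n → Carrier) → sum (λ i → f i - g i) ≈ sum f - sum g
  sum-sub {zero}  f g = sym (-‿inverseʳ 0#)
  sum-sub {suc n} f g = trans (+-congˡ (sum-sub (f ∘ suc) (g ∘ suc)))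
    (solve 4 (λ a b c d → (a :- b) :+ (c :- d) := (a :+ c) :- (b :+ d)) refl (f zero) (g zero) (sum (f ∘ suc)) (sum (g ∘ suc)))

  sub-cong : ∀ {x y z w} → x ≈ y → z ≈ w → x - z ≈ y - w
  sub-cong p q = +-cong p (-‿cong q)

  -- An element ω of Λ(K^m) ⊗ K^J is given by its coordinates at the subsets of Fin m. Writing
  -- ω = α + e₀ ∧ β, the slices of ω at false and true are α and β, and ω is sent to Σ eᵢ ∧ Xᵢ ω.

  module _ {J L : Set} where

    koszul : ∀ {m} → (Fin m → J ⊸ L) → (Vec Bool m × J → Carrier) → Vec Bool m × L → Carrier
    koszul {zero}  X ω (S , l)         = 0#
    koszul {suc m} X ω (false ∷ S , l) = koszul (X ∘ suc) (λ (S , j) → ω (false ∷ S , j)) (S , l)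
    koszul {suc m} X ω (true ∷ S , l)  =
      app (X zero) (λ j → ω (false ∷ S , j)) l - koszul (X ∘ suc) (λ (S , j) → ω (true ∷ S , j)) (S , l)

    koszul-cong : ∀ {m} (X : Fin m → J ⊸ L) {ω ω′} → (∀ s → ω s ≈ ω′ s) → ∀ s → koszul X ω s ≈ koszul X ω′ s
    koszul-cong {zero}  X ω≈ s               = refl
    koszul-cong {suc m} X ω≈ (false ∷ S , l) = koszul-cong (X ∘ suc) (λ _ → ω≈ _) (S , l)
    koszul-cong {suc m} X ω≈ (true ∷ S , l)  =
      sub-cong (app-cong (X zero) (λ _ → ω≈ _) l) (koszul-cong (X ∘ suc) (λ _ → ω≈ _) (S , l))

    koszul-+ : ∀ {m} (X : Fin m → J ⊸ L) ω ω′ s → koszul X (λ s → ω s + ω′ s) s ≈ koszul X ω s + koszul X ω′ s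
    koszul-+ {zero}  X ω ω′ s               = sym (+-identityˡ 0#)
    koszul-+ {suc m} X ω ω′ (false ∷ S , l) = koszul-+ (X ∘ suc) _ _ (S , l)
    koszul-+ {suc m} X ω ω′ (true ∷ S , l)  = trans
      (sub-cong (app-+ (X zero) _ _ l) (koszul-+ (X ∘ suc) _ _ (S , l)))
      (solve 4 (λ a b c d → (a :+ b) :- (c :+ d) := (a :- c) :+ (b :- d)) refl _ _ _ _)

    koszul-* : ∀ {m} (X : Fin m → J ⊸ L) a ω s → koszul X (λ s → a * ω s) s ≈ a * koszul X ω s
    koszul-* {zero}  X a ω s               = sym (zeroʳ a)
    koszul-* {suc m} X a ω (false ∷ S , l) = koszul-* (X ∘ suc) a _ (S , l)
    koszul-* {suc m} X a ω (true ∷ S , l)  = trans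
      (sub-cong (app-* (X zero) a _ l) (koszul-* (X ∘ suc) a _ (S , l)))
      (solve 3 (λ a c d → a :* c :- a :* d := a :* (c :- d)) refl _ _ _)

    D : ∀ {m} → (Fin m → J ⊸ L) → Vec Bool m × J ⊸ Vec Bool m × L
    D X = record
      { app      = koszul X
      ; app-cong = koszul-cong X
      ; app-+    = koszul-+ X
      ; app-*    = koszul-* X
      }

    D-congˡ : ∀ {m} {X Y : Fin m → J ⊸ L} → (∀ i f l → app (X i) f l ≈ app (Y i) f l) →
              ∀ ω s → app (D X) ω s ≈ app (D Y) ω s
    D-congˡ {zero}  X≈Y ω s               = refl
    D-congˡ {suc m} X≈Y ω (false ∷ S , l) = D-congˡ (X≈Y ∘ suc) _ (S , l)
    D-congˡ {suc m} X≈Y ω (true ∷ S , l)  = sub-cong (X≈Y zero _ l) (D-congˡ (X≈Y ∘ suc) _ (S , l))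

    D-sum : ∀ {m n} {X : Fin m → J ⊸ L} (Y : Fin n → Fin m → J ⊸ L) →
            (∀ i f l → app (X i) f l ≈ sum (λ k → app (Y k i) f l)) →
            ∀ ω s → app (D X) ω s ≈ sum (λ k → app (D (Y k)) ω s)
    D-sum {zero}  {n} Y X≈ ω s               = sym (sum-replicate-zero n)
    D-sum {suc m}     Y X≈ ω (false ∷ S , l) = D-sum (λ k → Y k ∘ suc) (X≈ ∘ suc) _ (S , l)
    D-sum {suc m} {n} Y X≈ ω (true ∷ S , l)  = trans
      (sub-cong (X≈ zero _ l) (D-sum (λ k → Y k ∘ suc) (X≈ ∘ suc) _ (S , l)))
      (sym (sum-sub {n} _ _))

    D-scale : ∀ {m a} {X Y : Fin m → J ⊸ L} → (∀ i f l → app (X i) f l ≈ a * app (Y i) f l) →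
              ∀ ω s → app (D X) ω s ≈ a * app (D Y) ω s
    D-scale {zero}  {a} X≈ ω s               = sym (zeroʳ a)
    D-scale {suc m}     X≈ ω (false ∷ S , l) = D-scale (X≈ ∘ suc) _ (S , l)
    D-scale {suc m} {a} X≈ ω (true ∷ S , l)  = trans
      (sub-cong (X≈ zero _ l) (D-scale (X≈ ∘ suc) _ (S , l)))
      (solve 3 (λ a c d → a :* c :- a :* d := a :* (c :- d)) refl _ _ _)

  Λ : ∀ m {J L : Set} → J ⊸ L → Vec Bool m × J ⊸ Vec Bool m × L
  Λ m f = record
    { app      = λ ω (S , l) → app f (λ j → ω (S , j)) l
    ; app-cong = λ ω≈ (S , l) → app-cong f (λ j → ω≈ (S , j)) l
    ; app-+    = λ _ _ (S , l) → app-+ f _ _ l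
    ; app-*    = λ a _ (S , l) → app-* f a _ l
    }

  -- D acts on exterior indices, f and g on coefficients only. With f = g an operator this moves it
  -- past D; with `reindex` it restricts D to columns or slices of the coefficients.
  D-natural : ∀ {m} {J J′ L L′ : Set} {X : Fin m → J ⊸ L} {Y : Fin m → J′ ⊸ L′} (f : J ⊸ J′) (g : L ⊸ L′) →
              (∀ i x l → app (Y i) (app f x) l ≈ app g (app (X i) x) l) →
              ∀ ω s → app (D Y) (app (Λ m f) ω) s ≈ app (Λ m g) (app (D X) ω) s
  D-natural {zero}  f g h ω (S , l)         = sym (app-0 g (λ _ → refl) l)
  D-natural {suc m} f g h ω (false ∷ S , l) = D-natural f g (h ∘ suc) _ (S , l)
  D-natural {suc m} f g h ω (true ∷ S , l)  = trans
    (sub-cong (h zero _ l) (D-natural f g (h ∘ suc) _ (S , l)))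
    (sym (app-sub g _ _ l))

  module _ {J : Set} where

    Commute : J ⊸ J → J ⊸ J → Set _
    Commute X Y = ∀ f j → app X (app Y f) j ≈ app Y (app X f) j

    D-anticommute : ∀ {m} (X Y : Fin m → J ⊸ J) → (∀ i j → Commute (X i) (Y j)) →
                    ∀ ω s → app (D X) (app (D Y) ω) s ≈ - app (D Y) (app (D X) ω) s
    D-anticommute {zero}  X Y comm ω s               = sym -0#≈0#
    D-anticommute {suc m} X Y comm ω (false ∷ S , j) = D-anticommute (X ∘ suc) (Y ∘ suc) (λ i j → comm (suc i) (suc j)) _ (S , j)
    D-anticommute {suc m} X Y comm ω (true ∷ S , j)  = begin
      p - app (D X′) (λ (S , j) → app (Y zero) (λ j → ω (false ∷ S , j)) j - app (D Y′) ωₜ (S , j)) (S , j)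
        ≈⟨ +-congˡ (-‿cong (app-sub (D X′) _ _ (S , j))) ⟩
      p - (app (D X′) (app (Λ m (Y zero)) ωf) (S , j) - app (D X′) (app (D Y′) ωₜ) (S , j))
        ≈⟨ sub-cong (sym (D-natural (X zero) (X zero) (λ i f j → sym (comm zero (suc i) f j)) ωf (S , j)))
             (sub-cong (D-natural (Y zero) (Y zero) (λ i f j → comm (suc i) zero f j) ωf (S , j))
               (D-anticommute X′ Y′ (λ i j → comm (suc i) (suc j)) ωₜ (S , j))) ⟩
      q - (r - - t)
        ≈⟨ solve 3 (λ q r t → q :- (r :- :- t) := :- (r :- (q :- t))) refl q r t ⟩
      - (r - (q - t))
        ≈⟨ -‿cong (+-congˡ (-‿cong (app-sub (D Y′) _ _ (S , j)))) ⟨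
      - (r - app (D Y′) (λ (S , j) → app (X zero) (λ j → ω (false ∷ S , j)) j - app (D X′) ωₜ (S , j)) (S , j))  ∎
      where
      X′ Y′ : Fin m → J ⊸ J
      X′ = X ∘ suc
      Y′ = Y ∘ suc
      ωf ωₜ : Vec Bool m × J → Carrier
      ωf (S , j) = ω (false ∷ S , j)
      ωₜ (S , j) = ω (true ∷ S , j)
      p q r t : Carrier
      p = app (X zero) (λ j → app (D Y′) ωf (S , j)) j
      q = app (D Y′) (app (Λ m (X zero)) ωf) (S , j)
      r = app (Y zero) (λ j → app (D X′) ωf (S , j)) j
      t = app (D Y′) (app (D X′) ωₜ) (S , j)

    -- The cross terms cancel directly. Setting Y = X in `D-anticommute` would give only twice this
    -- identity.
    D∘D≈0 : ∀ {m} (X : Fin m → J ⊸ J) → (∀ i j → Commute (X i) (X j)) →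
            ∀ ω s → app (D X) (app (D X) ω) s ≈ 0#
    D∘D≈0 {zero}  X comm ω s               = refl
    D∘D≈0 {suc m} X comm ω (false ∷ S , j) = D∘D≈0 (X ∘ suc) (λ i j → comm (suc i) (suc j)) _ (S , j)
    D∘D≈0 {suc m} X comm ω (true ∷ S , j)  = trans (+-congˡ (-‿cong (app-sub (D (X ∘ suc)) _ _ (S , j))))
      (trans (sub-cong (sym (D-natural (X zero) (X zero) (λ i f j → sym (comm zero (suc i) f j)) _ (S , j)))
          (sub-cong refl (D∘D≈0 (X ∘ suc) (λ i j → comm (suc i) (suc j)) _ (S , j))))
        (solve 1 (λ q → q :- (q :- con (0 , 0)) := con (0 , 0)) refl _))

  scalar : ∀ {J} → Carrier → J ⊸ J
  scalar a = record
    { app      = λ f j → a * f j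
    ; app-cong = λ f≈ j → *-congˡ (f≈ j)
    ; app-+    = λ f g j → distribˡ a (f j) (g j)
    ; app-*    = λ b f j → solve 3 (λ a b f → a :* (b :* f) := b :* (a :* f)) refl a b (f j)
    }

  wedge : ∀ {m J} → (Fin m → Carrier) → Vec Bool m × J ⊸ Vec Bool m × J
  wedge a = D (λ i → scalar (a i))

  wedge-congˡ : ∀ {m J} {a a′ : Fin m → Carrier} → (∀ i → a i ≈ a′ i) →
                ∀ (ω : Vec Bool m × J → Carrier) s → app (wedge a) ω s ≈ app (wedge a′) ω s
  wedge-congˡ a≈ = D-congˡ (λ i f l → *-congʳ (a≈ i))

  wedge-zero : ∀ {m J} {a : Fin m → Carrier} → (∀ i → a i ≈ 0#) →
               ∀ (ω : Vec Bool m × J → Carrier) s → app (wedge a) ω s ≈ 0#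
  wedge-zero {a = a} a≈0 ω s = trans
    (D-scale {a = 0#} {Y = λ i → scalar (a i)} (λ i f l → trans (*-congʳ (a≈0 i)) (trans (zeroˡ _) (sym (zeroˡ _)))) ω s) (zeroˡ _)

  -- The exterior product v₀ ∧ v₁ ∧ ⋯ ; its top coordinate is the determinant.
  ⋀ : ∀ {e m} → (Fin e → Fin m → Carrier) → Vec Bool m × Unit.⊤ → Carrier
  ⋀ {zero}  {zero}  v _               = 1#
  ⋀ {zero}  {suc m} v (false ∷ S , _) = ⋀ {zero} {m} (λ ()) (S , _)
  ⋀ {zero}  {suc m} v (true ∷ S , _)  = 0#
  ⋀ {suc e}         v                 = app (wedge (v zero)) (⋀ (v ∘ suc))

  scalars-commute : ∀ {J} a b → Commute {J} (scalar a) (scalar b)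
  scalars-commute a b f j = solve 3 (λ a b f → a :* (b :* f) := b :* (a :* f)) refl a b (f j)

  ⋀-cong : ∀ {e m} {v v′ : Fin e → Fin m → Carrier} → (∀ k i → v k i ≈ v′ k i) → ∀ s → ⋀ v s ≈ ⋀ v′ s
  ⋀-cong {zero}  {zero}  v≈ s               = refl
  ⋀-cong {zero}  {suc m} v≈ (false ∷ S , _) = ⋀-cong {zero} {m} {λ ()} {λ ()} (λ ()) (S , _)
  ⋀-cong {zero}  {suc m} v≈ (true ∷ S , _)  = refl
  ⋀-cong {suc e} {m} {v} {v′} v≈ s = trans (wedge-congˡ (v≈ zero) _ s) (app-cong (wedge (v′ zero)) (⋀-cong (v≈ ∘ suc)) s)

  -- The factor `v k` is moved past its predecessors by anticommutation until it meets itself.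
  wedge-repeated : ∀ {e m} (v : Fin e → Fin m → Carrier) k s → app (wedge (v k)) (⋀ v) s ≈ 0#
  wedge-repeated v zero    s = D∘D≈0 (λ i → scalar (v zero i)) (λ i j → scalars-commute (v zero i) (v zero j)) _ s
  wedge-repeated v (suc k) s = trans
    (D-anticommute (λ i → scalar (v (suc k) i)) (λ i → scalar (v zero i)) (λ i j → scalars-commute (v (suc k) i) (v zero j)) _ s)
    (trans (-‿cong (app-0 (wedge (v zero)) (wedge-repeated (v ∘ suc) k) s)) -0#≈0#)

  wedge-combination : ∀ {e m} (v : Fin e → Fin m → Carrier) (a : Fin e → Carrier) s →
                      app (wedge (λ i → sum (λ k → a k * v k i))) (⋀ v) s ≈ 0#
  wedge-combination {e} v a s = trans
    (D-sum (λ k i → scalar (a k * v k i)) (λ i f l → *-distribʳ-sum (f l) (λ k → a k * v k i)) _ s)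
    (sum-zero {e} _ (λ k → trans
      (D-scale {a = a k} {Y = λ i → scalar (v k i)} (λ i f l → *-assoc (a k) (v k i) (f l)) _ s)
      (trans (*-congˡ (wedge-repeated v k s)) (zeroʳ (a k)))))

  -- If the first coefficient is nonzero, the first vector is a combination of the others and every
  -- term repeats a factor. If it is zero, the relation involves the remaining vectors only. The
  -- case distinction is legitimate because the goal is stable.
  ⋀-dependent : ∀ {e m} (v : Fin e → Fin m → Carrier) (a : Fin e → Carrier) →
                (∀ i → sum (λ k → a k * v k i) ≈ 0#) → ∀ j → ¬ a j ≈ 0# → ∀ s → ⋀ v s ≈ 0#
  ⋀-dependent {suc e} v a Σ≈0 j aj≉0 s = ≈0-stable (do
    no a₀≉0 ← ¬¬-excluded-middle {A = a zero ≈ 0#}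
      where yes a₀≈0 → return (zero-head a₀≈0 j aj≉0)
    (w , wa≈1) ← invertible a₀≉0
    return (trans (wedge-congˡ (head w wa≈1) _ s) (wedge-combination (v ∘ suc) (λ k → - w * a (suc k)) s)))
    where
    zero-head : a zero ≈ 0# → ∀ j → ¬ a j ≈ 0# → ⋀ v s ≈ 0#
    zero-head a₀≈0 zero    aj≉0 = contradiction a₀≈0 aj≉0
    zero-head a₀≈0 (suc j) aj≉0 = app-0 (wedge (v zero)) (⋀-dependent (v ∘ suc) (a ∘ suc)
      (λ i → trans (sym (trans (+-congʳ (trans (*-congʳ a₀≈0) (zeroˡ _))) (+-identityˡ _))) (Σ≈0 i)) j aj≉0) s

    head : ∀ w → w * a zero ≈ 1# → ∀ i → v zero i ≈ sum (λ k → - w * a (suc k) * v (suc k) i)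
    head w wa≈1 i = begin
      v zero i                                            ≈⟨ *-identityˡ _ ⟨
      1# * v zero i                                       ≈⟨ *-congʳ wa≈1 ⟨
      w * a zero * v zero i                               ≈⟨ solve 4 (λ w a v t → w :* a :* v := w :* (a :* v :+ t) :+ (:- w) :* t) refl w (a zero) (v zero i) t ⟩
      w * (a zero * v zero i + t) + - w * t               ≈⟨ +-congʳ (trans (*-congˡ (Σ≈0 i)) (zeroʳ w)) ⟩
      0# + - w * t                                        ≈⟨ +-identityˡ _ ⟩
      - w * t                                             ≈⟨ *-distribˡ-sum (- w) (λ k → a (suc k) * v (suc k) i) ⟩
      sum (λ k → - w * (a (suc k) * v (suc k) i))         ≈⟨ sum-cong-≋ (λ k → sym (*-assoc (- w) (a (suc k)) (v (suc k) i))) ⟩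
      sum (λ k → - w * a (suc k) * v (suc k) i)           ∎
      where
      t : Carrier
      t = sum (λ k → a (suc k) * v (suc k) i)

  ⋀-extend : ∀ {e m} (v : Fin e → Fin (suc m) → Carrier) → (∀ k → v k zero ≈ 0#) →
             ∀ S → ⋀ v (false ∷ S , _) ≈ ⋀ (λ k → v k ∘ suc) (S , _)
  ⋀-extend {zero}  {m} v v₀≈0 S = ⋀-cong {zero} {m} {λ ()} {λ k → v k ∘ suc} (λ ()) (S , _)
  ⋀-extend {suc e} v v₀≈0 S = koszul-cong (λ i → scalar (v zero (suc i))) (λ (S , _) → ⋀-extend (v ∘ suc) (v₀≈0 ∘ suc) S) (S , _)

  ⋀-δ : ∀ m → ⋀ (δ {m}) (⊤ , _) ≈ 1#
  ⋀-δ zero    = refl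
  ⋀-δ (suc m) = trans
    (sub-cong (trans (*-identityˡ _) (trans (⋀-extend {m} {m} (λ k → δ (suc k)) (λ _ → refl) ⊤) (⋀-δ m)))
      (wedge-zero {m} {Unit.⊤} {λ _ → 0#} (λ _ → refl) (λ (S , t) → ⋀ {m} (λ k → δ (suc k)) (true ∷ S , t)) (⊤ , _)))
    (trans (+-congˡ -0#≈0#) (+-identityʳ 1#))

  -- Polynomials on the Boolean cube.

  -- Deg N d g: the function g of N variables with values in {0, 1} is a
  -- polynomial of degree at most d; multiplying out is possible because x² = x.
  Deg : ∀ N → ℕ → (Subset N → Carrier) → Set ℓ
  Deg zero    d       g = Lift ℓ Unit.⊤
  Deg (suc N) zero    g = Deg N zero (λ S → g (false ∷ S)) × (∀ S → g (true ∷ S) - g (false ∷ S) ≈ 0#)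
  Deg (suc N) (suc d) g = Deg N (suc d) (λ S → g (false ∷ S)) × Deg N d (λ S → g (true ∷ S) - g (false ∷ S))

  Deg-cong : ∀ {N d g h} → (∀ S → g S ≈ h S) → Deg N d g → Deg N d h
  Deg-cong {zero}          g≈h _       = lift Unit.tt
  Deg-cong {suc N} {zero}  g≈h (p , q) = Deg-cong (λ S → g≈h (false ∷ S)) p , λ S → trans (sub-cong (sym (g≈h _)) (sym (g≈h _))) (q S)
  Deg-cong {suc N} {suc d} g≈h (p , q) = Deg-cong (λ S → g≈h (false ∷ S)) p , Deg-cong (λ S → sub-cong (g≈h _) (g≈h _)) q

  Deg-zero : ∀ {N d g} → (∀ S → g S ≈ 0#) → Deg N d g
  Deg-zero {zero}          g≈0 = lift Unit.tt
  Deg-zero {suc N} {zero}  g≈0 = Deg-zero (λ S → g≈0 _) , λ S → trans (sub-cong (g≈0 _) (g≈0 _)) (-‿inverseʳ 0#)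
  Deg-zero {suc N} {suc d} g≈0 = Deg-zero (λ S → g≈0 _) , Deg-zero (λ S → trans (sub-cong (g≈0 _) (g≈0 _)) (-‿inverseʳ 0#))

  Deg-const : ∀ {N d} a → Deg N d (λ _ → a)
  Deg-const {zero}          a = lift Unit.tt
  Deg-const {suc N} {zero}  a = Deg-const a , λ S → -‿inverseʳ a
  Deg-const {suc N} {suc d} a = Deg-const a , Deg-zero (λ S → -‿inverseʳ a)

  Deg-+ : ∀ {N d g h} → Deg N d g → Deg N d h → Deg N d (λ S → g S + h S)
  Deg-+ {zero}          _       _         = lift Unit.tt
  Deg-+ {suc N} {zero}  {g} {h} (p , q) (p′ , q′) = Deg-+ p p′ , λ S → trans
    (solve 4 (λ a b c d → (a :+ b) :- (c :+ d) := (a :- c) :+ (b :- d)) refl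
      (g (true ∷ S)) (h (true ∷ S)) (g (false ∷ S)) (h (false ∷ S)))
    (trans (+-cong (q S) (q′ S)) (+-identityˡ 0#))
  Deg-+ {suc N} {suc d} {g} {h} (p , q) (p′ , q′) = Deg-+ p p′ , Deg-cong
    (λ S → solve 4 (λ a b c d → (a :- c) :+ (b :- d) := (a :+ b) :- (c :+ d)) refl
      (g (true ∷ S)) (h (true ∷ S)) (g (false ∷ S)) (h (false ∷ S)))
    (Deg-+ q q′)

  Deg-scale : ∀ {N d g} a → Deg N d g → Deg N d (λ S → a * g S)
  Deg-scale {zero}          a _       = lift Unit.tt
  Deg-scale {suc N} {zero} {g} a (p , q) = Deg-scale a p , λ S → trans
    (solve 3 (λ a b c → a :* b :- a :* c := a :* (b :- c)) refl a (g (true ∷ S)) (g (false ∷ S)))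
    (trans (*-congˡ (q S)) (zeroʳ a))
  Deg-scale {suc N} {suc d} {g} a (p , q) = Deg-scale a p , Deg-cong
    (λ S → solve 3 (λ a b c → a :* (b :- c) := a :* b :- a :* c) refl a (g (true ∷ S)) (g (false ∷ S)))
    (Deg-scale a q)

  Deg-sub : ∀ {N d g h} → Deg N d g → Deg N d h → Deg N d (λ S → g S - h S)
  Deg-sub p q = Deg-cong (λ S → +-congˡ (-1*x≈-x _)) (Deg-+ p (Deg-scale (- 1#) q))

  Deg-sum : ∀ {N d n} {g : Fin n → Subset N → Carrier} → (∀ k → Deg N d (g k)) → Deg N d (λ S → sum (λ k → g k S))
  Deg-sum {n = zero}  p = Deg-const 0#
  Deg-sum {n = suc n} p = Deg-+ (p zero) (Deg-sum (p ∘ suc))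

  Deg-weaken : ∀ {N d d′ g} → d ≤ d′ → Deg N d g → Deg N d′ g
  Deg-weaken {zero}                    d≤d′       _       = lift Unit.tt
  Deg-weaken {suc N} {zero}  {zero}    d≤d′       (p , q) = p , q
  Deg-weaken {suc N} {zero}  {suc d′}  d≤d′       (p , q) = Deg-weaken z≤n p , Deg-zero q
  Deg-weaken {suc N} {suc d} {suc d′}  (s≤s d≤d′) (p , q) = Deg-weaken (s≤s d≤d′) p , Deg-weaken d≤d′ q

  -- With Δ the difference in the first variable, Δ(gh) = g Δh + Δg h + Δg Δh, the undifferenced
  -- factors being taken at `false`. Each Δ lowers a positive degree by one and annihilates degree
  -- 0, which is why the zero cases are separate.
  Deg-* : ∀ {N d e g h} → Deg N d g → Deg N e h → Deg N (d ℕ.+ e) (λ S → g S * h S)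
  Deg-* {zero} _ _ = lift Unit.tt
  Deg-* {suc N} {d} {e} {g} {h} dg dh = go d e dg dh
    where
    g₀ h₀ g₁ h₁ : Subset N → Carrier
    g₀ S = g (false ∷ S)
    h₀ S = h (false ∷ S)
    g₁ S = g (true ∷ S) - g (false ∷ S)
    h₁ S = h (true ∷ S) - h (false ∷ S)

    difference : ∀ S → (g₀ S * h₁ S + g₁ S * h₀ S) + g₁ S * h₁ S ≈ g (true ∷ S) * h (true ∷ S) - g₀ S * h₀ S
    difference S = solve 4 (λ a b c d → (a :* (d :- b) :+ (c :- a) :* b) :+ (c :- a) :* (d :- b) := c :* d :- a :* b) refl
      (g₀ S) (h₀ S) (g (true ∷ S)) (h (true ∷ S))

    zero-* : ∀ {f k : Subset N → Carrier} → (∀ S → f S ≈ 0#) → ∀ S → f S * k S ≈ 0#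
    zero-* f≈0 S = trans (*-congʳ (f≈0 S)) (zeroˡ _)

    *-zero : ∀ {f k : Subset N → Carrier} → (∀ S → k S ≈ 0#) → ∀ S → f S * k S ≈ 0#
    *-zero k≈0 S = trans (*-congˡ (k≈0 S)) (zeroʳ _)

    go : ∀ d e → Deg (suc N) d g → Deg (suc N) e h → Deg (suc N) (d ℕ.+ e) (λ S → g S * h S)
    go zero zero (p , q) (p′ , q′) = Deg-* p p′ , λ S → trans (sym (difference S))
      (trans (+-cong (trans (+-cong (*-zero {g₀} {h₁} q′ S) (zero-* {g₁} {h₀} q S)) (+-identityˡ 0#)) (zero-* {g₁} {h₁} q S)) (+-identityˡ 0#))
    go zero (suc e) (p , q) (p′ , q′) = Deg-* p p′ , Deg-cong difference
      (Deg-+ (Deg-+ (Deg-* p q′) (Deg-zero (zero-* {g₁} {h₀} q))) (Deg-zero (zero-* {g₁} {h₁} q)))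
    go (suc d) zero (p , q) (p′ , q′) = Deg-* p p′ , Deg-cong difference
      (Deg-+ (Deg-+ (Deg-zero (*-zero {g₀} {h₁} q′)) (Deg-* q p′)) (Deg-zero (*-zero {g₁} {h₁} q′)))
    go (suc d) (suc e) (p , q) (p′ , q′) = Deg-* p p′ , Deg-cong difference
      (Deg-+ (Deg-+ (Deg-weaken (ℕₚ.≤-reflexive (≡.sym (ℕₚ.+-suc d e))) (Deg-* p q′)) (Deg-* q p′))
        (Deg-weaken (ℕₚ.+-monoʳ-≤ d (ℕₚ.n≤1+n e)) (Deg-* q q′)))

  -- Induction on the variables. The difference in the first variable has degree d - 1, and it
  -- vanishes on sets of size at most d - 1 because adding the first variable keeps the size within
  -- d.
  Deg-vanish : ∀ {N d g} → Deg N d g → (∀ S → ∣ S ∣ ≤ d → g S ≈ 0#) → ∀ S → g S ≈ 0#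
  Deg-vanish {zero}  p       g≈0 []          = g≈0 [] z≤n
  Deg-vanish {suc N} {zero} (p , q) g≈0 (false ∷ S) = Deg-vanish p (λ S → g≈0 (false ∷ S)) S
  Deg-vanish {suc N} {suc d} (p , q) g≈0 (false ∷ S) = Deg-vanish p (λ S → g≈0 (false ∷ S)) S
  Deg-vanish {suc N} {zero} {g} (p , q) g≈0 (true ∷ S) = begin
    g (true ∷ S)                                        ≈⟨ solve 2 (λ x y → x := (x :- y) :+ y) refl _ _ ⟩
    (g (true ∷ S) - g (false ∷ S)) + g (false ∷ S)      ≈⟨ +-cong (q S) (Deg-vanish p (λ S → g≈0 (false ∷ S)) S) ⟩
    0# + 0#                                             ≈⟨ +-identityˡ 0# ⟩
    0#                                                  ∎
  Deg-vanish {suc N} {suc d} {g} (p , q) g≈0 (true ∷ S) = begin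
    g (true ∷ S)                                        ≈⟨ solve 2 (λ x y → x := (x :- y) :+ y) refl _ _ ⟩
    (g (true ∷ S) - g (false ∷ S)) + g (false ∷ S)      ≈⟨ +-cong (Deg-vanish q (λ S ∣S∣≤d → trans
                                                             (sub-cong (g≈0 (true ∷ S) (s≤s ∣S∣≤d)) (g≈0 (false ∷ S) (ℕₚ.m≤n⇒m≤1+n ∣S∣≤d)))
                                                             (-‿inverseʳ 0#)) S)
                                                           (Deg-vanish p (λ S → g≈0 (false ∷ S)) S) ⟩
    0# + 0#                                             ≈⟨ +-identityˡ 0# ⟩
    0#                                                  ∎

  Deg-nonvanishing : ∀ {N d g} → Deg N d g → ∀ S → ¬ g S ≈ 0# → ¬ ¬ ∃ λ S → ∣ S ∣ ≤ d × ¬ g S ≈ 0#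
  Deg-nonvanishing p S gS≉0 none = gS≉0 (Deg-vanish p (λ S ∣S∣≤d → ≈0-stable (λ gS≉0 → none (S , ∣S∣≤d , gS≉0))) S)

  Deg-variable : ∀ {N} (k : Fin N) a → Deg N 1 (λ S → if lookup S k then a else 0#)
  Deg-variable zero    a = Deg-const 0# , Deg-const (a - 0#)
  Deg-variable (suc k) a = Deg-variable k a , Deg-zero (λ S → -‿inverseʳ _)

  Deg-linear : ∀ {N d n J} (f : Fin n ⊸ J) {x : Subset N → Fin n → Carrier} →
               (∀ i → Deg N d (λ S → x S i)) → ∀ j → Deg N d (λ S → app f (x S) j)
  Deg-linear f {x} dx j = Deg-cong (λ S → sym (app-expand f (x S) j))
    (Deg-sum (λ k → Deg-cong (λ S → *-comm _ _) (Deg-scale (app f (δ k) j) (dx k))))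

  Deg-koszul : ∀ {N d e m J L} (X : Subset N → Fin m → J ⊸ L) →
               (∀ i {f : Subset N → J → Carrier} → (∀ j → Deg N d (λ S → f S j)) → ∀ l → Deg N e (λ S → app (X S i) (f S) l)) →
               ∀ {ω : Subset N → Vec Bool m × J → Carrier} → (∀ s → Deg N d (λ S → ω S s)) →
               ∀ s → Deg N e (λ S → app (D (X S)) (ω S) s)
  Deg-koszul {m = zero}  X dX dω s               = Deg-const 0#
  Deg-koszul {m = suc m} X dX dω (false ∷ T , l) = Deg-koszul (λ S i → X S (suc i)) (λ i → dX (suc i)) (λ s → dω _) (T , l)
  Deg-koszul {m = suc m} X dX dω (true ∷ T , l)  =
    Deg-sub (dX zero (λ j → dω _) l) (Deg-koszul (λ S i → X S (suc i)) (λ i → dX (suc i)) (λ s → dω _) (T , l))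

  Deg-⋀ : ∀ {N d e m} (v : Subset N → Fin e → Fin m → Carrier) → (∀ k i → Deg N d (λ S → v S k i)) →
          ∀ s → Deg N (e ℕ.* d) (λ S → ⋀ (v S) s)
  Deg-⋀ {e = zero}  {m} v dv s = Deg-cong (λ S → ⋀-cong {zero} {m} {λ ()} {v S} (λ ()) s) (Deg-const (⋀ {zero} {m} (λ ()) s))
  Deg-⋀ {e = suc e} v dv s =
    Deg-koszul (λ S i → scalar (v S zero i)) (λ i df j → Deg-* (dv zero i) (df j)) (Deg-⋀ (λ S k → v S (suc k)) (λ k → dv (suc k))) s

  -- Compose `G S` with a left inverse of `G ⊤`. The determinant of the resulting n × n matrix has
  -- degree at most n d in S and equals 1 at ⊤, so it is nonzero at some S of size at most n d; a
  -- kernel vector of `G S` would make it vanish.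
  small-support : ∀ {N d n R} (G : Subset N → Fin n ⊸ R) → (∀ k ρ → Deg N d (λ S → app (G S) (δ k) ρ)) →
                  TrivialKernel (G ⊤) → ¬ ¬ ∃ λ S → ∣ S ∣ ≤ n ℕ.* d × TrivialKernel (G S)
  small-support {N} {d} {n} G dG ker = do
    basis ← dualBasisFin n (G ⊤) ker
    let open DualBasis basis
        v : Subset N → Fin n → Fin n → Carrier
        v S k = app (leftInverse basis ⊙ G S) (δ k)
        det = λ S → ⋀ (v S) (⊤ , _)
        det-deg = Deg-⋀ v (λ k i → Deg-sum (λ l → Deg-cong (λ S → *-comm _ _) (Deg-scale (b l i) (dG k (ι l))))) (⊤ , _)
        det⊤≈1 = trans (⋀-cong (λ k i → sym (span (δ k) i)) (⊤ , _)) (⋀-δ n)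
    (S , ∣S∣≤ , det≉0) ← Deg-nonvanishing {g = det} det-deg ⊤ (λ det≈0 → 1≉0 (trans (sym det⊤≈1) det≈0))
    return (S , ∣S∣≤ , λ x Gx≈0 k → ≈0-stable (λ xk≉0 → det≉0
      (⋀-dependent (v S) x
        (λ i → trans (sym (app-expand (leftInverse basis ⊙ G S) x i)) (app-0 (leftInverse basis) Gx≈0 i)) k xk≉0 (⊤ , _))))

  -- The rank of exterior multiplication by a vector.

  Supported : ∀ {m} {J : Set} → (ℕ → Set) → (Vec Bool m × J → Carrier) → Set ℓ
  Supported P ω = ∀ S j → ¬ P ∣ S ∣ → ω (S , j) ≈ 0#

  D-supported : ∀ {m J L} P Q (X : Fin m → J ⊸ L) → (∀ {n} → P n → Q (suc n)) →
                ∀ {ω} → Supported P ω → Supported Q (app (D X) ω)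
  D-supported {zero}  P Q X P⇒Q supp S           l ¬Q = refl
  D-supported {suc m} P Q X P⇒Q supp (false ∷ S) l ¬Q = D-supported P Q (X ∘ suc) P⇒Q (λ S → supp (false ∷ S)) S l ¬Q
  D-supported {suc m} P Q X P⇒Q supp (true ∷ S)  l ¬Q = trans
    (sub-cong (app-0 (X zero) (λ j → supp (false ∷ S) j (¬Q ∘ P⇒Q)) l)
      (D-supported (P ∘ suc) (Q ∘ suc) (X ∘ suc) P⇒Q (λ S → supp (true ∷ S)) S l ¬Q))
    (-‿inverseʳ 0#)

  slice : ∀ {m} {J : Set} → Bool → (Vec Bool (suc m) × J → Carrier) → Vec Bool m × J → Carrier
  slice b ω (S , j) = ω (b ∷ S , j)

  -- Rank at most C(m, k), expressed by naming that many coordinates of a ∧ ω that force the others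
  -- to vanish. In the final count these coordinates become the rows contributed by one term.
  WedgeRank : ∀ m k → (Fin (suc m) → Carrier) → Set (c ⊔ ℓ)
  WedgeRank m k a = ∃ λ (s : Combination m k → Subset (suc m)) →
    ∀ (ω : Vec Bool (suc m) × Unit.⊤ → Carrier) → Supported (_≡ k) ω →
    (∀ T → app (wedge a) ω (s T , _) ≈ 0#) → ∀ t → app (wedge a) ω t ≈ 0#

  -- If a₀ ≠ 0 then a ∧ ω vanishes as soon as its coordinates at the subsets containing 0 do.
  module _ {m k w} {a : Fin (suc m) → Carrier} (wa≈1 : w * a zero ≈ 1#) {ω : Vec Bool (suc m) × Unit.⊤ → Carrier}
           (supp : Supported (_≡ k) ω) (vanish : ∀ T → app (wedge a) ω (true ∷ toSubset {k = k} T , _) ≈ 0#) where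

    private
      a′ : Fin m → Carrier
      a′ = a ∘ suc
      ωf ωₜ : Vec Bool m × Unit.⊤ → Carrier
      ωf (S , j) = ω (false ∷ S , j)
      ωₜ (S , j) = ω (true ∷ S , j)

      tail-supported : ∀ {k} → Supported (λ n → suc n ≡ k) ωₜ → Supported (_≡ k) (app (wedge a′) ωₜ)
      tail-supported {zero}  s S j ¬Q = app-0 (wedge a′) (λ (S , j) → s S j (λ ())) (S , j)
      tail-supported {suc k} s = D-supported (_≡ k) (_≡ suc k) (λ i → scalar (a′ i)) (≡.cong suc) (λ S j ¬P → s S j (¬P ∘ ℕₚ.suc-injective))

      contraction : ∀ S → a zero * ωf (S , _) - app (wedge a′) ωₜ (S , _) ≈ 0#
      contraction S with ∣ S ∣ ℕₚ.≟ k
      ... | yes ∣S∣≡k = let (T , T≡S) = fromSubset S ∣S∣≡k in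
        ≡.subst (λ S → app (wedge a) ω (true ∷ S , _) ≈ 0#) T≡S (vanish T)
      ... | no ∣S∣≢k = trans
        (sub-cong (trans (*-congˡ (supp (false ∷ S) _ ∣S∣≢k)) (zeroʳ _))
          (tail-supported (λ S → supp (true ∷ S)) S _ ∣S∣≢k))
        (-‿inverseʳ 0#)

      head : ∀ s → ωf s ≈ w * app (wedge a′) ωₜ s
      head (S , j) = begin
        x                                   ≈⟨ *-identityˡ x ⟨
        1# * x                              ≈⟨ *-congʳ wa≈1 ⟨
        w * a zero * x                      ≈⟨ solve 4 (λ w a x y → w :* a :* x := w :* (a :* x :- y) :+ w :* y) refl w (a zero) x y ⟩
        w * (a zero * x - y) + w * y        ≈⟨ +-congʳ (trans (*-congˡ (contraction S)) (zeroʳ w)) ⟩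
        0# + w * y                          ≈⟨ +-identityˡ _ ⟩
        w * y                               ∎
        where
        x y : Carrier
        x = ωf (S , j)
        y = app (wedge a′) ωₜ (S , j)

    wedge-rank-pivot : ∀ t → app (wedge a) ω t ≈ 0#
    wedge-rank-pivot (true ∷ S , j)  = contraction S
    wedge-rank-pivot (false ∷ S , j) = trans (app-cong (wedge a′) head (S , j))
      (trans (app-* (wedge a′) w _ (S , j))
        (trans (*-congˡ (D∘D≈0 (λ i → scalar (a′ i)) (λ i j → scalars-commute (a′ i) (a′ j)) ωₜ (S , j))) (zeroʳ w)))

  module _ {m} {a : Fin (suc (suc m)) → Carrier} (a₀≈0 : a zero ≈ 0#) where

    private
      negated : ∀ (ω : Vec Bool (suc (suc m)) × Unit.⊤ → Carrier) S → app (wedge a) ω (true ∷ S , _) ≈ - app (wedge (a ∘ suc)) (slice true ω) (S , _)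
      negated ω S = trans (+-congʳ (trans (*-congʳ a₀≈0) (zeroˡ _))) (+-identityˡ _)

      vanish-tail : ∀ (ω : Vec Bool (suc (suc m)) × Unit.⊤ → Carrier) {S} → app (wedge a) ω (true ∷ S , _) ≈ 0# → app (wedge (a ∘ suc)) (slice true ω) (S , _) ≈ 0#
      vanish-tail ω {S} eq = trans (sym (-‿involutive _))
        (trans (-‿cong (trans (sym (negated ω S)) eq)) -0#≈0#)

    wedge-rank-0 : WedgeRank m 0 (a ∘ suc) → WedgeRank (suc m) 0 a
    wedge-rank-0 (s , h) = (λ { (skip T) → false ∷ s T }) , λ ω supp vanish →
      λ { (false ∷ S , j) → h (slice false ω) (λ S → supp (false ∷ S)) (λ T → vanish (skip T)) (S , j)
        ; (true ∷ S , j) → trans (negated ω S) (trans (-‿cong (app-0 (wedge (a ∘ suc)) {slice true ω} (λ (S , j) → supp (true ∷ S) j (λ ())) (S , _))) -0#≈0#) }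

    -- With a₀ = 0 the parts of ω with and without e₀ do not interact, and their ranks add up by
    -- Pascal's rule.
    wedge-rank-suc : ∀ {k} → WedgeRank m (suc k) (a ∘ suc) → WedgeRank m k (a ∘ suc) → WedgeRank (suc m) (suc k) a
    wedge-rank-suc (s , h) (s′ , h′) = (λ { (skip T) → false ∷ s T ; (pick T) → true ∷ s′ T }) , λ ω supp vanish →
      λ { (false ∷ S , j) → h (slice false ω) (λ S → supp (false ∷ S)) (λ T → vanish (skip T)) (S , j)
        ; (true ∷ S , j) → trans (negated ω S) (trans (-‿cong (h′ (slice true ω) (λ S j ¬P → supp (true ∷ S) j (¬P ∘ ℕₚ.suc-injective))
            (λ T → vanish-tail ω (vanish (pick T))) (S , _))) -0#≈0#) }

  wedge-rank : ∀ m k a → ¬ ¬ WedgeRank m k a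
  wedge-rank m k a = do
    no a₀≉0 ← ¬¬-excluded-middle {A = a zero ≈ 0#}
      where yes a₀≈0 → zero-head m k a a₀≈0
    (w , wa≈1) ← invertible a₀≉0
    return ((λ T → true ∷ toSubset T) , λ ω → wedge-rank-pivot {m} {k} {w} {a} wa≈1 {ω})
    where
    zero-head : ∀ m k a → a zero ≈ 0# → ¬ ¬ WedgeRank m k a
    -- In K^1 the vector is zero and so is every product; the chosen subset is a placeholder.
    zero-head zero    k       a a₀≈0 = return ((λ _ → ⊤) , λ ω _ _ → wedge-zero {a = a} (λ { zero → a₀≈0 }) ω)
    zero-head (suc m) zero    a a₀≈0 = do
      h ← wedge-rank m zero (a ∘ suc)
      return (wedge-rank-0 {m} {a} a₀≈0 h)
    zero-head (suc m) (suc k) a a₀≈0 = do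
      h ← wedge-rank m (suc k) (a ∘ suc)
      h′ ← wedge-rank m k (a ∘ suc)
      return (wedge-rank-suc {m} {a} a₀≈0 h h′)

  -- Hard Lefschetz.

  iterate : ∀ {I} → I ⊸ I → ℕ → I ⊸ I
  iterate f zero    = reindex id
  iterate f (suc j) = f ⊙ iterate f j

  D² : ∀ {m} {J : Set} → (Fin m → J ⊸ J) → Vec Bool m × J ⊸ Vec Bool m × J
  D² X = D X ⊙ D X

  infixr 5 _◂_
  _◂_ : ∀ {a} {A : Set a} {m} → A → (Fin m → A) → Fin (suc m) → A
  (x ◂ xs) zero    = x
  (x ◂ xs) (suc i) = xs i

  -- Hard Lefschetz for the operator D² on Λ(K^2q) ⊗ K^J, in all degrees below k at once.
  Lefschetz : ∀ {J : Set} q → (Fin (double q) → J ⊸ J) → Set (c ⊔ ℓ)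
  Lefschetz {J} q X = ∀ k j (ω : Vec Bool (double q) × J → Carrier) → Supported (_< k) ω → k ℕ.+ j ≤ suc q →
    (∀ s → app (iterate (D² X) j) ω s ≈ 0#) → ∀ s → ω s ≈ 0#

  difference-of-difference : ∀ {p q x} → p ≈ q → p - (q - x) ≈ x
  difference-of-difference {p} {q} {x} p≈q = trans (+-congʳ p≈q) (solve 2 (λ q x → q :- (q :- x) := x) refl q x)

  module _ {J : Set} {q : ℕ} (X : Fin (double q) → J ⊸ J) {P Q Z : J ⊸ J}
           (PX : ∀ i → Commute P (X i)) (QX : ∀ i → Commute Q (X i)) (ZX : ∀ i → Commute Z (X i))
           (PQ : ∀ f j → app P (app Q f) j - app Q (app P f) j ≈ app Z f j)
           (Z-trivial : TrivialKernel Z)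
           (L : Lefschetz q X) where

    private
      m : ℕ
      m = double q
      X⁺ : Fin (suc (suc m)) → J ⊸ J
      X⁺ = P ◂ Q ◂ X
      E : Vec Bool m × J ⊸ Vec Bool m × J
      E = D² X
      Form : Set c
      Form = Vec Bool m × J → Carrier
      Form⁺ : Set c
      Form⁺ = Vec Bool (suc (suc m)) × J → Carrier

      D-commutes : ∀ {Y : J ⊸ J} → (∀ i → Commute Y (X i)) → ∀ (ω : Form) s →
                   app (Λ m Y) (app (D X) ω) s ≈ app (D X) (app (Λ m Y) ω) s
      D-commutes {Y} YX ω s = sym (D-natural Y Y (λ i f j → sym (YX i f j)) ω s)

      E-commutes : ∀ {Y : J ⊸ J} → (∀ i → Commute Y (X i)) → ∀ (ω : Form) s →
                   app (Λ m Y) (app E ω) s ≈ app E (app (Λ m Y) ω) s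
      E-commutes {Y} YX ω s = trans (D-commutes {Y} YX (app (D X) ω) s) (koszul-cong X (D-commutes {Y} YX ω) s)

      part : Bool → Bool → Form⁺ → Form
      part x y ω = slice y (slice x ω)

      square : ∀ {Y : J ⊸ J} → (∀ i → Commute Y (X i)) → ∀ (ω η : Form) s →
               app (Λ m Y) (app (D X) ω) s - app (D X) (λ t → app (Λ m Y) ω t - app (D X) η t) s ≈ app E η s
      square {Y} YX ω η s = trans (+-congˡ (-‿cong (app-sub (D X) _ _ s))) (difference-of-difference (D-commutes {Y} YX ω s))

      part-ff : ∀ ω s → part false false (app (D² X⁺) ω) s ≈ app E (part false false ω) s
      part-ff ω s = refl

      part-ft : ∀ ω s → part false true (app (D² X⁺) ω) s ≈ app E (part false true ω) s
      part-ft ω s = square {Q} QX (part false false ω) (part false true ω) s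

      part-tf : ∀ ω s → part true false (app (D² X⁺) ω) s ≈ app E (part true false ω) s
      part-tf ω s = square {P} PX (part false false ω) (part true false ω) s

      -- P and Q commute with D, so the contributions of `β` and `γ` cancel; `α` enters through PQ -
      -- QP, which is Z.
      part-tt : ∀ ω s → part true true (app (D² X⁺) ω) s ≈ app E (part true true ω) s + app (Λ m Z) (part false false ω) s
      part-tt ω s@(S , j) = begin
        app P (λ j → QA (S , j) - DC (S , j)) j - (app Q (λ j → PA (S , j) - DB (S , j)) j - app (D X) (λ t → PC t - (QB t - DD t)) s)
          ≈⟨ sub-cong (app-sub P _ _ j) (sub-cong (app-sub Q _ _ j)
               (trans (app-sub (D X) _ _ s) (+-congˡ (-‿cong (app-sub (D X) _ _ s))))) ⟩
        (app (Λ m P) QA s - app (Λ m P) DC s) - ((app (Λ m Q) PA s - app (Λ m Q) DB s) - (app (D X) PC s - (app (D X) QB s - app E δ′ s)))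
          ≈⟨ sub-cong (+-congˡ (-‿cong (D-commutes {P} PX γ s)))
               (+-congʳ (+-congˡ (-‿cong (D-commutes {Q} QX β s)))) ⟩
        (app (Λ m P) QA s - app (D X) PC s) - ((app (Λ m Q) PA s - app (D X) QB s) - (app (D X) PC s - (app (D X) QB s - app E δ′ s)))
          ≈⟨ solve 5 (λ pq dpc qp dqb e → (pq :- dpc) :- ((qp :- dqb) :- (dpc :- (dqb :- e))) := e :+ (pq :- qp)) refl
               (app (Λ m P) QA s) (app (D X) PC s) (app (Λ m Q) PA s) (app (D X) QB s) (app E δ′ s) ⟩
        app E δ′ s + (app (Λ m P) QA s - app (Λ m Q) PA s)
          ≈⟨ +-congˡ (PQ _ j) ⟩
        app E δ′ s + app (Λ m Z) α s  ∎
        where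
        α β γ δ′ QA PA DB DC DD PC QB : Form
        α = part false false ω
        β = part true false ω
        γ = part false true ω
        δ′ = part true true ω
        QA = app (Λ m Q) α
        PA = app (Λ m P) α
        DB = app (D X) β
        DC = app (D X) γ
        DD = app (D X) δ′
        PC = app (Λ m P) γ
        QB = app (Λ m Q) β

      iterate-part : ∀ x y → (∀ ω s → part x y (app (D² X⁺) ω) s ≈ app E (part x y ω) s) →
                     ∀ j ω s → part x y (app (iterate (D² X⁺) j) ω) s ≈ app (iterate E j) (part x y ω) s
      iterate-part x y h zero    ω s = refl
      iterate-part x y h (suc j) ω s = trans (h (app (iterate (D² X⁺) j) ω) s) (app-cong E (iterate-part x y h j ω) s)

      E-+-scaled : ∀ (η θ : Form) a s → app E (λ t → η t + a * θ t) s ≈ app E η s + a * app E θ s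
      E-+-scaled η θ a s = trans (app-+ E η (λ t → a * θ t) s) (+-congˡ (app-* E a θ s))

      iterate-tt : ∀ j ω s → part true true (app (iterate (D² X⁺) (suc j)) ω) s ≈
                   app (iterate E (suc j)) (part true true ω) s + (suc j · 1#) * app (Λ m Z) (app (iterate E j) (part false false ω)) s
      iterate-tt zero    ω s = trans (part-tt ω s) (+-congˡ (solve 1 (λ x → x := (con (1 , 0) :+ con (0 , 0)) :* x) refl _))
      iterate-tt (suc j) ω s = begin
        part true true (app (D² X⁺) ω′) s
          ≈⟨ part-tt ω′ s ⟩
        app E (part true true ω′) s + app (Λ m Z) (part false false ω′) s
          ≈⟨ +-cong (app-cong E (iterate-tt j ω) s) (app-cong (Λ m Z) (iterate-part false false part-ff (suc j) ω) s) ⟩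
        app E (λ t → app (iterate E (suc j)) (part true true ω) t + (suc j · 1#) * app (Λ m Z) η t) s + app (Λ m Z) (app E η) s
          ≈⟨ +-congʳ (E-+-scaled (app (iterate E (suc j)) (part true true ω)) (app (Λ m Z) η) (suc j · 1#) s) ⟩
        (e + (suc j · 1#) * app E (app (Λ m Z) η) s) + app (Λ m Z) (app E η) s
          ≈⟨ +-congʳ (+-congˡ (*-congˡ (E-commutes {Z} ZX η s))) ⟨
        (e + (suc j · 1#) * z) + z
          ≈⟨ solve 3 (λ e n z → (e :+ n :* z) :+ z := e :+ (con (1 , 0) :+ n) :* z) refl e (suc j · 1#) z ⟩
        e + (suc (suc j) · 1#) * z  ∎
        where
        ω′ : Form⁺
        ω′ = app (iterate (D² X⁺) (suc j)) ω
        η : Form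
        η = app (iterate E j) (part false false ω)
        e z : Carrier
        e = app (iterate E (suc (suc j))) (part true true ω) s
        z = app (Λ m Z) (app E η) s

    -- Split ω = a + e∧b + f∧c + e∧f∧d along the new pair (e, f): D² acts on a, b, c as before
    -- and (D²)^j adds j Z (D²)^(j-1) a to the component of e∧f.
    lefschetz-step : Lefschetz (suc q) X⁺
    lefschetz-step k       zero    ω supp k+j≤ E≈0 s = E≈0 s
    lefschetz-step zero    (suc j) ω supp k+j≤ E≈0 (S , t) = supp S t (λ ())
    lefschetz-step (suc k) (suc j) ω supp k+j≤ E≈0 = λ
      { (false ∷ false ∷ S , t) → α≈0 (S , t)
      ; (false ∷ true ∷ S , t)  → side false true part-ft (λ S t ¬P → supp (false ∷ true ∷ S) t (¬P ∘ ℕ.s<s⁻¹)) (S , t)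
      ; (true ∷ false ∷ S , t)  → side true false part-tf (λ S t ¬P → supp (true ∷ false ∷ S) t (¬P ∘ ℕ.s<s⁻¹)) (S , t)
      ; (true ∷ true ∷ S , t)   → δ≈0 (S , t)
      }
      where
      α δ′ : Form
      α = part false false ω
      δ′ = part true true ω

      k+j≤′ : k ℕ.+ suc j ≤ suc q
      k+j≤′ = ℕ.s≤s⁻¹ k+j≤

      side : ∀ x y → (∀ ω s → part x y (app (D² X⁺) ω) s ≈ app E (part x y ω) s) →
             Supported (_< k) (part x y ω) → ∀ s → part x y ω s ≈ 0#
      side x y h supp = L k (suc j) (part x y ω) supp k+j≤′
        (λ (S , t) → trans (sym (iterate-part x y h (suc j) ω (S , t))) (E≈0 (x ∷ y ∷ S , t)))

      Eα≈0 : ∀ s → app (iterate E (suc j)) α s ≈ 0#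
      Eα≈0 (S , t) = trans (sym (iterate-part false false part-ff (suc j) ω (S , t))) (E≈0 (false ∷ false ∷ S , t))

      n : Carrier
      n = suc j · 1#

      top : ∀ s → app (iterate E (suc j)) δ′ s + n * app (Λ m Z) (app (iterate E j) α) s ≈ 0#
      top (S , t) = trans (sym (iterate-tt j ω (S , t))) (E≈0 (true ∷ true ∷ S , t))

      -- The component of e∧f has degree lower by two, so the induction hypothesis tolerates one
      -- more application of D² to it. That application annihilates the unwanted term in `α`.
      Eδ≈0 : ∀ s → app (iterate E (suc (suc j))) δ′ s ≈ 0#
      Eδ≈0 s = begin
        e                                                           ≈⟨ solve 3 (λ e n x → e := (e :+ n :* x) :- n :* x) refl e n x ⟩
        (e + n * x) - n * x                                         ≈⟨ sub-cong (trans (sym (E-+-scaled _ _ n s)) (app-0 E top s))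
                                                                         (*-congˡ (trans (sym (E-commutes {Z} ZX _ s)) (app-0 (Λ m Z) Eα≈0 s))) ⟩
        0# - n * 0#                                                 ≈⟨ solve 1 (λ n → con (0 , 0) :- n :* con (0 , 0) := con (0 , 0)) refl n ⟩
        0#                                                          ∎
        where
        e x : Carrier
        e = app (iterate E (suc (suc j))) δ′ s
        x = app E (app (Λ m Z) (app (iterate E j) α)) s

      δ-below : ∀ k → k ℕ.+ suc j ≤ suc q → Supported (λ n → suc (suc n) < suc k) δ′ → ∀ s → δ′ s ≈ 0#
      δ-below zero    _    s (S , t) = s S t (λ { (s≤s ()) })
      δ-below (suc k) k+j≤ s = L k (suc (suc j)) δ′ (λ S t ¬P → s S t (¬P ∘ ℕ.s<s⁻¹ ∘ ℕ.s<s⁻¹))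
        (ℕₚ.≤-trans (ℕₚ.≤-reflexive (ℕₚ.+-suc k (suc j))) k+j≤) Eδ≈0

      δ≈0 : ∀ s → δ′ s ≈ 0#
      δ≈0 = δ-below k k+j≤′ (λ S t → supp (true ∷ true ∷ S) t)

      -- Once `δ′` is zero, `top` reduces to (j + 1) Z (D²)^j α = 0, and j + 1 is invertible in
      -- characteristic zero.
      ZEα≈0 : ∀ s → app (Λ m Z) (app (iterate E j) α) s ≈ 0#
      ZEα≈0 s = ≈0-stable (do
        (w , wn≈1) ← invertible (characteristic-zero j)
        return (begin
          z              ≈⟨ *-identityˡ z ⟨
          1# * z         ≈⟨ *-congʳ wn≈1 ⟨
          w * n * z      ≈⟨ *-assoc w n z ⟩
          w * (n * z)    ≈⟨ *-congˡ (trans (sym (trans (+-congʳ (app-0 (iterate E (suc j)) δ≈0 s)) (+-identityˡ _))) (top s)) ⟩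
          w * 0#         ≈⟨ zeroʳ w ⟩
          0#             ∎))
        where
        z : Carrier
        z = app (Λ m Z) (app (iterate E j) α) s

      -- `Eα≈0` has one power too many for the induction hypothesis in degrees below `suc k`.
      -- Injectivity of Z supplies the vanishing of the j-th power, which is exactly what is
      -- allowed.
      α≈0 : ∀ s → α s ≈ 0#
      α≈0 = L (suc k) j α (λ S t → supp (false ∷ false ∷ S) t)
        (ℕₚ.≤-trans (ℕₚ.≤-reflexive (≡.sym (ℕₚ.+-suc k j))) k+j≤′)
        (λ (S , t) → Z-trivial (λ t → app (iterate E j) α (S , t)) (λ t → ZEα≈0 (S , t)) t)

  -- Operators with invertible commutators.

  private
    next : ∀ {n} → Fin (suc n) → Fin (suc n)
    next x with view x
    ... | ‵fromℕ     = zero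
    ... | ‵inject₁ y = suc y

    prev : ∀ {n} → Fin (suc n) → Fin (suc n)
    prev zero    = fromℕ _
    prev (suc x) = inject₁ x

    next-prev : ∀ {n} (x : Fin (suc n)) → next (prev x) ≡ x
    next-prev {n} zero rewrite view-fromℕ n = ≡.refl
    next-prev (suc x) rewrite view-inject₁ x = ≡.refl

    prev-next : ∀ {n} (x : Fin (suc n)) → prev (next x) ≡ x
    prev-next x with view x
    ... | ‵fromℕ     = ≡.refl
    ... | ‵inject₁ y = ≡.refl

    -- Two points are enough for the cyclic shift to move every point, hence the digits with at
    -- least two values.
    toℕ-prev : ∀ {n} (x : Fin (suc (suc n))) → ¬ toℕ (prev x) ≡ toℕ x
    toℕ-prev (suc x) eq = ℕₚ.1+n≢n (≡.sym (≡.trans (≡.sym (toℕ-inject₁ x)) eq))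

    ·1-injective : ∀ m n → m · 1# ≈ n · 1# → m ≡ n
    ·1-injective zero    zero    eq = ≡.refl
    ·1-injective zero    (suc n) eq = contradiction (sym eq) (characteristic-zero n)
    ·1-injective (suc m) zero    eq = contradiction eq (characteristic-zero m)
    ·1-injective (suc m) (suc n) eq = ≡.cong suc (·1-injective m n (∙-cancelˡ 1# _ _ eq))

  module _ {J B : Set} where

    onFirst : J ⊸ J → J × B ⊸ J × B
    onFirst X = record
      { app      = λ f (j , b) → app X (λ j → f (j , b)) j
      ; app-cong = λ f≈ (j , b) → app-cong X (λ j → f≈ (j , b)) j
      ; app-+    = λ f g (j , b) → app-+ X _ _ j
      ; app-*    = λ a f (j , b) → app-* X a _ j
      }

    at : B → J × B ⊸ J
    at b = reindex (_, b)

  iterate-natural : ∀ {m} {J L : Set} {X : Fin m → J ⊸ J} {Y : Fin m → L ⊸ L} (f : J ⊸ L) →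
                    (∀ i x l → app (Y i) (app f x) l ≈ app f (app (X i) x) l) →
                    ∀ j ω s → app (iterate (D² Y) j) (app (Λ m f) ω) s ≈ app (Λ m f) (app (iterate (D² X) j) ω) s
  iterate-natural f h zero    ω (S , l) = refl
  iterate-natural {m} {X = X} {Y} f h (suc j) ω s = begin
    app (D Y) (app (D Y) (app (iterate (D² Y) j) (app (Λ m f) ω))) s
      ≈⟨ koszul-cong Y (koszul-cong Y (iterate-natural {X = X} {Y} f h j ω)) s ⟩
    app (D Y) (app (D Y) (app (Λ m f) ω′)) s
      ≈⟨ koszul-cong Y (D-natural {X = X} {Y} f f h ω′) s ⟩
    app (D Y) (app (Λ m f) (app (D X) ω′)) s
      ≈⟨ D-natural {X = X} {Y} f f h (app (D X) ω′) s ⟩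
    app (Λ m f) (app (D X) (app (D X) ω′)) s  ∎
    where
    ω′ = app (iterate (D² X) j) ω

  -- The operators preserve each slice at a fixed `b`, so injectivity is checked slice by slice.
  lefschetz-onFirst : ∀ {J B : Set} q (X : Fin (double q) → J ⊸ J) → Lefschetz q X →
                      Lefschetz {J × B} q (λ i → onFirst (X i))
  lefschetz-onFirst {J} {B} q X L k j ω supp k+j≤ E≈0 (S , t , b) = L k j (app (Λ (double q) (at b)) ω)
    (λ S t → supp S (t , b)) k+j≤
    (λ { s@(S , t) → trans
      (iterate-natural {X = λ i → onFirst {J} {B} (X i)} {Y = X} (at b) (λ _ _ _ → refl) j ω s)
      (E≈0 (S , t , b)) })
    (S , t)

  Digits : List ℕ → Set
  Digits []       = Unit.⊤
  Digits (d ∷ ds) = Digits ds × Fin (suc (suc d))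

  -- If σ has no fixed point then P f = f ∘ σ and Q f = q · (f ∘ σ⁻¹) have the commutator
  -- multiplication by q ∘ σ - q, which is invertible as soon as q is injective.
  module _ {J : Set} {d : ℕ} where

    private
      B : Set
      B = Fin (suc (suc d))
      z : B → Carrier
      z b = toℕ (prev b) · 1# - toℕ b · 1#

    shift : J × B ⊸ J × B
    shift = reindex (λ (j , b) → j , prev b)

    weightedShift : J × B ⊸ J × B
    weightedShift = record
      { app      = λ f (j , b) → (toℕ b · 1#) * f (j , next b)
      ; app-cong = λ f≈ (j , b) → *-congˡ (f≈ (j , next b))
      ; app-+    = λ f g (j , b) → distribˡ _ _ _
      ; app-*    = λ a f (j , b) → solve 3 (λ n a x → n :* (a :* x) := a :* (n :* x)) refl (toℕ b · 1#) a (f (j , next b))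
      }

    commutator : J × B ⊸ J × B
    commutator = record
      { app      = λ f (j , b) → z b * f (j , b)
      ; app-cong = λ f≈ (j , b) → *-congˡ (f≈ (j , b))
      ; app-+    = λ f g (j , b) → distribˡ _ _ _
      ; app-*    = λ a f (j , b) → solve 3 (λ n a x → n :* (a :* x) := a :* (n :* x)) refl (z b) a (f (j , b))
      }

    commutator-spec : ∀ f s → app shift (app weightedShift f) s - app weightedShift (app shift f) s ≈ app commutator f s
    commutator-spec f (j , b) = begin
      (toℕ (prev b) · 1#) * f (j , next (prev b)) - (toℕ b · 1#) * f (j , prev (next b))
        ≈⟨ sub-cong (*-congˡ (reflexive (≡.cong (λ b → f (j , b)) (next-prev b))))
             (*-congˡ (reflexive (≡.cong (λ b → f (j , b)) (prev-next b)))) ⟩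
      (toℕ (prev b) · 1#) * f (j , b) - (toℕ b · 1#) * f (j , b)
        ≈⟨ solve 3 (λ m n x → m :* x :- n :* x := (m :- n) :* x) refl (toℕ (prev b) · 1#) (toℕ b · 1#) (f (j , b)) ⟩
      z b * f (j , b)  ∎

    commutator-trivial : TrivialKernel commutator
    commutator-trivial f zf≈0 (j , b) = ≈0-stable (do
      (w , wz≈1) ← invertible (λ z≈0 → toℕ-prev b (·1-injective _ _ (trans
        (solve 2 (λ x y → x := (x :- y) :+ y) refl _ _) (trans (+-congʳ z≈0) (+-identityˡ _)))))
      return (begin
        f (j , b)                 ≈⟨ *-identityˡ _ ⟨
        1# * f (j , b)            ≈⟨ *-congʳ wz≈1 ⟨
        w * z b * f (j , b)       ≈⟨ *-assoc _ _ _ ⟩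
        w * (z b * f (j , b))     ≈⟨ *-congˡ (zf≈0 (j , b)) ⟩
        w * 0#                    ≈⟨ zeroʳ w ⟩
        0#                        ∎))

  operators : ∀ ds → Fin (double (length ds)) → Digits ds ⊸ Digits ds
  operators []       = λ ()
  operators (d ∷ ds) = shift ◂ weightedShift ◂ λ i → onFirst (operators ds i)

  -- Each digit adds one pair of operators. Without digits k + j ≤ 1, so either ω is supported in no
  -- degree or j = 0.
  lefschetz-operators : ∀ ds → Lefschetz (length ds) (operators ds)
  lefschetz-operators []       zero          j    ω supp k+j≤       E≈0 (S , t) = supp S t (λ ())
  lefschetz-operators []       (suc zero)    zero ω supp k+j≤       E≈0 s       = E≈0 s
  lefschetz-operators []       (suc zero)    (suc j) ω supp (s≤s ()) E≈0 s
  lefschetz-operators []       (suc (suc k)) j    ω supp (s≤s ())   E≈0 s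
  lefschetz-operators (d ∷ ds) = lefschetz-step {q = length ds} (λ i → onFirst (operators ds i)) {shift} {weightedShift} {commutator}
    (λ i f s → refl)
    (λ i f (j , b) → sym (app-* (operators ds i) _ _ j))
    (λ i f (j , b) → sym (app-* (operators ds i) _ _ j))
    commutator-spec commutator-trivial
    (lefschetz-onFirst (length ds) (operators ds) (lefschetz-operators ds))

  digits↔ : ∀ ds → Digits ds ↔ Fin (size ds)
  digits↔ []       = mk↔ₛ′ (λ _ → zero) (λ _ → Unit.tt) (λ { zero → ≡.refl }) (λ _ → ≡.refl)
  digits↔ (d ∷ ds) = ↔-trans (digits↔ ds ×-↔ ↔-refl) (↔-sym *↔×)

  -- When f is the partial inverse of an injection, this is extension by zero.
  pullback : ∀ {I J : Set} → (J → Maybe I) → I ⊸ J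
  pullback f = record
    { app      = λ x j → maybe′ x 0# (f j)
    ; app-cong = λ x≈y j → cong-maybe x≈y (f j)
    ; app-+    = λ x y j → +-maybe x y (f j)
    ; app-*    = λ a x j → *-maybe a x (f j)
    }
    where
    cong-maybe : ∀ {I : Set} {x y : I → Carrier} → (∀ i → x i ≈ y i) → ∀ mi → maybe′ x 0# mi ≈ maybe′ y 0# mi
    cong-maybe x≈y (just i) = x≈y i
    cong-maybe x≈y nothing  = refl
    +-maybe : ∀ {I : Set} (x y : I → Carrier) mi → maybe′ (λ i → x i + y i) 0# mi ≈ maybe′ x 0# mi + maybe′ y 0# mi
    +-maybe x y (just i) = refl
    +-maybe x y nothing  = sym (+-identityˡ 0#)
    *-maybe : ∀ {I : Set} a (x : I → Carrier) mi → maybe′ (λ i → a * x i) 0# mi ≈ a * maybe′ x 0# mi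
    *-maybe a x (just i) = refl
    *-maybe a x nothing  = sym (zeroʳ a)

  app-pullback : ∀ {I J : Set} (f : J → Maybe I) {i j} → f j ≡ just i → ∀ x → app (pullback f) x j ≈ x i
  app-pullback f eq x = reflexive (≡.cong (maybe′ x 0#) eq)

  module _ {ds : List ℕ} {n : ℕ} (embed : Digits ds → Fin n) (project : Fin n → Maybe (Digits ds))
           (project-embed : ∀ t → project (embed t) ≡ just t) where

    private
      p m : ℕ
      p = length ds
      m = double p

      classify : Vec Bool m × Fin n → Maybe (Combination⁻ m p × Digits ds)
      classify (S , i) = Maybe.zip (combination⁻ p S) (project i)

    -- The digit operators continued by zero to the coordinates of K^n that are not digits.
    extended : Fin m → Fin n ⊸ Fin n
    extended i = pullback project ⊙ operators ds i ⊙ reindex embed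

    include : Combination⁻ m p × Digits ds ⊸ Vec Bool m × Fin n
    include = pullback classify

    private
      restricted : (Combination⁻ m p × Digits ds → Carrier) → Vec Bool m × Digits ds → Carrier
      restricted x = app (Λ m (reindex embed)) (app include x)

      restricted-supported : ∀ x → Supported (_< p) (restricted x)
      restricted-supported x S t ∣S∣≮p with combination⁻ p S in eq
      ... | just T  = contradiction (ℕₚ.≤-reflexive (combination⁻-size p S eq)) ∣S∣≮p
      ... | nothing = refl

    extended-square-trivial : TrivialKernel (D² extended ⊙ include)
    extended-square-trivial x D²≈0 (T , t) = begin
      x (T , t)                           ≈⟨ app-pullback classify {j = toSubset⁻ p T , embed t} (≡.cong₂ Maybe.zip (combination⁻-toSubset p T) (project-embed t)) x ⟨
      -- Degrees below p and a single application of D²: the extreme case k + j = p + 1 of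
      -- `Lefschetz`.
      restricted x (toSubset⁻ p T , t)    ≈⟨ lefschetz-operators ds p 1 (restricted x) (restricted-supported x)
                                               (ℕₚ.≤-reflexive (ℕₚ.+-comm p 1)) restricted≈0 (toSubset⁻ p T , t) ⟩
      0#                                  ∎
      where
      restricted≈0 : ∀ s → app (D² (operators ds)) (restricted x) s ≈ 0#
      restricted≈0 s@(S , t) = trans
        (iterate-natural {X = extended} {Y = operators ds} (reindex embed)
          (λ i f t → sym (app-pullback project (project-embed t) (app (operators ds i) (f ∘ embed)))) 1 (app include x) s)
        (D²≈0 (S , embed t))

  -- Counting.

  -- Used with scalars in the middle: the Koszul map of matrices which are multiples of a single
  -- rank one matrix factors through exterior multiplication by the vector of multiples.
  D-factor : ∀ {m} {J A B L : Set} (X : Fin m → A ⊸ B) (f : J ⊸ A) (g : B ⊸ L) →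
             ∀ ω s → app (D (λ i → g ⊙ X i ⊙ f)) ω s ≈ app (Λ m g) (app (D X) (app (Λ m f) ω)) s
  D-factor {zero}  X f g ω (S , l)         = sym (app-0 g (λ _ → refl) l)
  D-factor {suc m} X f g ω (false ∷ S , l) = D-factor (X ∘ suc) f g (slice false ω) (S , l)
  D-factor {suc m} X f g ω (true ∷ S , l)  = trans
    (+-congˡ (-‿cong (D-factor (X ∘ suc) f g (slice true ω) (S , l))))
    (sym (app-sub g _ _ l))

  outer : ∀ {L : Set} → (L → Carrier) → Unit.⊤ ⊸ L
  outer w = record
    { app      = λ x l → x _ * w l
    ; app-cong = λ x≈y l → *-congʳ (x≈y _)
    ; app-+    = λ x y l → distribʳ (w l) (x _) (y _)
    ; app-*    = λ a x l → *-assoc a (x _) (w l)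
    }

  tuple : ∀ {I J A : Set} → (A → I ⊸ J) → I ⊸ A × J
  tuple f = record
    { app      = λ x (a , j) → app (f a) x j
    ; app-cong = λ x≈y (a , j) → app-cong (f a) x≈y j
    ; app-+    = λ x y (a , j) → app-+ (f a) x y j
    ; app-*    = λ c x (a , j) → app-* (f a) c x j
    }

  TrivialKernel-reindex : ∀ {I J R : Set} (I↔J : I ↔ J) {f : I ⊸ R} → TrivialKernel f → TrivialKernel (f ⊙ reindex (Inverse.to I↔J))
  TrivialKernel-reindex I↔J ker x fx≈0 j =
    trans (reflexive (≡.cong x (≡.sym (strictlyInverseˡ j)))) (ker (x ∘ to) fx≈0 (from j))
    where open Inverse I↔J

  TrivialKernel-unindex : ∀ {I J R : Set} (I↔J : I ↔ J) {f : I ⊸ R} → TrivialKernel (f ⊙ reindex (Inverse.to I↔J)) → TrivialKernel f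
  TrivialKernel-unindex I↔J {f} ker x fx≈0 i =
    trans (reflexive (≡.cong x (≡.sym (strictlyInverseʳ i))))
      (ker (x ∘ from) (λ ρ → trans (app-cong f (λ i → reflexive (≡.cong x (strictlyInverseʳ i))) ρ) (fx≈0 ρ)) (to i))
    where open Inverse I↔J

  Square : ℕ → Set
  Square n = Fin n × Fin n

  actOnVectors : ∀ {n} → (Square n → Carrier) → Fin n ⊸ Fin n
  actOnVectors X = matrix (λ i k → X (i , k))

  actOnMatrices : ∀ {n} → (Square n → Carrier) → Square n ⊸ Square n
  actOnMatrices X = record
    { app      = λ Z (i , k) → app (actOnVectors X) (λ j → Z (j , k)) i
    ; app-cong = λ Z≈ (i , k) → app-cong (actOnVectors X) (λ j → Z≈ (j , k)) i
    ; app-+    = λ Y Z (i , k) → app-+ (actOnVectors X) (λ j → Y (j , k)) (λ j → Z (j , k)) i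
    ; app-*    = λ a Z (i , k) → app-* (actOnVectors X) a (λ j → Z (j , k)) i
    }

  identityMatrix : ∀ {n} → Square n → Carrier
  identityMatrix (i , j) = δ i j

  -- A restriction to S annihilates the forms ι j with j outside S, so that the corresponding terms
  -- of the rank decomposition disappear.
  module Restriction {n r : ℕ} {U : Square n ⊸ Fin r} (basis : DualBasis (n ℕ.* n) U) where

    open DualBasis basis

    restrict : (Square n → Carrier) → Subset (n ℕ.* n) → Square n → Carrier
    restrict X S s = sum (λ k → (if lookup S k then app U X (ι k) else 0#) * b k s)

    restrict-⊤ : ∀ X s → restrict X ⊤ s ≈ X s
    restrict-⊤ X s = trans
      (sum-cong-≋ (λ k → *-congʳ (reflexive (≡.cong (if_then app U X (ι k) else 0#) (lookup-replicate k true)))))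
      (sym (span X s))

    restrict-killed : ∀ X S j → lookup S j ≡ false → app U (restrict X S) (ι j) ≈ 0#
    restrict-killed X S j Sj≡false = begin
      app U (restrict X S) (ι j)                            ≈⟨ app-sum U coefficient b (ι j) ⟩
      sum (λ k → coefficient k * app U (b k) (ι j))         ≈⟨ sum-cong-≋ (λ k → *-congˡ (dual j k)) ⟩
      sum (λ k → coefficient k * δ j k)                     ≈⟨ sum-δ j coefficient ⟩
      coefficient j                                         ≈⟨ reflexive (≡.cong (if_then app U X (ι j) else 0#) Sj≡false) ⟩
      0#                                                    ∎
      where
      coefficient : Fin (n ℕ.* n) → Carrier
      coefficient k = if lookup S k then app U X (ι k) else 0#

    restrict-Deg : ∀ X s → Deg (n ℕ.* n) 1 (λ S → restrict X S s)
    restrict-Deg X s = Deg-sum (λ k → Deg-cong (λ S → *-comm _ _) (Deg-scale (b k s) (Deg-variable k (app U X (ι k)))))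

    act-restrict-Deg : ∀ {d} X {f : Subset (n ℕ.* n) → Fin n → Carrier} → (∀ i → Deg (n ℕ.* n) d (λ S → f S i)) →
                       ∀ i → Deg (n ℕ.* n) (d ℕ.+ 1) (λ S → app (actOnVectors (restrict X S)) (f S) i)
    act-restrict-Deg X df i = Deg-sum (λ k → Deg-* (df k) (restrict-Deg X (i , k)))

  module Count {ds : List ℕ} {n r : ℕ} (embed : Digits ds → Fin n) (project : Fin n → Maybe (Digits ds))
    (project-embed : ∀ t → project (embed t) ≡ just t)
    (U : Square n ⊸ Fin r) (V : Fin r → Square n ⊸ Unit.⊤) (W : Fin r → Square n → Carrier)
    (decomposition : ∀ X Y i k → sum (λ j → X (i , j) * Y (j , k)) ≈ sum (λ l → (app U X l * app (V l) Y _) * W l (i , k)))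
    where

    p m M N : ℕ
    p = length ds
    m = double p
    M = binomial m (p ⊖ 1) ℕ.* size ds
    N = n ℕ.* n

    Lower : Set
    Lower = Combination⁻ m p × Digits ds

    lower↔ : Lower ↔ Fin M
    lower↔ = ↔-trans (combination⁻↔ m p ×-↔ digits↔ ds) (↔-sym *↔×)

    includeLower : Lower ⊸ Vec Bool m × Fin n
    includeLower = include {ds} embed project project-embed

    P : Fin m → Fin n ⊸ Fin n
    P = extended {ds} embed project project-embed

    -- Take Y to be the identity matrix: the decomposition then recovers X from the values of the
    -- forms.
    U-trivial : TrivialKernel U
    U-trivial X UX≈0 (i , k) = begin
      X (i , k)                                                   ≈⟨ sum-δ k (λ j → X (i , j)) ⟨
      sum (λ j → X (i , j) * δ k j)                               ≈⟨ decomposition X (λ (j , k) → δ k j) i k ⟩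
      sum (λ l → (app U X l * app (V l) (λ (j , k) → δ k j) _) * W l (i , k))
        ≈⟨ sum-zero {r} _ (λ l → trans (*-congʳ (trans (*-congʳ (UX≈0 l)) (zeroˡ _))) (zeroˡ _)) ⟩
      0#                                                          ∎

    module WithBasis (basis : DualBasis N U) where
      open DualBasis basis
      open Restriction basis

      -- An n × n matrix with entries of degree 1 in S, equal to the identity at ⊤; hence the size n
      -- * 1.
      first : ¬ ¬ ∃ λ S → ∣ S ∣ ≤ n ℕ.* 1 × TrivialKernel (actOnVectors (restrict identityMatrix S))
      first = small-support (λ S → actOnVectors (restrict identityMatrix S))
        (λ k → act-restrict-Deg {0} identityMatrix (λ i → Deg-const (δ k i)))
        (λ x Xx≈0 i → trans (sym (trans (sum-cong-≋ (λ k → *-congˡ (restrict-⊤ identityMatrix (i , k)))) (sum-δ i x))) (Xx≈0 i))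

      module WithFirst (S₀ : Subset N) (basis₀ : DualBasis n (actOnVectors (restrict identityMatrix S₀))) where

        X₀ : Square n → Carrier
        X₀ = restrict identityMatrix S₀

        L₀ : Fin n ⊸ Fin n
        L₀ = leftInverse basis₀

        L₀X₀≈id : ∀ f i → app (L₀ ⊙ actOnVectors X₀) f i ≈ f i
        L₀X₀≈id f i = sym (DualBasis.span basis₀ f i)

        -- The product X₀ Pⱼ is restricted, rather than Pⱼ, so that L₀ recovers exactly Pⱼ at S = ⊤.
        X₀P : Fin m → Square n → Carrier
        X₀P j (i , k) = app (actOnVectors X₀ ⊙ P j) (δ k) i

        family : Subset N → Fin m → Fin n ⊸ Fin n
        family S j = L₀ ⊙ actOnVectors (restrict (X₀P j) S)

        family-⊤ : ∀ j f i → app (family ⊤ j) f i ≈ app (P j) f i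
        family-⊤ j f i = trans
          (app-cong L₀ (λ i → trans (sum-cong-≋ (λ k → *-congˡ (restrict-⊤ (X₀P j) (i , k))))
            (sym (app-expand (actOnVectors X₀ ⊙ P j) f i))) i)
          (L₀X₀≈id (app (P j) f) i)

        D-family-Deg : ∀ {d} {ω : Subset N → Vec Bool m × Fin n → Carrier} → (∀ s → Deg N d (λ S → ω S s)) →
                       ∀ s → Deg N (d ℕ.+ 1) (λ S → app (D (family S)) (ω S) s)
        D-family-Deg = Deg-koszul family (λ j df → Deg-linear L₀ (act-restrict-Deg (X₀P j) df))

        -- At ⊤ the family is `P`, to which hard Lefschetz applies. Each of the two Koszul maps is
        -- linear in S and there are M coordinates, hence the size M * 2.
        second : ¬ ¬ ∃ λ S → ∣ S ∣ ≤ M ℕ.* 2 × TrivialKernel (D² (family S) ⊙ includeLower)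
        second = do
          (S , ∣S∣≤ , ker) ← small-support (λ S → D² (family S) ⊙ includeLower ⊙ reindex (Inverse.to lower↔))
            (λ k → D-family-Deg {1} (D-family-Deg {0} (λ s → Deg-const (app includeLower (δ k ∘ Inverse.to lower↔) s))))
            (TrivialKernel-reindex lower↔ {D² (family ⊤) ⊙ includeLower} (λ x Dx≈0 → extended-square-trivial {ds} embed project project-embed x
              (λ s → trans (sym (trans (D-congˡ {X = family ⊤} {Y = P} family-⊤ _ s)
                (koszul-cong P (D-congˡ {X = family ⊤} {Y = P} family-⊤ (app includeLower x)) s))) (Dx≈0 s))))
          return (S , ∣S∣≤ , TrivialKernel-unindex lower↔ {D² (family S) ⊙ includeLower} ker)

        module WithSecond (S₁ : Subset N) (kernel : TrivialKernel (D² (family S₁) ⊙ includeLower)) where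

          Y : Fin (suc m) → Square n → Carrier
          Y = X₀ ◂ λ j → restrict (X₀P j) S₁

          -- Term l contributes to the Koszul map of `Y` the exterior multiplication by this vector,
          -- tensored with a map of rank at most one.
          a : Fin r → Fin (suc m) → Carrier
          a l j = app U (Y j) l

          killed : ∀ j → lookup (S₀ ∪ S₁) j ≡ false → ∀ i → a (ι j) i ≈ 0#
          killed j ∉S zero    = restrict-killed identityMatrix S₀ j (proj₁ (lookup-∪-false S₀ S₁ j ∉S))
          killed j ∉S (suc i) = restrict-killed (X₀P i) S₁ j (proj₂ (lookup-∪-false S₀ S₁ j ∉S))

          -- The unknowns are the coordinates of Ψ in Λ^p(K^(m+1)) ⊗ Mat whose e₀-part has values in
          -- K^Digits, the subspace where the square of the Koszul map is known to be injective.
          Unknown : Set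
          Unknown = (Lower ⊎ Combination m p × Fin n) × Fin n

          unknowns : ℕ
          unknowns = (M ℕ.+ (m C p) ℕ.* n) ℕ.* n

          unknown↔ : Unknown ↔ Fin unknowns
          unknown↔ = ↔-trans (↔-trans (lower↔ ⊎-↔ ↔-trans (combination↔ m p ×-↔ ↔-refl) (↔-sym *↔×)) (↔-sym +↔⊎) ×-↔ ↔-refl)
            (↔-sym *↔×)

          lowerPart : Fin n → (Unknown → Carrier) → Lower → Carrier
          lowerPart k x t = x (inj₁ t , k)

          upperPart : Fin n → (Unknown → Carrier) → Vec Bool m × Fin n → Carrier
          upperPart k x (S , i) = app (pullback {Combination m p} (combination p)) (λ T → x (inj₂ (T , i) , k)) S

          Ψ : Unknown ⊸ Vec Bool (suc m) × Square n
          Ψ = record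
            { app      = λ { x (true ∷ S , i , k) → app includeLower (lowerPart k x) (S , i) ; x (false ∷ S , i , k) → upperPart k x (S , i) }
            ; app-cong = λ { x≈y (true ∷ S , i , k) → app-cong includeLower (λ t → x≈y (inj₁ t , k)) (S , i)
                           ; x≈y (false ∷ S , i , k) → app-cong (pullback {Combination m p} (combination p)) (λ T → x≈y (inj₂ (T , i) , k)) S }
            ; app-+    = λ { x y (true ∷ S , i , k) → app-+ includeLower (lowerPart k x) (lowerPart k y) (S , i)
                           ; x y (false ∷ S , i , k) → app-+ (pullback {Combination m p} (combination p)) (λ T → x (inj₂ (T , i) , k)) (λ T → y (inj₂ (T , i) , k)) S }
            ; app-*    = λ { c x (true ∷ S , i , k) → app-* includeLower c (lowerPart k x) (S , i)
                           ; c x (false ∷ S , i , k) → app-* (pullback {Combination m p} (combination p)) c (λ T → x (inj₂ (T , i) , k)) S }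
            }

          Ψ-supported : ∀ x → Supported (_≡ p) (app Ψ x)
          Ψ-supported x (true ∷ S) (i , k) ∣S∣≢p with combination⁻ p S in eq
          ... | just T  = contradiction (combination⁻-size p S eq) ∣S∣≢p
          ... | nothing = refl
          Ψ-supported x (false ∷ S) (i , k) ∣S∣≢p with combination p S in eq
          ... | just T  = contradiction (combination-size p S eq) ∣S∣≢p
          ... | nothing = refl

          module WithRanks (ranks : ∀ l → WedgeRank m p (a l)) where

            -- C(2p, p) linear forms per term, chosen so that their vanishing kills the whole
            -- contribution of the term.
            row : Fin r → Unknown ⊸ Combination m p
            row l = reindex (λ T → proj₁ (ranks l) T , Unit.tt) ⊙ wedge (a l) ⊙ Λ (suc m) (V l) ⊙ Ψ

            module _ (x : Unknown → Carrier) (rows≈0 : ∀ l T → app (row l) x T ≈ 0#) where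

              wedge≈0 : ∀ l s → app (wedge (a l)) (app (Λ (suc m) (V l)) (app Ψ x)) s ≈ 0#
              wedge≈0 l = proj₂ (ranks l) _
                (λ S j ∣S∣≢p → app-0 (V l) (λ s → Ψ-supported x S s ∣S∣≢p) _)
                (rows≈0 l)

              rank-one : Fin r → Fin (suc m) → Square n ⊸ Square n
              rank-one l j = outer (W l) ⊙ scalar (a l j) ⊙ V l

              -- Expanding every `Y j` by the rank decomposition splits the Koszul map into one
              -- summand for each l, and each summand factors through a product that is zero by
              -- `wedge≈0`.
              D-matrices≈0 : ∀ s → app (D (λ j → actOnMatrices (Y j))) (app Ψ x) s ≈ 0#
              D-matrices≈0 s = trans
                (D-sum {X = λ j → actOnMatrices (Y j)} rank-one
                  (λ j Z (i , k) → trans (sum-cong-≋ (λ i′ → *-comm (Z (i′ , k)) (Y j (i , i′)))) (decomposition (Y j) Z i k))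
                  (app Ψ x) s)
                (sum-zero {r} _ (λ l → trans (D-factor (λ j → scalar (a l j)) (V l) (outer (W l)) (app Ψ x) s)
                  (app-0 (Λ (suc m) (outer (W l))) {app (wedge (a l)) (app (Λ (suc m) (V l)) (app Ψ x))} (wedge≈0 l) s)))

              column : Fin n → Vec Bool (suc m) × Fin n → Carrier
              column k (S , i) = app Ψ x (S , i , k)

              normalised : Fin (suc m) → Fin n ⊸ Fin n
              normalised j = L₀ ⊙ actOnVectors (Y j)

              D-column≈0 : ∀ k s → app (D normalised) (column k) s ≈ 0#
              D-column≈0 k s = trans
                (D-natural {X = λ j → actOnVectors (Y j)} {Y = normalised} (reindex id) L₀ (λ j f i → refl) (column k) s)
                (app-0 (Λ (suc m) L₀) {app (D (λ j → actOnVectors (Y j))) (column k)} (λ { (S , i) → trans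
                  (D-natural {X = λ j → actOnMatrices (Y j)} {Y = λ j → actOnVectors (Y j)} (reindex (_, k)) (reindex (_, k))
                    (λ j f i → refl) (app Ψ x) (S , i))
                  (D-matrices≈0 (S , i , k)) }) s)

              module _ (k : Fin n) where

                α β : Vec Bool m × Fin n → Carrier
                α = app includeLower (lowerPart k x)
                β = upperPart k x

                -- As L₀X₀ is the identity, the e₀ component of the normalised Koszul map is β - Dα.
                -- Eliminating β from the other component Dβ = 0 leaves D²α = 0: this is the Schur
                -- complement.
                β≈Dα : ∀ s → β s ≈ app (D (family S₁)) α s
                β≈Dα (S , i) = begin
                  y                          ≈⟨ solve 2 (λ y d → y := (y :- d) :+ d) refl y d ⟩
                  (y - d) + d                ≈⟨ +-congʳ (+-congʳ (L₀X₀≈id (λ i → β (S , i)) i)) ⟨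
                  (app (normalised zero) (λ i → β (S , i)) i - d) + d
                                             ≈⟨ +-congʳ (D-column≈0 k (true ∷ S , i)) ⟩
                  0# + d                     ≈⟨ +-identityˡ d ⟩
                  d                          ∎
                  where
                  y d : Carrier
                  y = β (S , i)
                  d = app (D (family S₁)) α (S , i)

                lower≈0 : ∀ t → x (inj₁ t , k) ≈ 0#
                lower≈0 = kernel (lowerPart k x) (λ { (S , i) → trans (sym (koszul-cong (family S₁) β≈Dα (S , i)))
                  (D-column≈0 k (false ∷ S , i)) })

                upper≈0 : ∀ T i → x (inj₂ (T , i) , k) ≈ 0#
                upper≈0 T i = begin
                  x (inj₂ (T , i) , k)          ≈⟨ app-pullback (combination p) {j = toSubset T} (combination-toSubset T) (λ T → x (inj₂ (T , i) , k)) ⟨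
                  β (toSubset T , i)            ≈⟨ β≈Dα (toSubset T , i) ⟩
                  app (D (family S₁)) α (toSubset T , i)
                    ≈⟨ app-0 (D (family S₁)) {α} (app-0 includeLower {lowerPart k x} lower≈0) (toSubset T , i) ⟩
                  0#                            ∎

            rows-trivial : TrivialKernel (tuple row)
            rows-trivial x rows≈0 (inj₁ t , k)       = lower≈0 x (λ l T → rows≈0 (l , T)) k t
            rows-trivial x rows≈0 (inj₂ (T , i) , k) = upper≈0 x (λ l T → rows≈0 (l , T)) k T i

            module WithRows (rowBasis : DualBasis unknowns (tuple row)) where

              private
                module R = DualBasis rowBasis

              -- A selected row takes the value 1 on its own dual vector, so it is not a zero row.
              alive : ∀ {k j T} → R.ι k ≡ (ι j , T) → ¬ lookup (S₀ ∪ S₁) j ≡ false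
              alive {k} {j} {T} eq ∉S = 1≉0 (begin
                1#                                        ≈⟨ reflexive (δ-diagonal k) ⟨
                δ k k                                     ≈⟨ R.dual k k ⟨
                app (tuple row) (R.b k) (R.ι k)           ≈⟨ reflexive (≡.cong (app (tuple row) (R.b k)) eq) ⟩
                app (tuple row) (R.b k) (ι j , T)         ≈⟨ wedge-zero {a = a (ι j)} (killed j ∉S)
                                                               (app (Λ (suc m) (V (ι j)) ⊙ Ψ) (R.b k)) (proj₁ (ranks (ι j)) T , _) ⟩
                0#                                        ∎)

              Absent : Set
              Absent = Fin ∣ ∁ (S₀ ∪ S₁) ∣ × Combination m p

              -- The rows (ι j , T) with j absent from S₀ ∪ S₁ vanish, so none of them is selected by rowBasis.
              locate : Fin unknowns ⊎ Absent → Fin r × Combination m p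
              locate (inj₁ k)       = R.ι k
              locate (inj₂ (i , T)) = ι (absent (S₀ ∪ S₁) i) , T

              locate-injective : ∀ {x y} → locate x ≡ locate y → x ≡ y
              locate-injective {inj₁ k} {inj₁ k′} eq = ≡.cong inj₁ (R.ι-injective eq)
              locate-injective {inj₁ k} {inj₂ (i , T)} eq = contradiction (lookup-absent (S₀ ∪ S₁) i) (alive eq)
              locate-injective {inj₂ (i , T)} {inj₁ k} eq = contradiction (lookup-absent (S₀ ∪ S₁) i) (alive (≡.sym eq))
              locate-injective {inj₂ (i , T)} {inj₂ (j , T′)} eq = ≡.cong inj₂ (≡.cong₂ _,_
                (absent-injective (S₀ ∪ S₁) (ι-injective (≡.cong proj₁ eq))) (≡.cong proj₂ eq))

              count : unknowns ℕ.+ ∣ ∁ (S₀ ∪ S₁) ∣ ℕ.* (m C p) ≤ r ℕ.* (m C p)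
              count = injective⇒≤ {f = to target↔ ∘ locate ∘ from source↔}
                (λ eq → Injection.injective (↔⇒↣ (↔-sym source↔)) (locate-injective (Injection.injective (↔⇒↣ target↔) eq)))
                where
                open Inverse using (to; from)
                source↔ : (Fin unknowns ⊎ Absent) ↔ Fin (unknowns ℕ.+ ∣ ∁ (S₀ ∪ S₁) ∣ ℕ.* (m C p))
                source↔ = ↔-trans (↔-refl ⊎-↔ ↔-trans (↔-refl ×-↔ combination↔ m p) (↔-sym *↔×)) (↔-sym +↔⊎)
                target↔ : (Fin r × Combination m p) ↔ Fin (r ℕ.* (m C p))
                target↔ = ↔-trans (↔-refl ×-↔ combination↔ m p) (↔-sym *↔×)

    rank-bound : (M ℕ.+ (m C p) ℕ.* n) ℕ.* n ℕ.+ (N ℕ.∸ (n ℕ.* 1 ℕ.+ M ℕ.* 2)) ℕ.* (m C p) ≤ r ℕ.* (m C p)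
    -- All choices below exist only under a double negation; decidability of ≤ on ℕ discharges it.
    rank-bound = decidable-stable (_ ℕₚ.≤? _) (do
      basis ← dualBasis (↔-sym *↔×) U U-trivial
      let open WithBasis basis
      (S₀ , ∣S₀∣≤ , ker₀) ← first
      basis₀ ← dualBasisFin n _ ker₀
      let open WithFirst S₀ basis₀
      (S₁ , ∣S₁∣≤ , ker₁) ← second
      let open WithSecond S₁ ker₁
      ranks ← sequence (λ l → wedge-rank m p (a l))
      let open WithRanks ranks
      rowBasis ← dualBasis unknown↔ (tuple row) rows-trivial
      let open WithRows rowBasis
      return (ℕₚ.≤-trans
        (ℕₚ.+-monoʳ-≤ unknowns (ℕₚ.*-monoˡ-≤ (m C p) (ℕₚ.≤-trans
          (ℕₚ.∸-monoʳ-≤ N (ℕₚ.≤-trans (∣p∪q∣≤∣p∣+∣q∣ S₀ S₁) (ℕₚ.+-mono-≤ ∣S₀∣≤ ∣S₁∣≤)))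
          (ℕₚ.≤-reflexive (≡.sym (∣∁p∣≡n∸∣p∣ (S₀ ∪ S₁)))))))
        count))

-- The integral bounds as inequalities between rational numbers.

module RationalBounds where

  open import Data.Integer.Base as ℤ using (+_)
  import Data.Integer.Properties as ℤₚ
  open import Data.Nat.Base as ℕ using (ℕ; zero; suc)
  import Data.Nat.Properties as ℕₚ
  open import Data.Product.Base using (∃; _,_)
  open import Data.Rational.Base
  import Data.Rational.Properties as ℚₚ
  import Data.Rational.Unnormalised.Base as ℚᵘ
  import Data.Rational.Unnormalised.Properties as ℚᵘₚ
  open import Data.Rational.Solver using (module +-*-Solver)
  import Data.Nat.Solver as ℕ-Solver
  open import Defs using (ℕ→ℚ)
  open import Relation.Binary.PropositionalEquality
  open Arithmetic
  open +-*-Solver using (solve; _:=_; _:+_; _:-_; _:*_)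

  private
    toℚᵘ-ℕ→ℚ : ∀ n → toℚᵘ (ℕ→ℚ n) ℚᵘ.≃ ℚᵘ.mkℚᵘ (+ n) 0
    toℚᵘ-ℕ→ℚ n = ℚₚ.toℚᵘ-fromℚᵘ (ℚᵘ.mkℚᵘ (+ n) 0)

  ℕ→ℚ-+ : ∀ m n → ℕ→ℚ (m ℕ.+ n) ≡ ℕ→ℚ m + ℕ→ℚ n
  ℕ→ℚ-+ m n = ℚₚ.toℚᵘ-injective (begin
    toℚᵘ (ℕ→ℚ (m ℕ.+ n))                           ≈⟨ toℚᵘ-ℕ→ℚ (m ℕ.+ n) ⟩
    ℚᵘ.mkℚᵘ (+ (m ℕ.+ n)) 0                        ≈⟨ ℚᵘ.*≡* (cong (ℤ._* + 1) (cong₂ ℤ._+_ (sym (ℤₚ.*-identityʳ (+ m))) (sym (ℤₚ.*-identityʳ (+ n))))) ⟩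
    ℚᵘ.mkℚᵘ (+ m) 0 ℚᵘ.+ ℚᵘ.mkℚᵘ (+ n) 0           ≈⟨ ℚᵘₚ.+-cong (toℚᵘ-ℕ→ℚ m) (toℚᵘ-ℕ→ℚ n) ⟨
    toℚᵘ (ℕ→ℚ m) ℚᵘ.+ toℚᵘ (ℕ→ℚ n)                 ≈⟨ ℚₚ.toℚᵘ-homo-+ (ℕ→ℚ m) (ℕ→ℚ n) ⟨
    toℚᵘ (ℕ→ℚ m + ℕ→ℚ n)                           ∎)
    where open ℚᵘₚ.≃-Reasoning

  ℕ→ℚ-* : ∀ m n → ℕ→ℚ (m ℕ.* n) ≡ ℕ→ℚ m * ℕ→ℚ n
  ℕ→ℚ-* m n = ℚₚ.toℚᵘ-injective (begin
    toℚᵘ (ℕ→ℚ (m ℕ.* n))                           ≈⟨ toℚᵘ-ℕ→ℚ (m ℕ.* n) ⟩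
    ℚᵘ.mkℚᵘ (+ (m ℕ.* n)) 0                        ≈⟨ ℚᵘ.*≡* (cong (ℤ._* + 1) (ℤₚ.pos-* m n)) ⟩
    ℚᵘ.mkℚᵘ (+ m) 0 ℚᵘ.* ℚᵘ.mkℚᵘ (+ n) 0           ≈⟨ ℚᵘₚ.*-cong (toℚᵘ-ℕ→ℚ m) (toℚᵘ-ℕ→ℚ n) ⟨
    toℚᵘ (ℕ→ℚ m) ℚᵘ.* toℚᵘ (ℕ→ℚ n)                 ≈⟨ ℚₚ.toℚᵘ-homo-* (ℕ→ℚ m) (ℕ→ℚ n) ⟨
    toℚᵘ (ℕ→ℚ m * ℕ→ℚ n)                           ∎)
    where open ℚᵘₚ.≃-Reasoning

  ℕ→ℚ-mono : ∀ {m n} → m ℕ.≤ n → ℕ→ℚ m ≤ ℕ→ℚ n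
  ℕ→ℚ-mono {m} {n} m≤n = ℚₚ.toℚᵘ-cancel-≤ (begin
    toℚᵘ (ℕ→ℚ m)              ≃⟨ toℚᵘ-ℕ→ℚ m ⟩
    ℚᵘ.mkℚᵘ (+ m) 0           ≤⟨ ℚᵘ.*≤* (ℤₚ.*-monoʳ-≤-nonNeg (+ 1) (ℤ.+≤+ m≤n)) ⟩
    ℚᵘ.mkℚᵘ (+ n) 0           ≃⟨ toℚᵘ-ℕ→ℚ n ⟨
    toℚᵘ (ℕ→ℚ n)              ∎)
    where open ℚᵘₚ.≤-Reasoning

  /-ℕ→ℚ : ∀ m d .{{_ : ℕ.NonZero d}} → (+ m / d) * ℕ→ℚ d ≡ ℕ→ℚ m
  /-ℕ→ℚ m (suc d) = ℚₚ.toℚᵘ-injective (begin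
    toℚᵘ ((+ m / suc d) * ℕ→ℚ (suc d))                        ≈⟨ ℚₚ.toℚᵘ-homo-* (+ m / suc d) (ℕ→ℚ (suc d)) ⟩
    toℚᵘ (+ m / suc d) ℚᵘ.* toℚᵘ (ℕ→ℚ (suc d))                ≈⟨ ℚᵘₚ.*-cong (ℚₚ.toℚᵘ-fromℚᵘ (ℚᵘ.mkℚᵘ (+ m) d)) (toℚᵘ-ℕ→ℚ (suc d)) ⟩
    ℚᵘ.mkℚᵘ (+ m) d ℚᵘ.* ℚᵘ.mkℚᵘ (+ suc d) 0                  ≈⟨ ℚᵘ.*≡* (trans (ℤₚ.*-identityʳ _) (cong (+ m ℤ.*_) (sym (cong +_ (ℕₚ.*-identityʳ (suc d)))))) ⟩
    ℚᵘ.mkℚᵘ (+ m) 0                                           ≈⟨ toℚᵘ-ℕ→ℚ m ⟨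
    toℚᵘ (ℕ→ℚ m)                                              ∎)
    where open ℚᵘₚ.≃-Reasoning

  ℕ→ℚ-positive : ∀ n → Positive (ℕ→ℚ (suc n))
  ℕ→ℚ-positive n = ℚₚ.normalize-pos (suc n) 1

  private
    n^2≡n*n : ∀ n → n ℕ.^ 2 ≡ n ℕ.* n
    n^2≡n*n n = cong (n ℕ.*_) (ℕₚ.*-identityʳ n)

  Bound⇒rational : ∀ p n r → Bound p n r →
    (ℕ→ℚ 3 - + 1 / suc p) * ℕ→ℚ (n ℕ.^ 2) - ℕ→ℚ (coefficient p) * ℕ→ℚ n ≤ ℕ→ℚ r
  Bound⇒rational p n r h = ℚₚ.*-cancelʳ-≤-pos P {{ℕ→ℚ-positive p}} (begin
    ((ℕ→ℚ 3 - e) * ℕ→ℚ (n ℕ.^ 2) - K * x) * P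
      ≡⟨ cong (λ y → ((ℕ→ℚ 3 - e) * y - K * x) * P) (trans (cong ℕ→ℚ (n^2≡n*n n)) (ℕ→ℚ-* n n)) ⟩
    ((ℕ→ℚ 3 - e) * (x * x) - K * x) * P
      ≡⟨ solve 5 (λ t e x K P → ((t :- e) :* (x :* x) :- K :* x) :* P := (t :* P :- e :* P) :* (x :* x) :- P :* (K :* x)) refl (ℕ→ℚ 3) e x K P ⟩
    (ℕ→ℚ 3 * P - e * P) * (x * x) - P * (K * x)
      ≡⟨ cong (λ y → y * (x * x) - P * (K * x)) leading-coefficient ⟩
    ℕ→ℚ (3 ℕ.* p ℕ.+ 2) * (x * x) - P * (K * x)
      ≡⟨ cong (_- P * (K * x)) (trans (ℕ→ℚ-* (3 ℕ.* p ℕ.+ 2) (n ℕ.* n)) (cong (ℕ→ℚ (3 ℕ.* p ℕ.+ 2) *_) (ℕ→ℚ-* n n))) ⟨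
    ℕ→ℚ ((3 ℕ.* p ℕ.+ 2) ℕ.* (n ℕ.* n)) - P * (K * x)
      ≤⟨ ℚₚ.+-monoˡ-≤ (- (P * (K * x))) (ℕ→ℚ-mono h) ⟩
    ℕ→ℚ (suc p ℕ.* (r ℕ.+ coefficient p ℕ.* n)) - P * (K * x)
      ≡⟨ cong (_- P * (K * x)) (trans (ℕ→ℚ-* (suc p) (r ℕ.+ coefficient p ℕ.* n)) (cong (P *_) (trans (ℕ→ℚ-+ r (coefficient p ℕ.* n)) (cong (λ y → ℕ→ℚ r + y) (ℕ→ℚ-* (coefficient p) n))))) ⟩
    P * (ℕ→ℚ r + K * x) - P * (K * x)
      ≡⟨ solve 3 (λ P r k → P :* (r :+ k) :- P :* k := r :* P) refl P (ℕ→ℚ r) (K * x) ⟩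
    ℕ→ℚ r * P  ∎)
    where
    open ℚₚ.≤-Reasoning
    P e K x : ℚ
    P = ℕ→ℚ (suc p)
    e = + 1 / suc p
    K = ℕ→ℚ (coefficient p)
    x = ℕ→ℚ n
    leading-coefficient : ℕ→ℚ 3 * P - e * P ≡ ℕ→ℚ (3 ℕ.* p ℕ.+ 2)
    leading-coefficient = begin-equality
      ℕ→ℚ 3 * P - e * P                               ≡⟨ cong₂ _-_ (sym (ℕ→ℚ-* 3 (suc p))) (/-ℕ→ℚ 1 (suc p)) ⟩
      ℕ→ℚ (3 ℕ.* suc p) - ℕ→ℚ 1                       ≡⟨ cong (λ y → ℕ→ℚ y - ℕ→ℚ 1) (ℕ-Solver.+-*-Solver.solve 1 (λ p → con′ 3 :*′ (con′ 1 :+′ p) :=′ (con′ 3 :*′ p :+′ con′ 2) :+′ con′ 1) refl p) ⟩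
      ℕ→ℚ (3 ℕ.* p ℕ.+ 2 ℕ.+ 1) - ℕ→ℚ 1               ≡⟨ cong (_- ℕ→ℚ 1) (ℕ→ℚ-+ (3 ℕ.* p ℕ.+ 2) 1) ⟩
      ℕ→ℚ (3 ℕ.* p ℕ.+ 2) + ℕ→ℚ 1 - ℕ→ℚ 1             ≡⟨ solve 2 (λ y z → y :+ z :- z := y) refl (ℕ→ℚ (3 ℕ.* p ℕ.+ 2)) (ℕ→ℚ 1) ⟩
      ℕ→ℚ (3 ℕ.* p ℕ.+ 2)                             ∎
      where open ℕ-Solver.+-*-Solver using () renaming (con to con′; _:*_ to _:*′_; _:+_ to _:+′_; _:=_ to _:=′_)

  -- This is 2n²/(p+1): one n²/(p+1) is the loss in the leading coefficient, the other absorbs the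
  -- linear term once n reaches `threshold p`.
  error : ℕ → ℕ → ℚ
  error p n = + (2 ℕ.* (n ℕ.* n)) / suc p

  Bound⇒error : ∀ p n r → Bound p n r → threshold p ℕ.≤ n → ℕ→ℚ (3 ℕ.* n ℕ.^ 2) - error p n ≤ ℕ→ℚ r
  Bound⇒error p n r h t≤n = ℚₚ.*-cancelʳ-≤-pos P {{ℕ→ℚ-positive p}} (begin
    (ℕ→ℚ (3 ℕ.* n ℕ.^ 2) - error p n) * P
      ≡⟨ solve 3 (λ x e P → (x :- e) :* P := x :* P :- e :* P) refl (ℕ→ℚ (3 ℕ.* n ℕ.^ 2)) (error p n) P ⟩
    ℕ→ℚ (3 ℕ.* n ℕ.^ 2) * P - error p n * P
      ≡⟨ cong₂ _-_ (trans (sym (ℕ→ℚ-* (3 ℕ.* n ℕ.^ 2) (suc p))) (cong (λ y → ℕ→ℚ (3 ℕ.* y ℕ.* suc p)) (n^2≡n*n n))) (/-ℕ→ℚ E (suc p)) ⟩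
    ℕ→ℚ (3 ℕ.* (n ℕ.* n) ℕ.* suc p) - ℕ→ℚ E
      ≤⟨ ℚₚ.+-monoˡ-≤ (- ℕ→ℚ E) (ℕ→ℚ-mono integral) ⟩
    ℕ→ℚ (r ℕ.* suc p ℕ.+ E) - ℕ→ℚ E
      ≡⟨ cong (_- ℕ→ℚ E) (trans (ℕ→ℚ-+ (r ℕ.* suc p) E) (cong (_+ ℕ→ℚ E) (ℕ→ℚ-* r (suc p)))) ⟩
    ℕ→ℚ r * P + ℕ→ℚ E - ℕ→ℚ E
      ≡⟨ solve 2 (λ y z → y :+ z :- z := y) refl (ℕ→ℚ r * P) (ℕ→ℚ E) ⟩
    ℕ→ℚ r * P  ∎)
    where
    open ℚₚ.≤-Reasoning
    P : ℚ
    P = ℕ→ℚ (suc p)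
    E : ℕ
    E = 2 ℕ.* (n ℕ.* n)
    integral : 3 ℕ.* (n ℕ.* n) ℕ.* suc p ℕ.≤ r ℕ.* suc p ℕ.+ E
    integral = ℕR.begin
      3 ℕ.* (n ℕ.* n) ℕ.* suc p                                   ℕR.≡⟨ ℕS.solve 2 (λ p x → ℕS.con 3 ℕS.:* x ℕS.:* (ℕS.con 1 ℕS.:+ p) ℕS.:= (ℕS.con 3 ℕS.:* p ℕS.:+ ℕS.con 2) ℕS.:* x ℕS.:+ x) refl p (n ℕ.* n) ⟩
      (3 ℕ.* p ℕ.+ 2) ℕ.* (n ℕ.* n) ℕ.+ n ℕ.* n                   ℕR.≤⟨ ℕₚ.+-monoˡ-≤ (n ℕ.* n) h ⟩
      suc p ℕ.* (r ℕ.+ coefficient p ℕ.* n) ℕ.+ n ℕ.* n           ℕR.≡⟨ ℕS.solve 4 (λ P r k n → P ℕS.:* (r ℕS.:+ k ℕS.:* n) ℕS.:+ n ℕS.:* n ℕS.:= r ℕS.:* P ℕS.:+ (P ℕS.:* k ℕS.:* n ℕS.:+ n ℕS.:* n)) refl (suc p) r (coefficient p) n ⟩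
      r ℕ.* suc p ℕ.+ (threshold p ℕ.* n ℕ.+ n ℕ.* n)             ℕR.≤⟨ ℕₚ.+-monoʳ-≤ (r ℕ.* suc p) (ℕₚ.+-monoˡ-≤ (n ℕ.* n) (ℕₚ.*-monoˡ-≤ n t≤n)) ⟩
      r ℕ.* suc p ℕ.+ (n ℕ.* n ℕ.+ n ℕ.* n)                       ℕR.≡⟨ cong (λ y → r ℕ.* suc p ℕ.+ (n ℕ.* n ℕ.+ y)) (sym (ℕₚ.+-identityʳ (n ℕ.* n))) ⟩
      r ℕ.* suc p ℕ.+ E                                           ℕR.∎
      where
      module ℕR = ℕₚ.≤-Reasoning
      module ℕS = ℕ-Solver.+-*-Solver

  -- A positive rational is at least the reciprocal of its denominator, so twice the denominator
  -- serves as `d`.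
  archimedean : ∀ ε → 0ℚ < ε → ∃ λ d → ∀ n → d ℕ.≤ n → ℕ→ℚ 2 ≤ ε * ℕ→ℚ (suc n)
  archimedean ε ε>0 = 2 ℕ.* d , λ n 2d≤n → begin
    ℕ→ℚ 2                          ≡⟨ ℚₚ.*-identityˡ (ℕ→ℚ 2) ⟨
    1ℚ * ℕ→ℚ 2                     ≤⟨ ℚₚ.*-monoʳ-≤-nonNeg (ℕ→ℚ 2) 1≤εd ⟩
    ε * ℕ→ℚ d * ℕ→ℚ 2              ≡⟨ trans (ℚₚ.*-assoc ε (ℕ→ℚ d) (ℕ→ℚ 2)) (cong (ε *_) (trans (ℚₚ.*-comm (ℕ→ℚ d) (ℕ→ℚ 2)) (sym (ℕ→ℚ-* 2 d)))) ⟩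
    ε * ℕ→ℚ (2 ℕ.* d)              ≤⟨ ℚₚ.*-monoˡ-≤-nonNeg ε {{nonNegative (ℚₚ.<⇒≤ ε>0)}} (ℕ→ℚ-mono (ℕₚ.m≤n⇒m≤1+n 2d≤n)) ⟩
    ε * ℕ→ℚ (suc n)                ∎
    where
    open ℚₚ.≤-Reasoning
    d : ℕ
    d = ↧ₙ ε
    1≤εd : 1ℚ ≤ ε * ℕ→ℚ d
    1≤εd = 1≤ ε ε>0
      where
      1≤ : ∀ ε → 0ℚ < ε → 1ℚ ≤ ε * ℕ→ℚ (↧ₙ ε)
      1≤ ε@(mkℚ (+ suc a) _ _) _ = begin
        1ℚ                                      ≤⟨ ℕ→ℚ-mono {1} {suc a} (ℕ.s≤s ℕ.z≤n) ⟩
        ℕ→ℚ (suc a)                             ≡⟨ /-ℕ→ℚ (suc a) (↧ₙ ε) ⟨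
        (+ suc a / ↧ₙ ε) * ℕ→ℚ (↧ₙ ε)           ≡⟨ cong (_* ℕ→ℚ (↧ₙ ε)) (ℚₚ.↥p/↧p≡p ε) ⟩
        ε * ℕ→ℚ (↧ₙ ε)                          ∎
      1≤ (mkℚ (+ zero) _ _)    (*<* (ℤ.+<+ ()))
      1≤ (mkℚ (ℤ.-[1+ _ ]) _ _) (*<* ())

  error-ratio : ∀ p n .{{_ : ℕ.NonZero n}} ε → ℕ→ℚ 2 ≤ ε * ℕ→ℚ (suc p) →
                ∣ error p n * (_/_ (+ 1) (n ℕ.* n) {{ℕₚ.m*n≢0 n n}}) ∣ ≤ ε
  error-ratio p n ε h = ℚₚ.*-cancelʳ-≤-pos P {{ℕ→ℚ-positive p}} (begin
    ∣ error p n * q ∣ * P        ≡⟨ cong (_* P) (ℚₚ.0≤p⇒∣p∣≡p 0≤v) ⟩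
    error p n * q * P            ≡⟨ ratio ⟩
    ℕ→ℚ 2                        ≤⟨ h ⟩
    ε * P                        ∎)
    where
    open ℚₚ.≤-Reasoning
    instance
      n²-nonZero : ℕ.NonZero (n ℕ.* n)
      n²-nonZero = ℕₚ.m*n≢0 n n
    P q : ℚ
    P = ℕ→ℚ (suc p)
    q = + 1 / (n ℕ.* n)
    0≤v : 0ℚ ≤ error p n * q
    0≤v = ℚₚ.nonNegative⁻¹ _ {{ℚₚ.nonNeg*nonNeg⇒nonNeg (error p n) {{ℚₚ.normalize-nonNeg (2 ℕ.* (n ℕ.* n)) (suc p)}} q {{ℚₚ.normalize-nonNeg 1 (n ℕ.* n)}}}}
    ratio : error p n * q * P ≡ ℕ→ℚ 2
    ratio = begin-equality
      error p n * q * P                   ≡⟨ solve 3 (λ e q P → e :* q :* P := q :* (e :* P)) refl (error p n) q P ⟩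
      q * (error p n * P)                 ≡⟨ cong (q *_) (trans (/-ℕ→ℚ (2 ℕ.* (n ℕ.* n)) (suc p)) (ℕ→ℚ-* 2 (n ℕ.* n))) ⟩
      q * (ℕ→ℚ 2 * ℕ→ℚ (n ℕ.* n))         ≡⟨ solve 3 (λ q t N → q :* (t :* N) := t :* (q :* N)) refl q (ℕ→ℚ 2) (ℕ→ℚ (n ℕ.* n)) ⟩
      ℕ→ℚ 2 * (q * ℕ→ℚ (n ℕ.* n))         ≡⟨ cong (ℕ→ℚ 2 *_) (/-ℕ→ℚ 1 (n ℕ.* n)) ⟩
      ℕ→ℚ 2 * ℕ→ℚ 1                       ≡⟨ ℚₚ.*-identityʳ (ℕ→ℚ 2) ⟩
      ℕ→ℚ 2                               ∎

-- The complex numbers as a stable field.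

module ComplexNumbers where

  open import Defs
  open import Algebra.Bundles using (CommutativeRing)
  import Algebra.Properties.Semiring.Mult as Mult
  open import Data.Integer.Base as ℤ using (+_)
  open import Data.Nat.Base as ℕ using (ℕ; zero; suc)
  import Data.Nat.Properties as ℕₚ
  open import Data.Product.Base using (∃; _×_; _,_; proj₁; proj₂)
  open import Data.Rational.Base
  import Data.Rational.Properties as ℚₚ
  open import Data.Rational.Solver using (module +-*-Solver)
  open import Data.Sum.Base using (_⊎_; inj₁; inj₂; [_,_]′)
  open import Relation.Binary.PropositionalEquality as ≡ using (_≡_; refl; sym; trans; cong; cong₂; subst)
  open import Relation.Nullary using (¬_; yes; no; contradiction; ¬¬-excluded-middle)
  open Estimates

  open DoubleNegation
  open +-*-Solver using (solve; _:=_; _:+_; _:-_; _:*_; :-_; con)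
  private
    module ℂᵣ = CommutativeRing ℂ-commutativeRing
  open Mult ℂᵣ.semiring using () renaming (_×_ to _·_)

  x≤y+∣x-y∣ : ∀ x y → x ≤ y + ∣ x - y ∣
  x≤y+∣x-y∣ x y = begin
    x                    ≡⟨ solve 2 (λ x y → x := y :+ (x :- y)) refl x y ⟩
    y + (x - y)          ≤⟨ ℚₚ.+-monoʳ-≤ y (p≤∣p∣ (x - y)) ⟩
    y + ∣ x - y ∣        ∎
    where
    open ℚₚ.≤-Reasoning
    p≤∣p∣ : ∀ p → p ≤ ∣ p ∣
    p≤∣p∣ p with ℚₚ.≤-total 0ℚ p
    ... | inj₁ 0≤p = ℚₚ.≤-reflexive (sym (ℚₚ.0≤p⇒∣p∣≡p 0≤p))
    ... | inj₂ p≤0 = ℚₚ.≤-trans p≤0 (ℚₚ.0≤∣p∣ p)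

  square-abs : ∀ x → x * x ≡ ∣ x ∣ * ∣ x ∣
  square-abs x with ℚₚ.∣p∣≡p∨∣p∣≡-p x
  ... | inj₁ eq = sym (cong₂ _*_ eq eq)
  ... | inj₂ eq = trans (solve 1 (λ x → x :* x := (:- x) :* (:- x)) refl x) (sym (cong₂ _*_ eq eq))

  0≤square : ∀ x → 0ℚ ≤ x * x
  0≤square x = subst (0ℚ ≤_) (sym (square-abs x))
    (ℚₚ.nonNegative⁻¹ _ {{ℚₚ.nonNeg*nonNeg⇒nonNeg y {{ℚₚ.∣-∣-nonNeg x}} y {{ℚₚ.∣-∣-nonNeg x}}}})
    where
    y : ℚ
    y = ∣ x ∣

  square≤⇒abs≤ : ∀ {x ε} → 0ℚ < ε → x * x ≤ ε * ε → ∣ x ∣ ≤ ε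
  square≤⇒abs≤ {x} {ε} ε>0 xx≤εε = ℚₚ.≮⇒≥ λ ε<∣x∣ → ℚₚ.<-irrefl refl (begin-strict
    ε * ε            <⟨ ℚₚ.*-monoˡ-<-pos ε {{positive ε>0}} ε<∣x∣ ⟩
    ∣ x ∣ * ε        ≤⟨ ℚₚ.*-monoˡ-≤-nonNeg ∣ x ∣ {{ℚₚ.∣-∣-nonNeg x}} (ℚₚ.<⇒≤ ε<∣x∣) ⟩
    ∣ x ∣ * ∣ x ∣    ≡⟨ square-abs x ⟨
    x * x            ≤⟨ xx≤εε ⟩
    ε * ε            ∎)
    where open ℚₚ.≤-Reasoning

  BoundedBelow : ℝ → Set
  BoundedBelow x = ∃ λ δ → 0ℚ < δ × ∃ λ N → ∀ n → N ℕ.≤ n → δ ≤ seq x n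

  -- A single term decides. Beyond N the sequence oscillates by at most ε/4; comparing its N-th term
  -- with ε/2 shows that the later terms either stay at most ε or stay at least ε/4.
  small-or-boundedBelow : ∀ x ε → 0ℚ < ε → (∃ λ N → ∀ n → N ℕ.≤ n → seq x n ≤ ε) ⊎ BoundedBelow x
  small-or-boundedBelow x ε ε>0 = go (cauchy x g (half>0 (half>0 ε>0)))
    where
    h g : ℚ
    h = ½ * ε
    g = ½ * h
    g>0 : 0ℚ < g
    g>0 = half>0 (half>0 ε>0)
    g≤h : g ≤ h
    g≤h = ℚₚ.≤-trans (ℚₚ.≤-reflexive (sym (ℚₚ.+-identityʳ g))) (ℚₚ.≤-trans (ℚₚ.+-monoʳ-≤ g (ℚₚ.<⇒≤ g>0)) (ℚₚ.≤-reflexive (half+half h)))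
    open ℚₚ.≤-Reasoning
    go : (∃ λ N → ∀ m n → N ℕ.≤ m → N ℕ.≤ n → ∣ seq x m - seq x n ∣ ≤ g) →
         (∃ λ N → ∀ n → N ℕ.≤ n → seq x n ≤ ε) ⊎ BoundedBelow x
    go (N , near) with seq x N ℚₚ.≤? h
    ... | yes xN≤h = inj₁ (N , λ n N≤n → begin
      seq x n                                ≤⟨ x≤y+∣x-y∣ (seq x n) (seq x N) ⟩
      seq x N + ∣ seq x n - seq x N ∣        ≤⟨ ℚₚ.+-mono-≤ xN≤h (ℚₚ.≤-trans (near n N N≤n ℕₚ.≤-refl) g≤h) ⟩
      h + h                                  ≡⟨ half+half ε ⟩
      ε                                      ∎)
    ... | no xN≰h = inj₂ (g , g>0 , N , λ n N≤n → begin
      g                                          ≡⟨ solve 1 (λ g → g := (g :+ g) :- g) refl g ⟩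
      (g + g) - g                                ≡⟨ cong (_- g) (half+half h) ⟩
      h - g                                      ≤⟨ ℚₚ.+-mono-≤ (ℚₚ.<⇒≤ (ℚₚ.≰⇒> xN≰h)) (ℚₚ.neg-antimono-≤ (near N n ℕₚ.≤-refl N≤n)) ⟩
      seq x N - ∣ seq x N - seq x n ∣            ≤⟨ ℚₚ.+-monoˡ-≤ _ (x≤y+∣x-y∣ (seq x N) (seq x n)) ⟩
      seq x n + ∣ seq x N - seq x n ∣ - ∣ seq x N - seq x n ∣
                                                 ≡⟨ solve 2 (λ x d → x :+ d :- d := x) refl (seq x n) ∣ seq x N - seq x n ∣ ⟩
      seq x n                                    ∎)

  module Reciprocal (x : ℝ) {δ : ℚ} (δ>0 : 0ℚ < δ) {N : ℕ} (δ≤x : ∀ n → N ℕ.≤ n → δ ≤ seq x n) where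

    private
      δ-nonZero : NonZero δ
      δ-nonZero = ℚₚ.pos⇒nonZero δ {{positive δ>0}}
      R : ℚ
      R = (1/ δ) {{δ-nonZero}}
      R>0 : 0ℚ < R
      R>0 = ℚₚ.positive⁻¹ R {{ℚₚ.1/pos⇒pos δ {{positive δ>0}}}}

      -- Raising every term to at least δ makes all of them invertible and changes nothing from N
      -- on.
      t : ℕ → ℚ
      t n = seq x n ⊔ δ
      t>0 : ∀ n → 0ℚ < t n
      t>0 n = ℚₚ.<-≤-trans δ>0 (ℚₚ.p≤q⊔p (seq x n) δ)
      t-nonZero : ∀ n → NonZero (t n)
      t-nonZero n = ℚₚ.pos⇒nonZero (t n) {{positive (t>0 n)}}

      r : ℕ → ℚ
      r n = (1/ t n) {{t-nonZero n}}
      r>0 : ∀ n → 0ℚ < r n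
      r>0 n = ℚₚ.positive⁻¹ (r n) {{ℚₚ.1/pos⇒pos (t n) {{positive (t>0 n)}}}}
      tr≡1 : ∀ n → t n * r n ≡ 1ℚ
      tr≡1 n = ℚₚ.*-inverseʳ (t n) {{t-nonZero n}}

      t≡x : ∀ n → N ℕ.≤ n → t n ≡ seq x n
      t≡x n N≤n = ℚₚ.p≥q⇒p⊔q≡p (δ≤x n N≤n)

      r≤R : ∀ n → r n ≤ R
      r≤R n = begin
        r n                  ≡⟨ ℚₚ.*-identityˡ (r n) ⟨
        1ℚ * r n             ≡⟨ cong (_* r n) (ℚₚ.*-inverseˡ δ {{δ-nonZero}}) ⟨
        R * δ * r n          ≡⟨ ℚₚ.*-assoc R δ (r n) ⟩
        R * (δ * r n)        ≤⟨ ℚₚ.*-monoˡ-≤-nonNeg R {{nonNegative (ℚₚ.<⇒≤ R>0)}}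
                                  (ℚₚ.*-monoʳ-≤-nonNeg (r n) {{nonNegative (ℚₚ.<⇒≤ (r>0 n))}} (ℚₚ.p≤q⊔p (seq x n) δ)) ⟩
        R * (t n * r n)      ≡⟨ cong (R *_) (tr≡1 n) ⟩
        R * 1ℚ               ≡⟨ ℚₚ.*-identityʳ R ⟩
        R                    ∎
        where open ℚₚ.≤-Reasoning

      ∣r∣≤R : ∀ n → ∣ r n ∣ ≤ R
      ∣r∣≤R n = subst (_≤ R) (sym (ℚₚ.0≤p⇒∣p∣≡p (ℚₚ.<⇒≤ (r>0 n)))) (r≤R n)

      difference : ∀ m n → r m - r n ≡ (r m * r n) * (t n - t m)
      difference m n = trans (sym (cong₂ _-_ (trans (cong (r m *_) (tr≡1 n)) (ℚₚ.*-identityʳ (r m)))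
                                             (trans (cong (r n *_) (tr≡1 m)) (ℚₚ.*-identityʳ (r n)))))
        (solve 4 (λ a b s t → a :* (t :* b) :- b :* (s :* a) := (a :* b) :* (t :- s)) refl (r m) (r n) (t m) (t n))

    reciprocal : ℝ
    seq    reciprocal = r
    cauchy reciprocal ε ε>0 =
      let (η , η>0 , RRη≡ε) = divide (ℚₚ.positive⁻¹ (R * R) {{ℚₚ.pos*pos⇒pos R {{positive R>0}} R {{positive R>0}}}}) ε>0
          (N′ , near) = cauchy x η η>0
      in N ℕ.⊔ N′ , λ m n p q → subst (_≤ ε) (cong ∣_∣ (sym (difference m n))) (subst (_ ≤_) RRη≡ε
        (∣prod∣≤ {r m * r n} {t n - t m} (∣prod∣≤ {r m} {r n} (∣r∣≤R m) (∣r∣≤R n))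
          (subst (λ d → ∣ d ∣ ≤ η) (sym (cong₂ _-_ (t≡x n (ℕₚ.≤-trans (ℕₚ.m≤m⊔n N N′) q)) (t≡x m (ℕₚ.≤-trans (ℕₚ.m≤m⊔n N N′) p))))
            (near n m (ℕₚ.≤-trans (ℕₚ.m≤n⊔m N N′) q) (ℕₚ.≤-trans (ℕₚ.m≤n⊔m N N′) p)))))

    reciprocal-inverse : ∀ n → N ℕ.≤ n → seq x n * seq reciprocal n ≡ 1ℚ
    reciprocal-inverse n N≤n = subst (λ y → y * r n ≡ 1ℚ) (t≡x n N≤n) (tr≡1 n)

  norm² : ℂ → ℝ
  norm² z = re z *ᴿ re z +ᴿ im z *ᴿ im z

  -- For each ε the dichotomy of `small-or-boundedBelow`, applied to ε², can only answer "small",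
  -- and a small sum of squares bounds both parts.
  norm²-small⇒≈0 : ∀ z → ¬ BoundedBelow (norm² z) → z ≈ᶜ 0ᶜ
  norm²-small⇒≈0 z ¬bounded = mk≈ (λ ε ε>0 → let (N , h) = small ε ε>0 in N , λ n N≤n → proj₁ (h n N≤n))
                            , mk≈ (λ ε ε>0 → let (N , h) = small ε ε>0 in N , λ n N≤n → proj₂ (h n N≤n))
    where
    a b : ℕ → ℚ
    a = seq (re z)
    b = seq (im z)
    minus0 : ∀ x → x ≡ x - 0ℚ
    minus0 = solve 1 (λ x → x := x :- con 0ℚ) refl
    ≤+ʳ : ∀ x {y} → 0ℚ ≤ y → x ≤ x + y
    ≤+ʳ x {y} 0≤y = subst (_≤ x + y) (ℚₚ.+-identityʳ x) (ℚₚ.+-monoʳ-≤ x 0≤y)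
    ≤+ˡ : ∀ x {y} → 0ℚ ≤ y → x ≤ y + x
    ≤+ˡ x {y} 0≤y = subst (_≤ y + x) (ℚₚ.+-identityˡ x) (ℚₚ.+-monoˡ-≤ x 0≤y)
    parts : ∀ {ε} → 0ℚ < ε → ∀ n → a n * a n + b n * b n ≤ ε * ε → ∣ a n - 0ℚ ∣ ≤ ε × ∣ b n - 0ℚ ∣ ≤ ε
    parts {ε} ε>0 n h =
        subst (λ x → ∣ x ∣ ≤ ε) (minus0 (a n)) (square≤⇒abs≤ {a n} ε>0 (ℚₚ.≤-trans (≤+ʳ (a n * a n) (0≤square (b n))) h))
      , subst (λ x → ∣ x ∣ ≤ ε) (minus0 (b n)) (square≤⇒abs≤ {b n} ε>0 (ℚₚ.≤-trans (≤+ˡ (b n * b n) (0≤square (a n))) h))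
    small : ∀ ε → 0ℚ < ε → ∃ λ N → ∀ n → N ℕ.≤ n → ∣ a n - 0ℚ ∣ ≤ ε × ∣ b n - 0ℚ ∣ ≤ ε
    small ε ε>0 = [ (λ (N , h) → N , λ n N≤n → parts ε>0 n (h n N≤n)) , (λ bounded → contradiction bounded ¬bounded) ]′
      (small-or-boundedBelow (norm² z) (ε * ε) (ℚₚ.positive⁻¹ (ε * ε) {{ℚₚ.pos*pos⇒pos ε {{positive ε>0}} ε {{positive ε>0}}}}))

  boundedBelow⇒≉0 : ∀ z → BoundedBelow (norm² z) → ¬ z ≈ᶜ 0ᶜ
  boundedBelow⇒≉0 z (δ , δ>0 , N , δ≤) (a≈0 , b≈0) =
    let norm²≈0 = +ᴿ-cong {re z *ᴿ re z} {0ᴿ *ᴿ 0ᴿ} {im z *ᴿ im z} {0ᴿ *ᴿ 0ᴿ}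
                    (*ᴿ-cong {re z} {0ᴿ} {re z} {0ᴿ} a≈0 a≈0) (*ᴿ-cong {im z} {0ᴿ} {im z} {0ᴿ} b≈0 b≈0)
        (N′ , h) = close norm²≈0 (½ * δ) (half>0 δ>0)
        n = N ℕ.⊔ N′
    in ℚₚ.<-irrefl refl (begin-strict
      δ                                                ≤⟨ δ≤ n (ℕₚ.m≤m⊔n N N′) ⟩
      seq (norm² z) n                                  ≤⟨ x≤y+∣x-y∣ (seq (norm² z) n) 0ℚ ⟩
      0ℚ + ∣ seq (norm² z) n - 0ℚ ∣                    ≡⟨ ℚₚ.+-identityˡ _ ⟩
      ∣ seq (norm² z) n - 0ℚ ∣                         ≤⟨ h n (ℕₚ.m≤n⊔m N N′) ⟩
      ½ * δ                                            ≡⟨ ℚₚ.+-identityʳ _ ⟨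
      ½ * δ + 0ℚ                                       <⟨ ℚₚ.+-monoʳ-< (½ * δ) (half>0 δ>0) ⟩
      ½ * δ + ½ * δ                                    ≡⟨ half+half δ ⟩
      δ                                                ∎)
    where open ℚₚ.≤-Reasoning

  boundedBelow⇒invertible : ∀ z → BoundedBelow (norm² z) → ∃ λ y → y *ᶜ z ≈ᶜ 1ᶜ
  boundedBelow⇒invertible z (δ , δ>0 , N , δ≤) = (re z *ᴿ s) +i (-ᴿ (im z *ᴿ s)) ,
      mk≈ (λ ε ε>0 → N , λ n N≤n → subst (λ x → ∣ x ∣ ≤ ε)
        (sym (trans (cong (_- 1ℚ) (trans (real (seq (re z) n) (seq (im z) n) (seq s n)) (reciprocal-inverse n N≤n))) (ℚₚ.+-inverseʳ 1ℚ)))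
        (ℚₚ.<⇒≤ ε>0))
    , pointwise (λ n → imaginary (seq (re z) n) (seq (im z) n) (seq s n))
    where
    open Reciprocal (norm² z) δ>0 δ≤
    s : ℝ
    s = reciprocal
    real : ∀ a b s → (a * s) * a - (- (b * s)) * b ≡ (a * a + b * b) * s
    real = solve 3 (λ a b s → (a :* s) :* a :- (:- (b :* s)) :* b := (a :* a :+ b :* b) :* s) refl
    imaginary : ∀ a b s → (a * s) * b + (- (b * s)) * a ≡ 0ℚ
    imaginary = solve 3 (λ a b s → (a :* s) :* b :+ (:- (b :* s)) :* a := con 0ℚ) refl

  0≤seq-re-· : ∀ n k → 0ℚ ≤ seq (re (n · 1ᶜ)) k
  0≤seq-re-· zero    k = ℚₚ.≤-refl
  0≤seq-re-· (suc n) k = ℚₚ.≤-trans (0≤seq-re-· n k)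
    (subst (_≤ 1ℚ + seq (re (n · 1ᶜ)) k) (ℚₚ.+-identityˡ (seq (re (n · 1ᶜ)) k)) (ℚₚ.+-monoˡ-≤ (seq (re (n · 1ᶜ)) k) (ℚₚ.<⇒≤ (ℚₚ.positive⁻¹ 1ℚ))))

  -- Being zero is equivalent to the negation of `BoundedBelow (norm² z)`, and negations are stable.
  -- A bound from below yields the inverse as conjugate over `norm²`; whether there is one is
  -- decided only under the double negation that `invertible` permits.
  ℂ-isStableField : IsStableField ℂ-commutativeRing
  ℂ-isStableField = record
    { ≈0-stable  = λ {z} ¬¬z≈0 → norm²-small⇒≈0 z (λ bounded → ¬¬z≈0 (boundedBelow⇒≉0 z bounded))
    ; invertible = λ {z} z≉0 → do
        yes bounded ← ¬¬-excluded-middle {A = BoundedBelow (norm² z)}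
          where no ¬bounded → contradiction (norm²-small⇒≈0 z ¬bounded) z≉0
        return (boundedBelow⇒invertible z bounded)
    ; characteristic-zero = λ n (re≈0 , _) →
        let (N , h) = close re≈0 ½ (ℚₚ.positive⁻¹ ½)
            x = seq (re (n · 1ᶜ)) N
        in ℚₚ.<-irrefl refl (begin-strict
          1ℚ                        ≡⟨ ℚₚ.+-identityʳ 1ℚ ⟨
          1ℚ + 0ℚ                   ≤⟨ ℚₚ.+-monoʳ-≤ 1ℚ (0≤seq-re-· n N) ⟩
          1ℚ + x                    ≤⟨ x≤y+∣x-y∣ (1ℚ + x) 0ℚ ⟩
          0ℚ + ∣ 1ℚ + x - 0ℚ ∣      ≡⟨ ℚₚ.+-identityˡ _ ⟩
          ∣ 1ℚ + x - 0ℚ ∣           ≤⟨ h N ℕₚ.≤-refl ⟩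
          ½                         <⟨ ½<1 ⟩
          1ℚ                        ∎)
    }
    where
    open ℚₚ.≤-Reasoning
    ½<1 : ½ < 1ℚ
    ½<1 = *<* (ℤ.+<+ (ℕ.s<s ℕ.z<s))

-- The theorem over ℂ.

open Arithmetic
open RationalBounds
open ComplexNumbers using (ℂ-isStableField)
open import Algebra.Bundles using (CommutativeRing)
import Algebra.Properties.Monoid.Sum as MonoidSum
import Algebra.Properties.Semiring.Sum as SemiringSum
open import Algebra.Module.Bundles using (Module)
open import Algebra.Module.Morphism.Structures using (IsModuleHomomorphism)
open import Data.Fin.Base using (Fin; zero; suc; _↑ˡ_; splitAt)
open import Data.Fin.Properties using (splitAt-↑ˡ)
import Data.Nat.Properties as ℕₚ
import Data.Rational.Properties as ℚₚ
open import Data.List.Base using (length)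
open import Data.Maybe.Base using (Maybe; just; nothing)
open import Data.Product.Base using (_,_)
open import Data.Sum.Base using ([_,_]′)
open import Function.Base using (_∘_; const)
open import Function.Bundles using (Inverse)
open import Relation.Binary.PropositionalEquality using (_≡_; refl; trans; cong; subst)
open import Defs
open import Data.Integer.Base using (+_; _⊖_)
open import Data.Nat.Base as ℕ using (ℕ; suc)
open import Data.Product.Base using (∃; _×_)
open import Data.Rational.Base using (_+_; _-_; _*_; _/_; _≤_)

module Decomposed {c ℓ} (K : CommutativeRing c ℓ) (K-isStableField : IsStableField K) {n r : ℕ}
  (T : Linear.RankDecomposition K (Linear.matrixMultiplication K n n n) r) where

  private
    module K = CommutativeRing K
    module L = Linear K
    module T = L.RankDecomposition T
    module Form {m k} (f : L.LinearForm (L.Mat m k)) = IsModuleHomomorphism (L.isLinear f)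
  open OverStableField K K-isStableField using (_⊸_; Digits; digits↔; Square; module Count)
  open SemiringSum K.semiring using (sum)
  open MonoidSum (Module.+ᴹ-monoid (L.Mat n n)) using () renaming (sum to sumᴹ)

  forms : ∀ {A : Set} → (A → L.LinearForm (L.Mat n n)) → Square n ⊸ A
  forms f = record
    { app      = λ X a → L.form (f a) (λ i j → X (i , j))
    ; app-cong = λ X≈Y a → Form.⟦⟧-cong (f a) (λ i j → X≈Y (i , j))
    ; app-+    = λ X Y a → Form.+ᴹ-homo (f a) (λ i j → X (i , j)) (λ i j → Y (i , j))
    ; app-*    = λ c X a → Form.*ₗ-homo (f a) c (λ i j → X (i , j))
    }

  sumᴹ-entry : ∀ {r} (t : Fin r → Fin n → Fin n → K.Carrier) i j → sumᴹ t i j ≡ sum (λ l → t l i j)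
  sumᴹ-entry {ℕ.zero} t i j = refl
  sumᴹ-entry {suc r}  t i j = cong (t zero i j K.+_) (sumᴹ-entry (t ∘ suc) i j)

  bound : ∀ ds {s} → size ds ℕ.+ s ≡ n →
          length ds ℕ.* size ds ℕ.* n ℕ.+ 2 ℕ.* suc (length ds) ℕ.* (n ℕ.* n) ℕ.≤
          suc (length ds) ℕ.* (r ℕ.+ (n ℕ.+ 2 ℕ.* (binomial (double (length ds)) (length ds ⊖ 1) ℕ.* size ds)))
  bound ds {s} refl = cancel-central (length ds) (size ds) n r
    (Count.rank-bound {ds} {n} {r} embed project project-embed (forms T.u) (λ l → forms (const (T.v l))) (λ l (i , k) → T.w l i k)
      (λ X Y i k → K.trans (T.decomposes (λ i j → X (i , j)) (λ i j → Y (i , j)) i k) (K.reflexive (sumᴹ-entry {r} _ i k))))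
    where
    -- The digits occupy the first `size ds` coordinates of K^n; the last s coordinates are the
    -- ignored remainder.
    embed : Digits ds → Fin n
    embed t = Inverse.to (digits↔ ds) t ↑ˡ s
    project : Fin n → Maybe (Digits ds)
    project i = [ just ∘ Inverse.from (digits↔ ds) , const nothing ]′ (splitAt (size ds) i)
    project-embed : ∀ t → project (embed t) ≡ just t
    project-embed t = trans (cong [ just ∘ Inverse.from (digits↔ ds) , const nothing ]′ (splitAt-↑ˡ (size ds) (Inverse.to (digits↔ ds) t) s))
      (cong just (Inverse.strictlyInverseʳ (digits↔ ds) t))

rank-bound : ∀ {n r} → RankDecomposition M⟨ n , n , n ⟩ r → n ℕ.≥ 1 → ∀ p → Bound p n r
rank-bound {n} {r} T n≥1 p = bound-p {n} {r} (Decomposed.bound ℂ-commutativeRing ℂ-isStableField T) n≥1 p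

parameter-bound : ∀ n → n ℕ.≥ 1 → threshold (parameter n) ℕ.≤ n
parameter-bound (suc n) _ = threshold-parameter n

-- The parameter p grows with n, slowly enough that `threshold p` stays at most n and fast enough to
-- be unbounded.
deficit : ℕ → ℝ
deficit n = fromℚ (error (parameter n) n)

deficit-littleO : IsLittleO-n² deficit
deficit-littleO ε (η , η>0 , N , η≤ε) =
  let η/2 = ℚ.½ * η
      η/2>0 = Estimates.half>0 η>0
      (d , h) = archimedean η/2 η/2>0
      (N′ , d≤) = parameter-unbounded d
  -- Half of η bounds the ratio 2/(p+1); the other half is the gap that the strict inequality `_<ᴿ_`
  -- demands.
  in N′ , λ n N′≤n → η/2 , η/2>0 , N , λ k N≤k → begin
    ℚ.∣ error (parameter n) n * _ ∣ + η/2    ≤⟨ ℚₚ.+-monoˡ-≤ η/2 (error-ratio (parameter n) n η/2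
                                                  (h (parameter n) (ℕₚ.≤-trans d≤ (parameter-mono (ℕₚ.≤⇒≤′ N′≤n))))) ⟩
    η/2 + η/2                                ≡⟨ Estimates.half+half η ⟩
    η                                        ≡⟨ ℚₚ.+-identityˡ η ⟨
    ℚ.0ℚ + η                                 ≤⟨ η≤ε k N≤k ⟩
    seq ε k                                  ∎
  where
  import Data.Rational.Base as ℚ
  open ℚₚ.≤-Reasoning

theorem1p2 : (∀ (n p : ℕ) → n ℕ.≥ 1 → p ℕ.≤ n ℕ.∸ 1 →
    ∀ r → IsRank M⟨ n , n , n ⟩ r →
    (ℕ→ℚ 3 - + 1 / suc p) * ℕ→ℚ (n ℕ.^ 2)
    - ℕ→ℚ (1 ℕ.+ 2 ℕ.* p ℕ.* binomial (2 ℕ.* p) (p ⊖ 1)) * ℕ→ℚ n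
    ≤ ℕ→ℚ r)
    × (∃ λ (f : ℕ → ℝ) → IsLittleO-n² f ×
    (∀ n → n ℕ.≥ 1 → ∀ r → IsRank M⟨ n , n , n ⟩ r →
    fromℚ (ℕ→ℚ (3 ℕ.* n ℕ.^ 2)) -ᴿ f n ≤ᴿ fromℚ (ℕ→ℚ r)))
theorem1p2 =
    (λ n p n≥1 _ r (T , _) → Bound⇒rational p n r (rank-bound T n≥1 p))
  , deficit , deficit-littleO , λ n n≥1 r (T , _) ε ε>0 → 0 , λ _ _ →
      ℚₚ.≤-trans (Bound⇒error (parameter n) n r (rank-bound T n≥1 (parameter n)) (parameter-bound n n≥1))
        (subst (_≤ ℕ→ℚ r + ε) (ℚₚ.+-identityʳ (ℕ→ℚ r)) (ℚₚ.+-monoʳ-≤ (ℕ→ℚ r) (ℚₚ.<⇒≤ ε>0)))
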